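{- Let $K$ be a finite field of characteristic $p$ and order $q$, and let $s$ be a positive integer with $\gcd(s,q-1)=1$. For any $t_1,t_2,t_3\in K^\times$: (i) $\sum_{u\in K^\times}W_u=q$; (ii) $\sum_{u\in K^\times}W_{t_1u}W_{t_2u}=q^2$ if $t_1=t_2$ and $=0$ if $t_1\neq t_2$; (iii) $\sum_{u\in K^\times}W_{t_1u}W_{t_2u}W_{t_3u}=q^2\,V^{[t_1,t_2]}_{1/t_3}$; (iv) $\sum_{u\in K^\times}W_u^4=q^2\sum_{u\in K^\times}\bigl(V^{[1,1]}_u\bigr)^2$.
   Context: $\zeta=\exp(2\pi i/p)$, $\psi(x)=\zeta^{\mathrm{Tr}(x)}$ with $\mathrm{Tr}\colon K\to\mathbb{F}_p$ the absolute trace, $W_u=\sum_{x\in K}\psi(x^s-ux)$. For $(t_1,t_2)\in(K^\times)^2$ and $a,b\in K$, $Q^{(t_1,t_2)}_{a,b}$ is the number of $(v_1,v_2)\in K^2$ with $t_1v_1+t_2v_2=a$ and $v_1^s+v_2^s=b^s$, and for $u\in K^\times$, $V^{[t_1,t_2]}_u=Q^{(t_1,t_2)}_{1,u}-Q^{(t_1,t_2)}_{1,0}$. -}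

module Defs where

open import Level using (0ℓ)
open import Data.Nat as ℕ using (ℕ; zero; suc; NonZero; _%_; _<_)
open import Data.Integer as ℤ using (ℤ; +_; 0ℤ; 1ℤ)
open import Data.Bool using (Bool; true; false; if_then_else_)
open import Data.List using (List; []; _∷_; map; filter; length; cartesianProduct; foldr; upTo)
open import Data.List.Membership.Propositional using (_∈_)
open import Data.List.Relation.Unary.Unique.Propositional using (Unique)
open import Data.Product using (_×_; _,_; ∃-syntax)
open import Relation.Nullary using (¬_; does)
open import Relation.Nullary.Decidable using (_×-dec_; ¬?)
open import Relation.Binary.Definitions using (DecidableEquality)
open import Relation.Binary.PropositionalEquality using (_≡_; _≢_)
open import Algebra.Structures using (IsCommutativeRing)

-- Finite fields (equality is propositional equality).
-- `inv` is total; only its values on nonzero elements are specified.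

record FiniteField : Set₁ where
  infixl 6 _+_ _-_
  infixl 7 _*_
  field
    Carrier : Set
    _+_ _*_ : Carrier → Carrier → Carrier
    -_      : Carrier → Carrier
    0# 1#   : Carrier
    isCommutativeRing : IsCommutativeRing _≡_ _+_ _*_ -_ 0# 1#
    0≢1     : 0# ≢ 1#
    inv     : Carrier → Carrier
    inv-r   : ∀ x → x ≢ 0# → x * inv x ≡ 1#
    _≟_     : DecidableEquality Carrier
    elements          : List Carrier
    elements-complete : ∀ x → x ∈ elements
    elements-unique   : Unique elements

  _-_ : Carrier → Carrier → Carrier
  x - y = x + (- y)

  order : ℕ
  order = length elements

  _^_ : Carrier → ℕ → Carrier
  x ^ zero  = 1#
  x ^ suc n = x * (x ^ n)

  fromℕ : ℕ → Carrier
  fromℕ zero    = 0#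
  fromℕ (suc n) = 1# + fromℕ n

  units : List Carrier
  units = filter (λ x → ¬? (x ≟ 0#)) elements

-- The cyclotomic ring ℤ[ζ] ⊂ ℂ, ζ = exp(2πi/p), p prime.
-- An element Σ_{i<p} f(i) ζ^i is encoded by its coefficients f(0..p-1)
-- (a function ℕ → ℤ, only the values at i < p matter).  Since the only
-- ℤ-linear relation among 1, ζ, …, ζ^{p-1} is 1 + ζ + … + ζ^{p-1} = 0,
-- two such sums are equal in ℂ iff their coefficient vectors differ by a
-- constant vector.

Cyc : Set
Cyc = ℕ → ℤ

module _ (p : ℕ) .{{_ : NonZero p}} where

  _≈ᶜ_ : Cyc → Cyc → Set
  f ≈ᶜ g = ∃[ c ] (∀ i → i < p → f i ≡ g i ℤ.+ c)

  intᶜ : ℤ → Cyc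
  intᶜ n zero    = n
  intᶜ n (suc _) = 0ℤ

  ζ^ : ℕ → Cyc
  ζ^ k i = if does (i ℕ.≟ (k % p)) then 1ℤ else 0ℤ

  _+ᶜ_ : Cyc → Cyc → Cyc
  (f +ᶜ g) i = f i ℤ.+ g i

  -- product (ζ^i ζ^j = ζ^{(i+j) mod p})
  _*ᶜ_ : Cyc → Cyc → Cyc
  (f *ᶜ g) k = foldr ℤ._+_ 0ℤ (map (λ i → f i ℤ.* g ((k ℕ.+ (p ℕ.∸ i)) % p)) (upTo p))

  sumᶜ : List Cyc → Cyc
  sumᶜ = foldr _+ᶜ_ (intᶜ 0ℤ)

module Paper (F : FiniteField) (p n s : ℕ) .{{_ : NonZero p}} where
  open FiniteField F

  Tr : Carrier → Carrier
  Tr x = foldr _+_ 0# (map (λ i → x ^ (p ℕ.^ i)) (upTo n))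

  -- identification of the prime field with {0,…,p-1}:
  -- the least k < p with k·1 = y  (default 0, never used since Tr lands in F_p)
  primeIndex : Carrier → ℕ
  primeIndex y = go (upTo p)
    where
    go : List ℕ → ℕ
    go []       = 0
    go (k ∷ ks) = if does (fromℕ k ≟ y) then k else go ks

  ψ : Carrier → Cyc
  ψ x = ζ^ p (primeIndex (Tr x))

  W : Carrier → Cyc
  W u = sumᶜ p (map (λ x → ψ ((x ^ s) - u * x)) elements)

  Q : Carrier → Carrier → Carrier → Carrier → ℕ
  Q t₁ t₂ a b = length (filter
    (λ { (v₁ , v₂) → ((t₁ * v₁ + t₂ * v₂) ≟ a) ×-dec (((v₁ ^ s) + (v₂ ^ s)) ≟ (b ^ s)) })
    (cartesianProduct elements elements))

  V : Carrier → Carrier → Carrier → ℤ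
  V t₁ t₂ u = (+ Q t₁ t₂ 1# u) ℤ.- (+ Q t₁ t₂ 1# 0#)

{-# OPTIONS --safe #-}
module Submission where

-- Multiplying out the Weil sums turns each moment into a sum over u ∈ K^× and v ∈ K^k of
-- ψ(A(v) + u B(v)), with A(v) = Σ vᵢ^s and B linear. By orthogonality of ψ the sum over u counts
-- the zeros of B, after discarding u = 0, whose contribution Σ_v ψ(A(v)) vanishes because x ↦ x^s
-- permutes K (gcd(s, q - 1) = 1).
-- On B = 0 the last coordinate is determined; grouping the remaining points by the value w of the
-- linear form and rescaling by w reduces everything to sums over the line t₁x + t₂y = 1, where
-- Σ_{w ≠ 0} ψ(w^s d) = q [d = 0] - 1 produces the point counts Q. The line through 0 contributes
-- only when t₁ = t₂, since x^s + y^s = (1 - (t₁/t₂)^s) x^s on it.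
-- Elements of ℤ[ζ] are coefficient vectors up to an additive constant (Defs), so equalities are
-- proved coefficientwise (_≐_) or up to a constant (_≈_).

open import Defs
open import Data.Nat using (ℕ; NonZero; _<_; _∸_)
open import Data.Nat.GCD using (gcd)
open import Data.Nat.Primality using (Prime)
open import Relation.Binary.PropositionalEquality using (_≡_; _≢_)

module Sums where
  open import Data.Integer as ℤ using (ℤ; 0ℤ; 1ℤ)
  open import Data.Integer.Solver using (module +-*-Solver)
  open import Relation.Nullary.Decidable using (_×-dec_)
  import Data.Integer.Properties as ℤP
  open import Data.Nat using (ℕ; zero; suc)
  open import Data.List using (List; []; _∷_; map; foldr; filter; length; _++_; cartesianProduct; applyUpTo)
  open import Data.List.Membership.Propositional using (_∈_)
  open import Data.List.Relation.Unary.Any using (here; there)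
  open import Data.List.Relation.Unary.All using (All; []; _∷_)
  import Data.List.Relation.Unary.All as All
  open import Data.List.Relation.Unary.AllPairs using (_∷_)
  open import Data.List.Relation.Unary.Unique.Propositional using (Unique)
  open import Data.Product using (_×_; _,_)
  open import Data.Bool using (if_then_else_)
  open import Relation.Nullary using (Dec; yes; no; does; ¬_; ¬?)
  open import Relation.Unary using (Pred; Decidable)
  open import Relation.Binary.Definitions using (DecidableEquality)
  open import Relation.Binary.PropositionalEquality
  open import Algebra.Bundles using (CommutativeSemigroup)
  open import Algebra.Structures using (IsCommutativeMonoid)
  import Algebra.Properties.CommutativeSemigroup as CommutativeSemigroupProperties
  open import Data.Empty using (⊥-elim)
  open import Function using (_∘_)

  module Generic {C : Set} {_∙_ : C → C → C} {ε : C}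
                 (isCommutativeMonoid : IsCommutativeMonoid _≡_ _∙_ ε) where
    open IsCommutativeMonoid isCommutativeMonoid using (assoc; identityˡ; identityʳ; isCommutativeSemigroup)

    commutativeSemigroup : CommutativeSemigroup _ _
    commutativeSemigroup = record { isCommutativeSemigroup = isCommutativeSemigroup }

    open CommutativeSemigroupProperties commutativeSemigroup using (interchange)

    Σ : {A : Set} → List A → (A → C) → C
    Σ L f = foldr _∙_ ε (map f L)

    ind : {P : Set} → Dec P → C → C
    ind d a = if does d then a else ε

    module _ {A : Set} where
      Σ-cong : ∀ (L : List A) {f g : A → C} → (∀ x → f x ≡ g x) → Σ L f ≡ Σ L g
      Σ-cong [] eq = refl
      Σ-cong (x ∷ L) eq = cong₂ _∙_ (eq x) (Σ-cong L eq)

      Σ-cong-∈ : ∀ (L : List A) {f g : A → C} → (∀ x → x ∈ L → f x ≡ g x) → Σ L f ≡ Σ L g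
      Σ-cong-∈ [] eq = refl
      Σ-cong-∈ (x ∷ L) eq = cong₂ _∙_ (eq x (here refl)) (Σ-cong-∈ L (λ y y∈ → eq y (there y∈)))

      Σ-∙ : ∀ (L : List A) (f g : A → C) → Σ L (λ x → f x ∙ g x) ≡ Σ L f ∙ Σ L g
      Σ-∙ [] f g = sym (identityˡ ε)
      Σ-∙ (x ∷ L) f g = trans (cong ((f x ∙ g x) ∙_) (Σ-∙ L f g)) (interchange (f x) (g x) (Σ L f) (Σ L g))

      Σ-ε : ∀ (L : List A) → Σ L (λ _ → ε) ≡ ε
      Σ-ε [] = refl
      Σ-ε (x ∷ L) = trans (identityˡ _) (Σ-ε L)

      Σ-++ : ∀ (L M : List A) (f : A → C) → Σ (L ++ M) f ≡ Σ L f ∙ Σ M f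
      Σ-++ [] M f = sym (identityˡ _)
      Σ-++ (x ∷ L) M f = trans (cong (f x ∙_) (Σ-++ L M f)) (sym (assoc (f x) (Σ L f) (Σ M f)))

      Σ-ind : ∀ (L : List A) {P : Set} (d : Dec P) (f : A → C) → Σ L (λ x → ind d (f x)) ≡ ind d (Σ L f)
      Σ-ind L (yes _) f = refl
      Σ-ind L (no _) f = Σ-ε L

      Σ-filter : ∀ {P : Pred A _} (P? : Decidable P) (L : List A) (f : A → C) →
                 Σ (filter P? L) f ≡ Σ L (λ x → ind (P? x) (f x))
      Σ-filter P? [] f = refl
      Σ-filter P? (x ∷ L) f with P? x
      ... | yes _ = cong (f x ∙_) (Σ-filter P? L f)
      ... | no _ = trans (Σ-filter P? L f) (sym (identityˡ _))

    Σ-map : ∀ {A B : Set} (g : A → B) (L : List A) (f : B → C) → Σ (map g L) f ≡ Σ L (f ∘ g)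
    Σ-map g [] f = refl
    Σ-map g (x ∷ L) f = cong (f (g x) ∙_) (Σ-map g L f)

    module _ {A B : Set} where
      Σ-swap : ∀ (L : List A) (M : List B) (f : A → B → C) →
               Σ L (λ a → Σ M (λ b → f a b)) ≡ Σ M (λ b → Σ L (λ a → f a b))
      Σ-swap [] M f = sym (Σ-ε M)
      Σ-swap (x ∷ L) M f = trans (cong (Σ M (f x) ∙_) (Σ-swap L M f)) (sym (Σ-∙ M (f x) (λ b → Σ L (λ a → f a b))))

      Σ-cartesianProduct : ∀ (L : List A) (M : List B) (g : A × B → C) →
                           Σ (cartesianProduct L M) g ≡ Σ L (λ a → Σ M (λ b → g (a , b)))
      Σ-cartesianProduct [] M g = refl
      Σ-cartesianProduct (x ∷ L) M g = trans (Σ-++ (map (x ,_) M) (cartesianProduct L M) g)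
        (cong₂ _∙_ (Σ-map (x ,_) M g) (Σ-cartesianProduct L M g))

    Σ-applyUpTo-last : ∀ (h : ℕ → ℕ) m (f : ℕ → C) → Σ (applyUpTo h (suc m)) f ≡ Σ (applyUpTo h m) f ∙ f (h m)
    Σ-applyUpTo-last h zero f = trans (identityʳ _) (sym (identityˡ _))
    Σ-applyUpTo-last h (suc m) f = trans (cong (f (h 0) ∙_) (Σ-applyUpTo-last (λ x → h (suc x)) m f)) (sym (assoc _ _ _))

    Σ-applyUpTo-suc : ∀ (h : ℕ → ℕ) m (f : ℕ → C) → Σ (applyUpTo h m) (λ i → f (suc i)) ≡ Σ (applyUpTo (λ i → suc (h i)) m) f
    Σ-applyUpTo-suc h zero f = refl
    Σ-applyUpTo-suc h (suc m) f = cong (f (suc (h 0)) ∙_) (Σ-applyUpTo-suc (λ x → h (suc x)) m f)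

    ind-⇔ : ∀ {P Q : Set} (d : Dec P) (e : Dec Q) → (P → Q) → (Q → P) → ∀ a → ind d a ≡ ind e a
    ind-⇔ (yes p) (yes q) f g a = refl
    ind-⇔ (yes p) (no ¬q) f g a = ⊥-elim (¬q (f p))
    ind-⇔ (no ¬p) (yes q) f g a = ⊥-elim (¬p (g q))
    ind-⇔ (no ¬p) (no ¬q) f g a = refl

    ind-yes : ∀ {P : Set} (d : Dec P) → P → ∀ a → ind d a ≡ a
    ind-yes (yes _) p a = refl
    ind-yes (no ¬p) p a = ⊥-elim (¬p p)

    ind-no : ∀ {P : Set} (d : Dec P) → ¬ P → ∀ a → ind d a ≡ ε
    ind-no (yes p) ¬p a = ⊥-elim (¬p p)
    ind-no (no _) ¬p a = refl

    ind-∙-ind-¬ : ∀ {P : Set} (d : Dec P) (a : C) → a ≡ ind d a ∙ ind (¬? d) a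
    ind-∙-ind-¬ (yes _) a = sym (identityʳ a)
    ind-∙-ind-¬ (no _) a = sym (identityˡ a)

    module WithDecidableEquality {A : Set} (_≟_ : DecidableEquality A) where

      Σ-delta-∉ : ∀ (L : List A) (a : A) (f : A → C) → All (λ x → x ≢ a) L → Σ L (λ x → ind (x ≟ a) (f x)) ≡ ε
      Σ-delta-∉ [] a f [] = refl
      Σ-delta-∉ (x ∷ L) a f (x≢a ∷ all) = trans (cong₂ _∙_ (ind-no (x ≟ a) x≢a (f x)) (Σ-delta-∉ L a f all)) (identityˡ _)

      Σ-delta : ∀ (L : List A) (a : A) (f : A → C) → Unique L → a ∈ L → Σ L (λ x → ind (x ≟ a) (f x)) ≡ f a
      Σ-delta (x ∷ L) a f (x∉ ∷ u) a∈ with x ≟ a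
      ... | yes refl = trans (cong (f x ∙_) (Σ-delta-∉ L x f (All.map (λ ne eq → ne (sym eq)) x∉))) (identityʳ _)
      ... | no x≢a with a∈
      ...   | here a≡x = ⊥-elim (x≢a (sym a≡x))
      ...   | there a∈L = trans (identityˡ _) (Σ-delta L a f u a∈L)

      Σ-bijection : ∀ (E : List A) → Unique E → (∀ x → x ∈ E) →
                    (σ τ : A → A) → (∀ y → σ (τ y) ≡ y) → (∀ x → τ (σ x) ≡ x) →
                    (f : A → C) → Σ E (λ x → f (σ x)) ≡ Σ E f
      Σ-bijection E u c σ τ στ τσ f = begin
        Σ E (λ x → f (σ x)) ≡⟨ Σ-cong E (λ x → sym (Σ-delta E (σ x) f u (c (σ x)))) ⟩
        Σ E (λ x → Σ E (λ y → ind (y ≟ σ x) (f y))) ≡⟨ Σ-swap E E _ ⟩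
        Σ E (λ y → Σ E (λ x → ind (y ≟ σ x) (f y))) ≡⟨ Σ-cong E (λ y → Σ-cong E (λ x →
            ind-⇔ (y ≟ σ x) (x ≟ τ y) (λ eq → trans (sym (τσ x)) (cong τ (sym eq))) (λ eq → trans (sym (στ y)) (cong σ (sym eq))) (f y))) ⟩
        Σ E (λ y → Σ E (λ x → ind (x ≟ τ y) (f y))) ≡⟨ Σ-cong E (λ y → Σ-delta E (τ y) (λ _ → f y) u (c (τ y))) ⟩
        Σ E f ∎
        where open ≡-Reasoning

      Σ-remove : ∀ (E : List A) (a : A) → Unique E → a ∈ E → (f : A → C) →
                 Σ E f ≡ f a ∙ Σ (filter (λ x → ¬? (x ≟ a)) E) f
      Σ-remove E a u a∈ f = begin
        Σ E f ≡⟨ Σ-cong E (λ x → ind-∙-ind-¬ (x ≟ a) (f x)) ⟩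
        Σ E (λ x → ind (x ≟ a) (f x) ∙ ind (¬? (x ≟ a)) (f x)) ≡⟨ Σ-∙ E _ _ ⟩
        Σ E (λ x → ind (x ≟ a) (f x)) ∙ Σ E (λ x → ind (¬? (x ≟ a)) (f x)) ≡⟨ cong₂ _∙_ (Σ-delta E a f u a∈) (sym (Σ-filter (λ x → ¬? (x ≟ a)) E f)) ⟩
        f a ∙ Σ (filter (λ x → ¬? (x ≟ a)) E) f ∎
        where open ≡-Reasoning

  open Generic ℤP.+-0-isCommutativeMonoid public

  module _ {A : Set} where
    Σ-*ˡ : ∀ (L : List A) (c : ℤ) (f : A → ℤ) → Σ L (λ x → c ℤ.* f x) ≡ c ℤ.* Σ L f
    Σ-*ˡ [] c f = sym (ℤP.*-zeroʳ c)
    Σ-*ˡ (x ∷ L) c f = trans (cong (λ z → c ℤ.* f x ℤ.+ z) (Σ-*ˡ L c f)) (sym (ℤP.*-distribˡ-+ c (f x) (Σ L f)))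

    Σ-*ʳ : ∀ (L : List A) (f : A → ℤ) c → Σ L f ℤ.* c ≡ Σ L (λ x → f x ℤ.* c)
    Σ-*ʳ L f c = trans (ℤP.*-comm _ c) (trans (sym (Σ-*ˡ L c f)) (Σ-cong L (λ x → ℤP.*-comm c (f x))))

    Σ-neg : ∀ (L : List A) (f : A → ℤ) → Σ L (λ x → ℤ.- f x) ≡ ℤ.- Σ L f
    Σ-neg [] f = refl
    Σ-neg (x ∷ L) f = trans (cong (λ z → ℤ.- f x ℤ.+ z) (Σ-neg L f)) (sym (ℤP.neg-distrib-+ (f x) (Σ L f)))

    Σ-const : ∀ (L : List A) (c : ℤ) → Σ L (λ _ → c) ≡ ℤ.+ length L ℤ.* c
    Σ-const [] c = sym (ℤP.*-zeroˡ c)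
    Σ-const (x ∷ L) c = trans (cong (λ z → c ℤ.+ z) (Σ-const L c))
      (trans (cong (λ z → z ℤ.+ ℤ.+ length L ℤ.* c) (sym (ℤP.*-identityˡ c))) (sym (ℤP.*-distribʳ-+ c 1ℤ (ℤ.+ length L))))

    length-filter : ∀ {P : Pred A _} (P? : Decidable P) (L : List A) →
                    ℤ.+ length (filter P? L) ≡ Σ L (λ x → ind (P? x) 1ℤ)
    length-filter P? [] = refl
    length-filter P? (x ∷ L) with P? x
    ... | yes _ = trans (ℤP.pos-+ 1 (length (filter P? L))) (cong (λ z → 1ℤ ℤ.+ z) (length-filter P? L))
    ... | no _ = trans (length-filter P? L) (sym (ℤP.+-identityˡ _))

  ind-× : ∀ {P Q : Set} (d : Dec P) (e : Dec Q) a → ind d (ind e a) ≡ ind (d ×-dec e) a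
  ind-× (yes _) (yes _) a = refl
  ind-× (yes _) (no _) a = refl
  ind-× (no _) (yes _) a = refl
  ind-× (no _) (no _) a = refl

  ind≡*ind1 : ∀ {P : Set} (d : Dec P) c → ind d c ≡ c ℤ.* ind d 1ℤ
  ind≡*ind1 (yes _) c = sym (ℤP.*-identityʳ c)
  ind≡*ind1 (no _) c = sym (ℤP.*-zeroʳ c)

  ind1*≡ind : ∀ {P : Set} (d : Dec P) t → ind d 1ℤ ℤ.* t ≡ ind d t
  ind1*≡ind (yes _) t = ℤP.*-identityˡ t
  ind1*≡ind (no _) t = ℤP.*-zeroˡ t

  ind-ind1*≡ind-ind : ∀ {P Q : Set} (d : Dec P) (e : Dec Q) c → ind d (ind e 1ℤ) ℤ.* c ≡ ind d (ind e c)
  ind-ind1*≡ind-ind (yes _) e c = ind1*≡ind e c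
  ind-ind1*≡ind-ind (no _) _ c = ℤP.*-zeroˡ c

  module _ where
    open +-*-Solver

    ind-[ind-1] : ∀ {P Q : Set} (d : Dec P) (e : Dec Q) c →
                  ind d (ind e c ℤ.- 1ℤ) ≡ c ℤ.* ind d (ind e 1ℤ) ℤ.- ind d 1ℤ
    ind-[ind-1] (yes _) (yes _) c = solve 1 (λ c → c :- con 1ℤ := c :* con 1ℤ :- con 1ℤ) refl c
    ind-[ind-1] (yes _) (no _) c = solve 1 (λ c → con 0ℤ :- con 1ℤ := c :* con 0ℤ :- con 1ℤ) refl c
    ind-[ind-1] (no _) (yes _) c = solve 1 (λ c → con 0ℤ := c :* con 0ℤ :- con 0ℤ) refl c
    ind-[ind-1] (no _) (no _) c = solve 1 (λ c → con 0ℤ := c :* con 0ℤ :- con 0ℤ) refl c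

    ind-[c*x-c] : ∀ {P : Set} (d : Dec P) c x → ind d (c ℤ.* x ℤ.- c) ≡ c ℤ.* ind d x ℤ.- c ℤ.* ind d 1ℤ
    ind-[c*x-c] (yes _) c x = solve 2 (λ c x → c :* x :- c := c :* x :- c :* con 1ℤ) refl c x
    ind-[c*x-c] (no _) c x = solve 2 (λ c x → con 0ℤ := c :* con 0ℤ :- c :* con 0ℤ) refl c x

module Field (F : FiniteField) where
  open import Data.Nat as ℕ using (ℕ; zero; suc; NonZero; _≤_; s≤s; z≤n)
  import Data.Nat.Properties as ℕP
  open import Data.Integer as ℤ using (ℤ; -[1+_])
  open import Data.Sign as Sign using (Sign)
  import Data.Integer.Properties as ℤP
  open import Data.List using (List; []; _∷_; length)
  open import Data.List.Membership.Propositional using (_∈_)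
  open import Data.List.Membership.Propositional.Properties using (∈-filter⁺; ∈-filter⁻)
  open import Data.Product using (proj₂)
  open import Data.Maybe using (Maybe; just; nothing)
  open import Data.Sum using (inj₁; inj₂)
  open import Relation.Nullary using (Dec; yes; no; ¬?)
  open import Relation.Binary.PropositionalEquality
  open import Algebra.Bundles using (CommutativeRing)
  open import Algebra.Structures using (IsCommutativeRing)
  open import Algebra.Solver.Ring.AlmostCommutativeRing

  open FiniteField F public renaming (_≟_ to _≟F_)
  open IsCommutativeRing isCommutativeRing public
    using (+-assoc; +-comm; *-assoc; *-comm; distribˡ; distribʳ; zeroˡ; zeroʳ;
           +-identityˡ; +-identityʳ; *-identityˡ; *-identityʳ; -‿inverseˡ; -‿inverseʳ;
           +-isCommutativeMonoid; *-isCommutativeMonoid)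

  CR : CommutativeRing _ _
  CR = record { isCommutativeRing = isCommutativeRing }

  open import Algebra.Properties.Ring (CommutativeRing.ring CR) public
    using (-‿distribˡ-*; -‿distribʳ-*; -‿involutive; -0#≈0#; -‿+-comm)

  ACR : AlmostCommutativeRing _ _
  ACR = fromCommutativeRing CR

  fromℕ-+ : ∀ a b → fromℕ (a ℕ.+ b) ≡ fromℕ a + fromℕ b
  fromℕ-+ zero b = sym (+-identityˡ _)
  fromℕ-+ (suc a) b = trans (cong (1# +_) (fromℕ-+ a b)) (sym (+-assoc _ _ _))

  fromℕ-* : ∀ a b → fromℕ (a ℕ.* b) ≡ fromℕ a * fromℕ b
  fromℕ-* zero b = sym (zeroˡ _)
  fromℕ-* (suc a) b = begin
    fromℕ (b ℕ.+ a ℕ.* b) ≡⟨ fromℕ-+ b (a ℕ.* b) ⟩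
    fromℕ b + fromℕ (a ℕ.* b) ≡⟨ cong₂ _+_ (sym (*-identityˡ _)) (fromℕ-* a b) ⟩
    1# * fromℕ b + fromℕ a * fromℕ b ≡⟨ sym (distribʳ _ _ _) ⟩
    (1# + fromℕ a) * fromℕ b ∎
    where open ≡-Reasoning

  σ : Sign → Carrier → Carrier
  σ Sign.+ a = a
  σ Sign.- a = - a

  ι′ : ℤ → Carrier
  ι′ z = σ (ℤ.sign z) (fromℕ ℤ.∣ z ∣)

  ι′-◃ : ∀ s n → ι′ (s ℤ.◃ n) ≡ σ s (fromℕ n)
  ι′-◃ Sign.+ zero = refl
  ι′-◃ Sign.- zero = sym -0#≈0#
  ι′-◃ Sign.+ (suc n) = refl
  ι′-◃ Sign.- (suc n) = refl

  σ-* : ∀ s t a b → σ s a * σ t b ≡ σ (s Sign.* t) (a * b)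
  σ-* Sign.+ Sign.+ a b = refl
  σ-* Sign.+ Sign.- a b = sym (-‿distribʳ-* a b)
  σ-* Sign.- Sign.+ a b = sym (-‿distribˡ-* a b)
  σ-* Sign.- Sign.- a b = begin
    - a * - b ≡⟨ sym (-‿distribˡ-* a (- b)) ⟩
    - (a * - b) ≡⟨ cong -_ (sym (-‿distribʳ-* a b)) ⟩
    - - (a * b) ≡⟨ -‿involutive _ ⟩
    a * b ∎
    where open ≡-Reasoning

  ι′-* : ∀ i j → ι′ (i ℤ.* j) ≡ ι′ i * ι′ j
  ι′-* i j = begin
    ι′ (i ℤ.* j) ≡⟨ ι′-◃ (ℤ.sign i Sign.* ℤ.sign j) (ℤ.∣ i ∣ ℕ.* ℤ.∣ j ∣) ⟩
    σ (ℤ.sign i Sign.* ℤ.sign j) (fromℕ (ℤ.∣ i ∣ ℕ.* ℤ.∣ j ∣)) ≡⟨ cong (σ (ℤ.sign i Sign.* ℤ.sign j)) (fromℕ-* ℤ.∣ i ∣ ℤ.∣ j ∣) ⟩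
    σ (ℤ.sign i Sign.* ℤ.sign j) (fromℕ ℤ.∣ i ∣ * fromℕ ℤ.∣ j ∣) ≡⟨ sym (σ-* (ℤ.sign i) (ℤ.sign j) _ _) ⟩
    ι′ i * ι′ j ∎
    where open ≡-Reasoning

  ι′-neg : ∀ i → ι′ (ℤ.- i) ≡ - ι′ i
  ι′-neg -[1+ n ] = sym (-‿involutive _)
  ι′-neg (ℤ.+ zero) = sym -0#≈0#
  ι′-neg (ℤ.+ suc n) = refl

  x+y-y≡x : ∀ x y → (x + y) + - y ≡ x
  x+y-y≡x x y = begin
    (x + y) + - y ≡⟨ +-assoc _ _ _ ⟩
    x + (y + - y) ≡⟨ cong (x +_) (-‿inverseʳ y) ⟩
    x + 0# ≡⟨ +-identityʳ x ⟩
    x ∎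
    where open ≡-Reasoning

  ι′-⊖ : ∀ a b → ι′ (a ℤ.⊖ b) ≡ fromℕ a + - fromℕ b
  ι′-⊖ a b with ℕP.≤-<-connex b a
  ... | inj₁ b≤a = begin
    ι′ (a ℤ.⊖ b) ≡⟨ cong ι′ (ℤP.⊖-≥ b≤a) ⟩
    fromℕ (a ℕ.∸ b) ≡⟨ sym (x+y-y≡x _ _) ⟩
    (fromℕ (a ℕ.∸ b) + fromℕ b) + - fromℕ b ≡⟨ cong (λ z → z + - fromℕ b) (sym (fromℕ-+ (a ℕ.∸ b) b)) ⟩
    fromℕ (a ℕ.∸ b ℕ.+ b) + - fromℕ b ≡⟨ cong (λ z → fromℕ z + - fromℕ b) (ℕP.m∸n+n≡m b≤a) ⟩
    fromℕ a + - fromℕ b ∎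
    where open ≡-Reasoning
  ... | inj₂ a<b = begin
    ι′ (a ℤ.⊖ b) ≡⟨ cong ι′ (ℤP.⊖-< a<b) ⟩
    ι′ (ℤ.- (ℤ.+ (b ℕ.∸ a))) ≡⟨ ι′-neg (ℤ.+ (b ℕ.∸ a)) ⟩
    - fromℕ (b ℕ.∸ a) ≡⟨ cong -_ (sym (x+y-y≡x _ _)) ⟩
    - ((fromℕ (b ℕ.∸ a) + fromℕ a) + - fromℕ a) ≡⟨ cong (λ z → - (z + - fromℕ a)) (trans (sym (fromℕ-+ (b ℕ.∸ a) a)) (cong fromℕ (ℕP.m∸n+n≡m (ℕP.<⇒≤ a<b)))) ⟩
    - (fromℕ b + - fromℕ a) ≡⟨ sym (-‿+-comm _ _) ⟩
    - fromℕ b + - - fromℕ a ≡⟨ cong (- fromℕ b +_) (-‿involutive _) ⟩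
    - fromℕ b + fromℕ a ≡⟨ +-comm _ _ ⟩
    fromℕ a + - fromℕ b ∎
    where open ≡-Reasoning

  ι′-+ : ∀ i j → ι′ (i ℤ.+ j) ≡ ι′ i + ι′ j
  ι′-+ -[1+ m ] -[1+ n ] = begin
    - fromℕ (suc (suc (m ℕ.+ n))) ≡⟨ cong (λ z → - fromℕ (suc z)) (sym (ℕP.+-suc m n)) ⟩
    - fromℕ (suc m ℕ.+ suc n) ≡⟨ cong -_ (fromℕ-+ (suc m) (suc n)) ⟩
    - (fromℕ (suc m) + fromℕ (suc n)) ≡⟨ sym (-‿+-comm _ _) ⟩
    - fromℕ (suc m) + - fromℕ (suc n) ∎
    where open ≡-Reasoning
  ι′-+ -[1+ m ] (ℤ.+ n) = trans (ι′-⊖ n (suc m)) (+-comm _ _)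
  ι′-+ (ℤ.+ m) -[1+ n ] = ι′-⊖ m (suc n)
  ι′-+ (ℤ.+ m) (ℤ.+ n) = fromℕ-+ m n

  -- The solver needs ι 1ℤ to be 1# definitionally (1-homo = refl below); fromℕ 1 is 1# + 0#.
  nat : ℕ → Carrier
  nat zero = 0#
  nat (suc zero) = 1#
  nat (suc (suc n)) = 1# + nat (suc n)

  nat≡ : ∀ n → nat n ≡ fromℕ n
  nat≡ zero = refl
  nat≡ (suc zero) = sym (+-identityʳ 1#)
  nat≡ (suc (suc n)) = cong (1# +_) (nat≡ (suc n))

  ι : ℤ → Carrier
  ι z = σ (ℤ.sign z) (nat ℤ.∣ z ∣)

  ι≡ : ∀ z → ι z ≡ ι′ z
  ι≡ z = cong (σ (ℤ.sign z)) (nat≡ ℤ.∣ z ∣)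

  ι-+ : ∀ i j → ι (i ℤ.+ j) ≡ ι i + ι j
  ι-+ i j = trans (ι≡ (i ℤ.+ j)) (trans (ι′-+ i j) (sym (cong₂ _+_ (ι≡ i) (ι≡ j))))
  ι-* : ∀ i j → ι (i ℤ.* j) ≡ ι i * ι j
  ι-* i j = trans (ι≡ (i ℤ.* j)) (trans (ι′-* i j) (sym (cong₂ _*_ (ι≡ i) (ι≡ j))))
  ι-neg : ∀ i → ι (ℤ.- i) ≡ - ι i
  ι-neg i = trans (ι≡ (ℤ.- i)) (trans (ι′-neg i) (sym (cong -_ (ι≡ i))))

  ι-homomorphism : ℤ.+-*-rawRing -Raw-AlmostCommutative⟶ ACR
  ι-homomorphism = record
    { ⟦_⟧ = ι ; +-homo = ι-+ ; *-homo = ι-* ; -‿homo = ι-neg ; 0-homo = refl ; 1-homo = refl }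

  ι-≟ : ∀ a b → Maybe (ι a ≡ ι b)
  ι-≟ a b with a ℤP.≟ b
  ... | yes eq = just (cong ι eq)
  ... | no _ = nothing

  open import Algebra.Solver.Ring ℤ.+-*-rawRing ACR ι-homomorphism ι-≟ public

  inv-l : ∀ x → x ≢ 0# → inv x * x ≡ 1#
  inv-l x nz = trans (*-comm _ _) (inv-r x nz)

  x*y≡0⇒y≡0 : ∀ x y → x * y ≡ 0# → x ≢ 0# → y ≡ 0#
  x*y≡0⇒y≡0 x y xy≡0 nz = begin
    y ≡⟨ solve 2 (λ a b → b := (a :* b) :+ (con (ℤ.+ 1) :- a) :* b) refl (inv x * x) y ⟩
    (inv x * x) * y + (1# - inv x * x) * y ≡⟨ cong (λ z → (inv x * x) * y + (1# - z) * y) (inv-l x nz) ⟩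
    (inv x * x) * y + (1# - 1#) * y ≡⟨ cong (λ z → z + (1# - 1#) * y) (*-assoc _ _ _) ⟩
    inv x * (x * y) + (1# - 1#) * y ≡⟨ cong (λ z → inv x * z + (1# - 1#) * y) xy≡0 ⟩
    inv x * 0# + (1# - 1#) * y ≡⟨ solve 2 (λ a b → a :* con (ℤ.+ 0) :+ (con (ℤ.+ 1) :- con (ℤ.+ 1)) :* b := con (ℤ.+ 0)) refl (inv x) y ⟩
    0# ∎
    where open ≡-Reasoning

  *-nonzero : ∀ x y → x ≢ 0# → y ≢ 0# → x * y ≢ 0#
  *-nonzero x y nx ny eq = ny (x*y≡0⇒y≡0 x y eq nx)

  *-cancelˡ : ∀ a x y → a ≢ 0# → a * x ≡ a * y → x ≡ y
  *-cancelˡ a x y nz eq = begin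
    x ≡⟨ sym (*-identityˡ x) ⟩
    1# * x ≡⟨ cong (_* x) (sym (inv-l a nz)) ⟩
    (inv a * a) * x ≡⟨ *-assoc _ _ _ ⟩
    inv a * (a * x) ≡⟨ cong (inv a *_) eq ⟩
    inv a * (a * y) ≡⟨ sym (*-assoc _ _ _) ⟩
    (inv a * a) * y ≡⟨ cong (_* y) (inv-l a nz) ⟩
    1# * y ≡⟨ *-identityˡ y ⟩
    y ∎
    where open ≡-Reasoning

  a*[a⁻¹*y]≡y : ∀ a → a ≢ 0# → ∀ y → a * (inv a * y) ≡ y
  a*[a⁻¹*y]≡y a nz y = trans (sym (*-assoc _ _ _)) (trans (cong (_* y) (inv-r a nz)) (*-identityˡ y))

  a⁻¹*[a*y]≡y : ∀ a → a ≢ 0# → ∀ y → inv a * (a * y) ≡ y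
  a⁻¹*[a*y]≡y a nz y = trans (sym (*-assoc _ _ _)) (trans (cong (_* y) (inv-l a nz)) (*-identityˡ y))

  inv-unique : ∀ a b → a ≢ 0# → a * b ≡ 1# → b ≡ inv a
  inv-unique a b nz e = *-cancelˡ a b (inv a) nz (trans e (sym (inv-r a nz)))

  inv-nonzero : ∀ a → a ≢ 0# → inv a ≢ 0#
  inv-nonzero a nz e = 0≢1 (trans (sym (zeroʳ a)) (trans (cong (a *_) (sym e)) (inv-r a nz)))

  inv-involutive : ∀ a → a ≢ 0# → inv (inv a) ≡ a
  inv-involutive a nz = sym (inv-unique (inv a) a (inv-nonzero a nz) (inv-l a nz))

  1≢0 : 1# ≢ 0#
  1≢0 e = 0≢1 (sym e)

  x-y≡0⇒x≡y : ∀ x y → x - y ≡ 0# → x ≡ y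
  x-y≡0⇒x≡y x y eq = begin
    x ≡⟨ solve 2 (λ a b → a := (a :- b) :+ b) refl x y ⟩
    (x - y) + y ≡⟨ cong (_+ y) eq ⟩
    0# + y ≡⟨ +-identityˡ y ⟩
    y ∎
    where open ≡-Reasoning

  -x≡0⇒x≡0 : ∀ x → - x ≡ 0# → x ≡ 0#
  -x≡0⇒x≡0 x h = trans (sym (-‿involutive x)) (trans (cong -_ h) -0#≈0#)

  x≡0⇒-x≡0 : ∀ x → x ≡ 0# → - x ≡ 0#
  x≡0⇒-x≡0 x h = trans (cong -_ h) -0#≈0#

  ^-distribˡ-+-* : ∀ x m n → x ^ (m ℕ.+ n) ≡ x ^ m * x ^ n
  ^-distribˡ-+-* x zero n = sym (*-identityˡ _)
  ^-distribˡ-+-* x (suc m) n = trans (cong (x *_) (^-distribˡ-+-* x m n)) (sym (*-assoc _ _ _))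

  ^-distribʳ-* : ∀ x y n → (x * y) ^ n ≡ x ^ n * y ^ n
  ^-distribʳ-* x y zero = sym (*-identityˡ 1#)
  ^-distribʳ-* x y (suc n) = trans (cong ((x * y) *_) (^-distribʳ-* x y n))
    (solve 4 (λ a b c d → (a :* b) :* (c :* d) := (a :* c) :* (b :* d)) refl x y (x ^ n) (y ^ n))

  ^-*-assoc : ∀ x m n → (x ^ m) ^ n ≡ x ^ (m ℕ.* n)
  ^-*-assoc x m zero = cong (x ^_) (sym (ℕP.*-zeroʳ m))
  ^-*-assoc x m (suc n) = sym (begin
    x ^ (m ℕ.* suc n) ≡⟨ cong (x ^_) (ℕP.*-suc m n) ⟩
    x ^ (m ℕ.+ m ℕ.* n) ≡⟨ ^-distribˡ-+-* x m (m ℕ.* n) ⟩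
    x ^ m * x ^ (m ℕ.* n) ≡⟨ cong (x ^ m *_) (sym (^-*-assoc x m n)) ⟩
    x ^ m * (x ^ m) ^ n ∎)
    where open ≡-Reasoning

  1^n≡1 : ∀ n → 1# ^ n ≡ 1#
  1^n≡1 zero = refl
  1^n≡1 (suc n) = trans (*-identityˡ _) (1^n≡1 n)

  0^n≡0 : ∀ n .{{_ : NonZero n}} → 0# ^ n ≡ 0#
  0^n≡0 (suc n) = zeroˡ _

  ^-nonzero : ∀ x n → x ≢ 0# → x ^ n ≢ 0#
  ^-nonzero x zero nz eq = 0≢1 (sym eq)
  ^-nonzero x (suc n) nz = *-nonzero x (x ^ n) nz (^-nonzero x n nz)

  inv-^ : ∀ a k → a ≢ 0# → inv a ^ k ≡ inv (a ^ k)
  inv-^ a k nz = inv-unique (a ^ k) (inv a ^ k) (^-nonzero a k nz)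
    (trans (sym (^-distribʳ-* a (inv a) k)) (trans (cong (_^ k) (inv-r a nz)) (1^n≡1 k)))

  module ℤSum = Sums.WithDecidableEquality _≟F_
  module Product = Sums.Generic *-isCommutativeMonoid

  ∈units⇒≢0 : ∀ {w} → w ∈ units → w ≢ 0#
  ∈units⇒≢0 {w} w∈ = proj₂ (∈-filter⁻ (λ x → ¬? (x ≟F 0#)) {xs = elements} w∈)

  1∈units : 1# ∈ units
  1∈units = ∈-filter⁺ (λ x → ¬? (x ≟F 0#)) (elements-complete 1#) 1≢0

  order≡1+|units| : order ≡ suc (length units)
  order≡1+|units| = ℤP.+-injective (begin
    ℤ.+ length elements ≡⟨ sym (trans (Sums.Σ-const elements (ℤ.+ 1)) (ℤP.*-identityʳ (ℤ.+ length elements))) ⟩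
    Sums.Σ elements (λ _ → ℤ.+ 1) ≡⟨ ℤSum.Σ-remove elements 0# elements-unique (elements-complete 0#) (λ _ → ℤ.+ 1) ⟩
    ℤ.1ℤ ℤ.+ Sums.Σ units (λ _ → ℤ.+ 1) ≡⟨ cong (λ z → ℤ.1ℤ ℤ.+ z) (trans (Sums.Σ-const units (ℤ.+ 1)) (ℤP.*-identityʳ (ℤ.+ length units))) ⟩
    ℤ.+ suc (length units) ∎)
    where open ≡-Reasoning

  1≤|units| : 1 ≤ length units
  1≤|units| with units | 1∈units
  ... | _ ∷ _ | _ = s≤s z≤n

  Π-const : ∀ {A : Set} (L : List A) a → Product.Σ L (λ _ → a) ≡ a ^ length L
  Π-const [] a = refl
  Π-const (x ∷ L) a = cong (a *_) (Π-const L a)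

  unitPart : Carrier → Carrier
  unitPart x = Product.ind (¬? (x ≟F 0#)) x

  Π-unitPart-nonzero : ∀ L → Product.Σ L unitPart ≢ 0#
  Π-unitPart-nonzero [] eq = 0≢1 (sym eq)
  Π-unitPart-nonzero (x ∷ L) with x ≟F 0#
  ... | yes _ = λ eq → Π-unitPart-nonzero L (trans (sym (*-identityˡ _)) eq)
  ... | no nz = *-nonzero x _ nz (Π-unitPart-nonzero L)

  ind-distrib-* : ∀ {P : Set} (d : Dec P) a b → Product.ind d (a * b) ≡ Product.ind d a * Product.ind d b
  ind-distrib-* (yes _) a b = refl
  ind-distrib-* (no _) a b = sym (*-identityˡ 1#)

  -- Multiplication by a permutes the units, so their product P satisfies P = a ^ |units| * P.
  x^|units|≡1 : ∀ a → a ≢ 0# → a ^ length units ≡ 1#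
  x^|units|≡1 a nz = *-cancelˡ P (a ^ length units) 1# (Π-unitPart-nonzero elements) (begin
    P * a ^ length units ≡⟨ *-comm _ _ ⟩
    a ^ length units * P ≡⟨ cong (_* P) (sym (Π-const units a)) ⟩
    Product.Σ units (λ _ → a) * P ≡⟨ cong (_* P) (Product.Σ-filter (λ x → ¬? (x ≟F 0#)) elements (λ _ → a)) ⟩
    Product.Σ elements (λ x → Product.ind (¬? (x ≟F 0#)) a) * P ≡⟨ sym (Product.Σ-∙ elements _ _) ⟩
    Product.Σ elements (λ x → Product.ind (¬? (x ≟F 0#)) a * unitPart x) ≡⟨ Product.Σ-cong elements (λ x → sym (ind-distrib-* (¬? (x ≟F 0#)) a x)) ⟩
    Product.Σ elements (λ x → Product.ind (¬? (x ≟F 0#)) (a * x)) ≡⟨ Product.Σ-cong elements (λ x →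
        Product.ind-⇔ (¬? (x ≟F 0#)) (¬? ((a * x) ≟F 0#)) (λ nx ax → nx (x*y≡0⇒y≡0 a x ax nz))
          (λ nax x0 → nax (trans (cong (a *_) x0) (zeroʳ a))) (a * x)) ⟩
    Product.Σ elements (λ x → unitPart (a * x)) ≡⟨ Product.WithDecidableEquality.Σ-bijection _≟F_ elements elements-unique elements-complete
        (a *_) (inv a *_) (a*[a⁻¹*y]≡y a nz) (a⁻¹*[a*y]≡y a nz) unitPart ⟩
    P ≡⟨ sym (*-identityʳ P) ⟩
    P * 1# ∎)
    where open ≡-Reasoning
          P = Product.Σ elements unitPart

  x^q≡x : ∀ x → x ^ order ≡ x
  x^q≡x x rewrite order≡1+|units| with x ≟F 0#
  ... | yes refl = zeroˡ _
  ... | no nz = trans (cong (x *_) (x^|units|≡1 x nz)) (*-identityʳ x)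

module Polynomials (F : FiniteField) where
  open Field F
  open import Data.Nat using (ℕ; zero; suc; _≤_; s≤s)
  open import Data.Integer as ℤ using (ℤ)
  open import Data.List using (List; []; _∷_; map; length)
  open import Data.List.Membership.Propositional using (_∈_)
  open import Data.List.Relation.Unary.Any using (here; there)
  open import Data.List.Relation.Unary.All using (All; []; _∷_)
  import Data.List.Relation.Unary.All as All
  open import Data.List.Relation.Unary.AllPairs using (_∷_)
  open import Data.List.Relation.Unary.Unique.Propositional using (Unique)
  open import Data.Empty using (⊥-elim)
  open import Relation.Binary.PropositionalEquality

  Poly : Set
  Poly = List Carrier

  eval : Poly → Carrier → Carrier
  eval [] x = 0#
  eval (c ∷ f) x = c + x * eval f x

  quotient : Carrier → Poly → Poly
  quotient a [] = []
  quotient a (d ∷ h) = eval (d ∷ h) a ∷ quotient a h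

  length-quotient : ∀ a h → length (quotient a h) ≡ length h
  length-quotient a [] = refl
  length-quotient a (d ∷ h) = cong suc (length-quotient a h)

  eval-quotient : ∀ h x a → x * eval h x - a * eval h a ≡ (x - a) * eval (quotient a h) x
  eval-quotient [] x a = solve 2 (λ x a → x :* con (ℤ.+ 0) :- a :* con (ℤ.+ 0) := (x :- a) :* con (ℤ.+ 0)) refl x a
  eval-quotient (d ∷ h) x a = begin
    x * (d + x * eval h x) - a * (d + a * eval h a) ≡⟨ solve 5 (λ x a d Hx Ha → x :* (d :+ x :* Hx) :- a :* (d :+ a :* Ha)
           := (x :- a) :* (d :+ a :* Ha) :+ x :* (x :* Hx :- a :* Ha)) refl x a d (eval h x) (eval h a) ⟩
    (x - a) * (d + a * eval h a) + x * (x * eval h x - a * eval h a) ≡⟨ cong (λ z → (x - a) * (d + a * eval h a) + x * z) (eval-quotient h x a) ⟩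
    (x - a) * (d + a * eval h a) + x * ((x - a) * eval (quotient a h) x) ≡⟨ solve 4 (λ x a D G → (x :- a) :* D :+ x :* ((x :- a) :* G) := (x :- a) :* (D :+ x :* G)) refl x a (d + a * eval h a) (eval (quotient a h) x) ⟩
    (x - a) * (eval (d ∷ h) a + x * eval (quotient a h) x) ∎
    where open ≡-Reasoning

  eval-zeros : ∀ f x → All (_≡ 0#) f → eval f x ≡ 0#
  eval-zeros [] x [] = refl
  eval-zeros (c ∷ f) x (c0 ∷ a) rewrite c0 | eval-zeros f x a =
    solve 1 (λ x → con (ℤ.+ 0) :+ x :* con (ℤ.+ 0) := con (ℤ.+ 0)) refl x

  quotient-zeros : ∀ a h → All (_≡ 0#) (quotient a h) → All (_≡ 0#) h
  quotient-zeros a [] _ = []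
  quotient-zeros a (d ∷ h) (e0 ∷ rest) = d≡0 ∷ h≡0
    where
    h≡0 : All (_≡ 0#) h
    h≡0 = quotient-zeros a h rest
    d≡0 : d ≡ 0#
    d≡0 = begin
      d ≡⟨ solve 2 (λ d a → d := d :+ a :* con (ℤ.+ 0)) refl d a ⟩
      d + a * 0# ≡⟨ cong (λ z → d + a * z) (sym (eval-zeros h a h≡0)) ⟩
      d + a * eval h a ≡⟨ e0 ⟩
      0# ∎
      where open ≡-Reasoning

  -- Dividing by X - a, for the first root a, leaves a shorter polynomial vanishing on the other roots.
  roots⇒zeros : ∀ (L : List Carrier) → Unique L → (f : Poly) → length f ≤ length L →
              (∀ a → a ∈ L → eval f a ≡ 0#) → All (_≡ 0#) f
  roots⇒zeros L u [] le roots = []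
  roots⇒zeros [] u (c ∷ h) () roots
  roots⇒zeros (a ∷ L) (a∉ ∷ u) (c ∷ h) (s≤s le) roots = c≡0 ∷ h≡0
    where
    a-root : c + a * eval h a ≡ 0#
    a-root = roots a (here refl)
    quotient-roots : ∀ b → b ∈ L → eval (quotient a h) b ≡ 0#
    quotient-roots b b∈ = x*y≡0⇒y≡0 (b - a) _ (trans (sym (eval-quotient h b a)) bh[b]-ah[a]≡0) b-a≢0
      where
      b-root : c + b * eval h b ≡ 0#
      b-root = roots b (there b∈)
      bh[b]-ah[a]≡0 : b * eval h b - a * eval h a ≡ 0#
      bh[b]-ah[a]≡0 = begin
        b * eval h b - a * eval h a ≡⟨ solve 3 (λ c B A → B :- A := (c :+ B) :- (c :+ A)) refl c (b * eval h b) (a * eval h a) ⟩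
        (c + b * eval h b) - (c + a * eval h a) ≡⟨ cong₂ _-_ b-root a-root ⟩
        0# - 0# ≡⟨ solve 0 (con (ℤ.+ 0) :- con (ℤ.+ 0) := con (ℤ.+ 0)) refl ⟩
        0# ∎
        where open ≡-Reasoning
      b-a≢0 : b - a ≢ 0#
      b-a≢0 eq = All.lookup a∉ b∈ (sym (x-y≡0⇒x≡y b a eq))
    h≡0 : All (_≡ 0#) h
    h≡0 = quotient-zeros a h (roots⇒zeros L u (quotient a h) (subst (_≤ length L) (sym (length-quotient a h)) le) quotient-roots)
    c≡0 : c ≡ 0#
    c≡0 = begin
      c ≡⟨ solve 2 (λ c a → c := c :+ a :* con (ℤ.+ 0)) refl c a ⟩
      c + a * 0# ≡⟨ cong (λ z → c + a * z) (sym (eval-zeros h a h≡0)) ⟩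
      c + a * eval h a ≡⟨ a-root ⟩
      0# ∎
      where open ≡-Reasoning

  monomial : ℕ → Poly
  monomial zero = 1# ∷ []
  monomial (suc k) = 0# ∷ monomial k

  eval-monomial : ∀ k x → eval (monomial k) x ≡ x ^ k
  eval-monomial zero x = solve 1 (λ x → con (ℤ.+ 1) :+ x :* con (ℤ.+ 0) := con (ℤ.+ 1)) refl x
  eval-monomial (suc k) x rewrite eval-monomial k x = +-identityˡ _

  length-monomial : ∀ k → length (monomial k) ≡ suc k
  length-monomial zero = refl
  length-monomial (suc k) = cong suc (length-monomial k)

  padd : Poly → Poly → Poly
  padd [] g = g
  padd (a ∷ f) [] = a ∷ f
  padd (a ∷ f) (b ∷ g) = (a + b) ∷ padd f g

  eval-padd : ∀ f g x → eval (padd f g) x ≡ eval f x + eval g x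
  eval-padd [] g x = sym (+-identityˡ _)
  eval-padd (a ∷ f) [] x = sym (+-identityʳ _)
  eval-padd (a ∷ f) (b ∷ g) x rewrite eval-padd f g x =
    solve 5 (λ a b x F G → (a :+ b) :+ x :* (F :+ G) := (a :+ x :* F) :+ (b :+ x :* G)) refl a b x (eval f x) (eval g x)

  length-padd : ∀ f g M → length f ≤ M → length g ≤ M → length (padd f g) ≤ M
  length-padd [] g M lf lg = lg
  length-padd (a ∷ f) [] M lf lg = lf
  length-padd (a ∷ f) (b ∷ g) (suc M) (s≤s lf) (s≤s lg) = s≤s (length-padd f g M lf lg)

  pneg : Poly → Poly
  pneg = map (λ c → - c)

  eval-pneg : ∀ f x → eval (pneg f) x ≡ - eval f x
  eval-pneg [] x = sym -0#≈0#
  eval-pneg (c ∷ f) x rewrite eval-pneg f x = solve 3 (λ c x F → :- c :+ x :* (:- F) := :- (c :+ x :* F)) refl c x (eval f x)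

  length-pneg : ∀ f → length (pneg f) ≡ length f
  length-pneg [] = refl
  length-pneg (c ∷ f) = cong suc (length-pneg f)

  coef : Poly → ℕ → Carrier
  coef [] j = 0#
  coef (c ∷ f) zero = c
  coef (c ∷ f) (suc j) = coef f j

  coef-padd : ∀ f g j → coef (padd f g) j ≡ coef f j + coef g j
  coef-padd [] g j = sym (+-identityˡ _)
  coef-padd (a ∷ f) [] zero = sym (+-identityʳ _)
  coef-padd (a ∷ f) [] (suc j) = sym (+-identityʳ _)
  coef-padd (a ∷ f) (b ∷ g) zero = refl
  coef-padd (a ∷ f) (b ∷ g) (suc j) = coef-padd f g j

  coef-pneg : ∀ f j → coef (pneg f) j ≡ - coef f j
  coef-pneg [] j = sym -0#≈0#
  coef-pneg (c ∷ f) zero = refl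
  coef-pneg (c ∷ f) (suc j) = coef-pneg f j

  coef-monomial-≡ : ∀ k → coef (monomial k) k ≡ 1#
  coef-monomial-≡ zero = refl
  coef-monomial-≡ (suc k) = coef-monomial-≡ k

  coef-monomial-≢ : ∀ k j → j ≢ k → coef (monomial k) j ≡ 0#
  coef-monomial-≢ zero zero ne = ⊥-elim (ne refl)
  coef-monomial-≢ zero (suc zero) ne = refl
  coef-monomial-≢ zero (suc (suc j)) ne = refl
  coef-monomial-≢ (suc k) zero ne = refl
  coef-monomial-≢ (suc k) (suc j) ne = coef-monomial-≢ k j (λ eq → ne (cong suc eq))

  coef-zero : ∀ f j → All (_≡ 0#) f → coef f j ≡ 0#
  coef-zero [] j _ = refl
  coef-zero (c ∷ f) zero (c0 ∷ _) = c0
  coef-zero (c ∷ f) (suc j) (_ ∷ a) = coef-zero f j a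


module Binomial where
  open import Data.Nat
  open import Data.Nat.Properties
  open import Data.Nat.Divisibility using (_∣_; ∣⇒≤; m∣m*n)
  open import Data.Nat.Primality using (Prime; euclidsLemma; ¬prime[0])
  open import Data.Sum using (inj₁; inj₂)
  open import Data.Empty using (⊥-elim)
  open import Relation.Binary.PropositionalEquality
  open import Data.Nat.Solver using (module +-*-Solver)
  open +-*-Solver

  binomial : ℕ → ℕ → ℕ
  binomial n zero = 1
  binomial zero (suc k) = 0
  binomial (suc n) (suc k) = binomial n k + binomial n (suc k)

  binomial-≡0 : ∀ n k → n < k → binomial n k ≡ 0
  binomial-≡0 zero (suc k) _ = refl
  binomial-≡0 (suc n) (suc k) (s≤s n<k) = cong₂ _+_ (binomial-≡0 n k n<k) (binomial-≡0 n (suc k) (m<n⇒m<1+n n<k))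

  binomial-n-n : ∀ n → binomial n n ≡ 1
  binomial-n-n zero = refl
  binomial-n-n (suc n) = cong₂ _+_ (binomial-n-n n) (binomial-≡0 n (suc n) (n<1+n n))

  binomial-absorption : ∀ n k → suc k * binomial (suc n) (suc k) ≡ suc n * binomial n k
  binomial-absorption zero zero = refl
  binomial-absorption zero (suc k) = *-zeroʳ (suc (suc k))
  binomial-absorption (suc n) zero = begin
    1 * (binomial (suc n) zero + binomial (suc n) 1) ≡⟨ *-identityˡ _ ⟩
    1 + binomial (suc n) 1 ≡⟨ cong suc (trans (sym (*-identityˡ _)) (binomial-absorption n zero)) ⟩
    1 + suc n * 1 ≡⟨ solve 1 (λ n → con 1 :+ (con 1 :+ n) :* con 1 := (con 2 :+ n) :* con 1) refl n ⟩
    suc (suc n) * 1 ∎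
    where open ≡-Reasoning
  binomial-absorption (suc n) (suc k) = begin
    suc (suc k) * (binomial (suc n) (suc k) + binomial (suc n) (suc (suc k)))
      ≡⟨ solve 3 (λ k x y → (con 2 :+ k) :* (x :+ y) := x :+ ((con 1 :+ k) :* x) :+ ((con 2 :+ k) :* y)) refl k (binomial (suc n) (suc k)) (binomial (suc n) (suc (suc k))) ⟩
    binomial (suc n) (suc k) + suc k * binomial (suc n) (suc k) + suc (suc k) * binomial (suc n) (suc (suc k))
      ≡⟨ cong₂ (λ a b → binomial (suc n) (suc k) + a + b) (binomial-absorption n k) (binomial-absorption n (suc k)) ⟩
    binomial (suc n) (suc k) + suc n * binomial n k + suc n * binomial n (suc k)
      ≡⟨ solve 3 (λ n a b → (a :+ b) :+ (con 1 :+ n) :* a :+ (con 1 :+ n) :* b := (con 2 :+ n) :* (a :+ b)) refl n (binomial n k) (binomial n (suc k)) ⟩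
    suc (suc n) * binomial (suc n) (suc k) ∎
    where open ≡-Reasoning

  prime∣binomial : ∀ p k → Prime p → 0 < k → k < p → p ∣ binomial p k
  prime∣binomial zero k pr _ _ = ⊥-elim (¬prime[0] pr)
  prime∣binomial (suc n) zero pr () _
  prime∣binomial (suc n) (suc k) pr _ k<p with euclidsLemma (suc k) (binomial (suc n) (suc k)) pr
        (subst (suc n ∣_) (sym (binomial-absorption n k)) (m∣m*n (binomial n k)))
  ... | inj₁ p∣k = ⊥-elim (<⇒≱ k<p (∣⇒≤ p∣k))
  ... | inj₂ p∣B = p∣B


module Characteristic (F : FiniteField) (p : ℕ) .{{_ : NonZero p}} (p-prime : Prime p)
                      (charF≡p : FiniteField.fromℕ F p ≡ FiniteField.0# F) where
  open Field F
  open Polynomials F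
  open Binomial
  open import Data.Nat as ℕ using (ℕ; zero; suc; _<_; _≤_; z≤n; s≤s; NonZero; _%_; _/_)
  import Data.Nat.Properties as ℕP
  open import Data.Nat.DivMod using (m≡m%n+[m/n]*n)
  open import Data.Nat.Divisibility using (divides)
  open import Data.Nat.Primality using (Prime; ¬prime[1])
  open import Data.Nat.Coprimality using (prime⇒coprime; coprime-Bézout)
  open import Data.Nat.GCD using (module Bézout)
  open import Data.Integer as ℤ using (ℤ)
  open import Data.List using (List; []; _∷_; map; length; upTo; applyUpTo)
  open import Data.List.Membership.Propositional using (_∈_)
  open import Data.List.Membership.Propositional.Properties using (∈-applyUpTo⁻; ∈-upTo⁺; ∈-upTo⁻)
  open import Data.List.Properties using (length-applyUpTo)
  open import Data.List.Relation.Unary.Any using (here; there)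
  open import Data.List.Relation.Unary.All using (All)
  import Data.List.Relation.Unary.All as All
  open import Data.List.Relation.Unary.AllPairs using (_∷_)
  open import Data.List.Relation.Unary.Unique.Propositional using (Unique)
  open import Data.List.Relation.Unary.Unique.Propositional.Properties using (applyUpTo⁺₁)
  open import Relation.Nullary using (yes; no)
  open import Relation.Binary.PropositionalEquality
  open import Data.Empty using (⊥-elim)
  open import Data.Product using (_×_; _,_; Σ-syntax)
  open import Data.Sum using (_⊎_; inj₁; inj₂)
  open import Relation.Binary using (tri<; tri≈; tri>)

  fromℕ[k*p]≡0 : ∀ c → fromℕ (c ℕ.* p) ≡ 0#
  fromℕ[k*p]≡0 c = trans (fromℕ-* c p) (trans (cong (fromℕ c *_) charF≡p) (zeroʳ _))

  fromℕ-% : ∀ m → fromℕ m ≡ fromℕ (m % p)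
  fromℕ-% m = begin
    fromℕ m ≡⟨ cong fromℕ (m≡m%n+[m/n]*n m p) ⟩
    fromℕ (m % p ℕ.+ (m / p) ℕ.* p) ≡⟨ fromℕ-+ (m % p) _ ⟩
    fromℕ (m % p) + fromℕ ((m / p) ℕ.* p) ≡⟨ cong (fromℕ (m % p) +_) (fromℕ[k*p]≡0 (m / p)) ⟩
    fromℕ (m % p) + 0# ≡⟨ +-identityʳ _ ⟩
    fromℕ (m % p) ∎
    where open ≡-Reasoning

  fromℕ1≢0 : fromℕ 1 ≢ 0#
  fromℕ1≢0 eq = 0≢1 (sym (trans (sym (+-identityʳ 1#)) eq))

  fromℕ-nonzero : ∀ m → 0 < m → m < p → fromℕ m ≢ 0#
  fromℕ-nonzero (suc m) _ m<p eq with coprime-Bézout (prime⇒coprime p-prime m<p)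
  ... | Bézout.+- x y e = fromℕ1≢0 (begin
          fromℕ 1 ≡⟨ sym (+-identityʳ _) ⟩
          fromℕ 1 + 0# ≡⟨ cong (fromℕ 1 +_) (sym (trans (fromℕ-* y (suc m)) (trans (cong (fromℕ y *_) eq) (zeroʳ _)))) ⟩
          fromℕ 1 + fromℕ (y ℕ.* suc m) ≡⟨ sym (fromℕ-+ 1 (y ℕ.* suc m)) ⟩
          fromℕ (1 ℕ.+ y ℕ.* suc m) ≡⟨ cong fromℕ e ⟩
          fromℕ (x ℕ.* p) ≡⟨ fromℕ[k*p]≡0 x ⟩
          0# ∎)
    where open ≡-Reasoning
  ... | Bézout.-+ x y e = fromℕ1≢0 (begin
          fromℕ 1 ≡⟨ sym (+-identityʳ _) ⟩
          fromℕ 1 + 0# ≡⟨ cong (fromℕ 1 +_) (sym (fromℕ[k*p]≡0 x)) ⟩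
          fromℕ 1 + fromℕ (x ℕ.* p) ≡⟨ sym (fromℕ-+ 1 (x ℕ.* p)) ⟩
          fromℕ (1 ℕ.+ x ℕ.* p) ≡⟨ cong fromℕ e ⟩
          fromℕ (y ℕ.* suc m) ≡⟨ fromℕ-* y (suc m) ⟩
          fromℕ y * fromℕ (suc m) ≡⟨ cong (fromℕ y *_) eq ⟩
          fromℕ y * 0# ≡⟨ zeroʳ _ ⟩
          0# ∎)
    where open ≡-Reasoning

  fromℕ-injective-< : ∀ i j → i < j → j < p → fromℕ i ≢ fromℕ j
  fromℕ-injective-< i j i<j j<p eq = fromℕ-nonzero (j ℕ.∸ i) (ℕP.m<n⇒0<n∸m i<j) (ℕP.≤-<-trans (ℕP.m∸n≤m j i) j<p) (begin
    fromℕ (j ℕ.∸ i) ≡⟨ solve 2 (λ a b → a := (b :+ a) :- b) refl (fromℕ (j ℕ.∸ i)) (fromℕ i) ⟩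
    (fromℕ i + fromℕ (j ℕ.∸ i)) - fromℕ i ≡⟨ cong (λ z → z - fromℕ i) (sym (fromℕ-+ i (j ℕ.∸ i))) ⟩
    fromℕ (i ℕ.+ (j ℕ.∸ i)) - fromℕ i ≡⟨ cong (λ z → fromℕ z - fromℕ i) (ℕP.m+[n∸m]≡n (ℕP.<⇒≤ i<j)) ⟩
    fromℕ j - fromℕ i ≡⟨ cong (λ z → fromℕ j - z) eq ⟩
    fromℕ j - fromℕ j ≡⟨ -‿inverseʳ _ ⟩
    0# ∎)
    where open ≡-Reasoning

  fromℕ-injective : ∀ i j → i < p → j < p → fromℕ i ≡ fromℕ j → i ≡ j
  fromℕ-injective i j ip jp eq with ℕP.<-cmp i j
  ... | tri< i<j _ _ = ⊥-elim (fromℕ-injective-< i j i<j jp eq)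
  ... | tri≈ _ e _ = e
  ... | tri> _ _ j<i = ⊥-elim (fromℕ-injective-< j i j<i ip (sym eq))

  *[X+y] : Carrier → Poly → Poly
  *[X+y] y f = padd (map (y *_) f) (0# ∷ f)

  eval-scale : ∀ y f x → eval (map (y *_) f) x ≡ y * eval f x
  eval-scale y [] x = sym (zeroʳ y)
  eval-scale y (c ∷ f) x rewrite eval-scale y f x =
    solve 4 (λ y c x E → y :* c :+ x :* (y :* E) := y :* (c :+ x :* E)) refl y c x (eval f x)

  coef-scale : ∀ y f j → coef (map (y *_) f) j ≡ y * coef f j
  coef-scale y [] j = sym (zeroʳ y)
  coef-scale y (c ∷ f) zero = refl
  coef-scale y (c ∷ f) (suc j) = coef-scale y f j

  [X+y]^ : Carrier → ℕ → Poly
  [X+y]^ y zero = 1# ∷ []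
  [X+y]^ y (suc m) = *[X+y] y ([X+y]^ y m)

  eval-[X+y]^ : ∀ y m x → eval ([X+y]^ y m) x ≡ (x + y) ^ m
  eval-[X+y]^ y zero x = solve 1 (λ x → con (ℤ.+ 1) :+ x :* con (ℤ.+ 0) := con (ℤ.+ 1)) refl x
  eval-[X+y]^ y (suc m) x = begin
    eval (*[X+y] y ([X+y]^ y m)) x ≡⟨ eval-padd (map (y *_) ([X+y]^ y m)) (0# ∷ [X+y]^ y m) x ⟩
    eval (map (y *_) ([X+y]^ y m)) x + (0# + x * eval ([X+y]^ y m) x) ≡⟨ cong (_+ (0# + x * eval ([X+y]^ y m) x)) (eval-scale y ([X+y]^ y m) x) ⟩
    y * eval ([X+y]^ y m) x + (0# + x * eval ([X+y]^ y m) x) ≡⟨ solve 3 (λ y x E → y :* E :+ (con (ℤ.+ 0) :+ x :* E) := (x :+ y) :* E) refl y x (eval ([X+y]^ y m) x) ⟩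
    (x + y) * eval ([X+y]^ y m) x ≡⟨ cong ((x + y) *_) (eval-[X+y]^ y m x) ⟩
    (x + y) ^ suc m ∎
    where open ≡-Reasoning

  coef-[X+y]^ : ∀ y m j → coef ([X+y]^ y m) j ≡ fromℕ (binomial m j) * y ^ (m ℕ.∸ j)
  coef-[X+y]^ y zero zero = solve 0 (con (ℤ.+ 1) := (con (ℤ.+ 1) :+ con (ℤ.+ 0)) :* con (ℤ.+ 1)) refl
  coef-[X+y]^ y zero (suc j) = sym (zeroˡ _)
  coef-[X+y]^ y (suc m) zero = begin
    coef (*[X+y] y ([X+y]^ y m)) zero ≡⟨ coef-padd (map (y *_) ([X+y]^ y m)) (0# ∷ [X+y]^ y m) zero ⟩
    coef (map (y *_) ([X+y]^ y m)) zero + 0# ≡⟨ cong (_+ 0#) (coef-scale y ([X+y]^ y m) zero) ⟩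
    y * coef ([X+y]^ y m) zero + 0# ≡⟨ cong (λ z → y * z + 0#) (coef-[X+y]^ y m zero) ⟩
    y * ((1# + 0#) * y ^ m) + 0# ≡⟨ solve 2 (λ y Y → y :* ((con (ℤ.+ 1) :+ con (ℤ.+ 0)) :* Y) :+ con (ℤ.+ 0) := (con (ℤ.+ 1) :+ con (ℤ.+ 0)) :* (y :* Y)) refl y (y ^ m) ⟩
    (1# + 0#) * (y * y ^ m) ∎
    where open ≡-Reasoning
  coef-[X+y]^ y (suc m) (suc j) = begin
    coef (*[X+y] y ([X+y]^ y m)) (suc j) ≡⟨ coef-padd (map (y *_) ([X+y]^ y m)) (0# ∷ [X+y]^ y m) (suc j) ⟩
    coef (map (y *_) ([X+y]^ y m)) (suc j) + coef ([X+y]^ y m) j ≡⟨ cong₂ _+_ (coef-scale y ([X+y]^ y m) (suc j)) (coef-[X+y]^ y m j) ⟩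
    y * coef ([X+y]^ y m) (suc j) + fromℕ (binomial m j) * y ^ (m ℕ.∸ j) ≡⟨ cong (λ z → y * z + fromℕ (binomial m j) * y ^ (m ℕ.∸ j)) (coef-[X+y]^ y m (suc j)) ⟩
    y * (fromℕ (binomial m (suc j)) * y ^ (m ℕ.∸ suc j)) + fromℕ (binomial m j) * y ^ (m ℕ.∸ j) ≡⟨ absorb-y ⟩
    fromℕ (binomial m (suc j)) * y ^ (m ℕ.∸ j) + fromℕ (binomial m j) * y ^ (m ℕ.∸ j) ≡⟨ solve 3 (λ a b Y → a :* Y :+ b :* Y := (b :+ a) :* Y) refl (fromℕ (binomial m (suc j))) (fromℕ (binomial m j)) (y ^ (m ℕ.∸ j)) ⟩
    (fromℕ (binomial m j) + fromℕ (binomial m (suc j))) * y ^ (m ℕ.∸ j) ≡⟨ cong (_* y ^ (m ℕ.∸ j)) (sym (fromℕ-+ (binomial m j) (binomial m (suc j)))) ⟩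
    fromℕ (binomial m j ℕ.+ binomial m (suc j)) * y ^ (m ℕ.∸ j) ∎
    where
    open ≡-Reasoning
    absorb-y : y * (fromℕ (binomial m (suc j)) * y ^ (m ℕ.∸ suc j)) + fromℕ (binomial m j) * y ^ (m ℕ.∸ j)
         ≡ fromℕ (binomial m (suc j)) * y ^ (m ℕ.∸ j) + fromℕ (binomial m j) * y ^ (m ℕ.∸ j)
    absorb-y with ℕP.<-≤-connex j m
    ... | inj₁ j<m rewrite ℕP.+-∸-assoc 1 j<m =
      cong (_+ fromℕ (binomial m j) * y ^ suc (m ℕ.∸ suc j))
        (solve 3 (λ y b Y → y :* (b :* Y) := b :* (y :* Y)) refl y (fromℕ (binomial m (suc j))) (y ^ (m ℕ.∸ suc j)))
    ... | inj₂ m≤j rewrite binomial-≡0 m (suc j) (s≤s m≤j) =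
      cong (_+ fromℕ (binomial m j) * y ^ (m ℕ.∸ j))
        (solve 3 (λ y A B → y :* (con (ℤ.+ 0) :* A) := con (ℤ.+ 0) :* B) refl y (y ^ (m ℕ.∸ suc j)) (y ^ (m ℕ.∸ j)))

  eval-coef-zero : ∀ g x → (∀ j → 0# ≡ coef g j) → 0# ≡ eval g x
  eval-coef-zero [] x eq = refl
  eval-coef-zero (c ∷ g) x eq = begin
    0# ≡⟨ solve 1 (λ x → con (ℤ.+ 0) := con (ℤ.+ 0) :+ x :* con (ℤ.+ 0)) refl x ⟩
    0# + x * 0# ≡⟨ cong₂ (λ a b → a + x * b) (eq zero) (eval-coef-zero g x (λ j → eq (suc j))) ⟩
    c + x * eval g x ∎
    where open ≡-Reasoning

  eval-coef-ext : ∀ f g x → (∀ j → coef f j ≡ coef g j) → eval f x ≡ eval g x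
  eval-coef-ext [] g x eq = eval-coef-zero g x eq
  eval-coef-ext (c ∷ f) [] x eq = sym (eval-coef-zero (c ∷ f) x (λ j → sym (eq j)))
  eval-coef-ext (c ∷ f) (d ∷ g) x eq = cong₂ (λ a b → a + x * b) (eq zero) (eval-coef-ext f g x (λ j → eq (suc j)))

  fromℕ-binomial-p : ∀ j → 0 < j → j < p → fromℕ (binomial p j) ≡ 0#
  fromℕ-binomial-p j 0<j j<p with prime∣binomial p j p-prime 0<j j<p
  ... | divides c eq = trans (cong fromℕ eq) (fromℕ[k*p]≡0 c)

  frobenius-+ : ∀ x y → (x + y) ^ p ≡ x ^ p + y ^ p
  frobenius-+ x y = begin
    (x + y) ^ p ≡⟨ sym (eval-[X+y]^ y p x) ⟩
    eval ([X+y]^ y p) x ≡⟨ eval-coef-ext ([X+y]^ y p) y^p+X^p x coefficients ⟩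
    eval y^p+X^p x ≡⟨ eval-padd (y ^ p ∷ []) (monomial p) x ⟩
    (y ^ p + x * 0#) + eval (monomial p) x ≡⟨ cong ((y ^ p + x * 0#) +_) (eval-monomial p x) ⟩
    (y ^ p + x * 0#) + x ^ p ≡⟨ solve 3 (λ x Y X → (Y :+ x :* con (ℤ.+ 0)) :+ X := X :+ Y) refl x (y ^ p) (x ^ p) ⟩
    x ^ p + y ^ p ∎
    where
    open ≡-Reasoning
    y^p+X^p : Poly
    y^p+X^p = padd (y ^ p ∷ []) (monomial p)
    coefficients : ∀ j → coef ([X+y]^ y p) j ≡ coef y^p+X^p j
    coefficients j = trans (coef-[X+y]^ y p j) (trans (coef-binomial-p j) (sym (coef-padd (y ^ p ∷ []) (monomial p) j)))
      where
      coef-binomial-p : ∀ j → fromℕ (binomial p j) * y ^ (p ℕ.∸ j) ≡ coef (y ^ p ∷ []) j + coef (monomial p) j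
      coef-binomial-p zero = trans (solve 1 (λ Y → (con (ℤ.+ 1) :+ con (ℤ.+ 0)) :* Y := Y :+ con (ℤ.+ 0)) refl (y ^ p))
                      (cong (y ^ p +_) (sym (coef-monomial-≢ p zero (λ e → ℕ.≢-nonZero⁻¹ p (sym e)))))
      coef-binomial-p (suc j) with ℕP.<-cmp (suc j) p
      ... | tri< sj<p _ _ = begin
        fromℕ (binomial p (suc j)) * y ^ (p ℕ.∸ suc j) ≡⟨ cong (_* y ^ (p ℕ.∸ suc j)) (fromℕ-binomial-p (suc j) (s≤s z≤n) sj<p) ⟩
        0# * y ^ (p ℕ.∸ suc j) ≡⟨ zeroˡ _ ⟩
        0# ≡⟨ sym (+-identityˡ 0#) ⟩
        0# + 0# ≡⟨ cong (0# +_) (sym (coef-monomial-≢ p (suc j) (λ e → ℕP.<-irrefl e sj<p))) ⟩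
        0# + coef (monomial p) (suc j) ∎
      ... | tri≈ _ refl _ = begin
        fromℕ (binomial (suc j) (suc j)) * y ^ (suc j ℕ.∸ suc j) ≡⟨ cong₂ (λ a b → fromℕ a * y ^ b) (binomial-n-n (suc j)) (ℕP.n∸n≡0 (suc j)) ⟩
        fromℕ 1 * 1# ≡⟨ solve 0 ((con (ℤ.+ 1) :+ con (ℤ.+ 0)) :* con (ℤ.+ 1) := con (ℤ.+ 0) :+ con (ℤ.+ 1)) refl ⟩
        0# + 1# ≡⟨ cong (0# +_) (sym (coef-monomial-≡ (suc j))) ⟩
        0# + coef (monomial (suc j)) (suc j) ∎
      ... | tri> _ _ p<sj = begin
        fromℕ (binomial p (suc j)) * y ^ (p ℕ.∸ suc j) ≡⟨ cong (λ a → fromℕ a * y ^ (p ℕ.∸ suc j)) (binomial-≡0 p (suc j) p<sj) ⟩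
        0# * y ^ (p ℕ.∸ suc j) ≡⟨ zeroˡ _ ⟩
        0# ≡⟨ sym (+-identityˡ 0#) ⟩
        0# + 0# ≡⟨ cong (0# +_) (sym (coef-monomial-≢ p (suc j) (λ e → ℕP.<-irrefl (sym e) p<sj))) ⟩
        0# + coef (monomial p) (suc j) ∎

  frobenius^-+ : ∀ i x y → (x + y) ^ (p ℕ.^ i) ≡ x ^ (p ℕ.^ i) + y ^ (p ℕ.^ i)
  frobenius^-+ zero x y = solve 2 (λ x y → (x :+ y) :* con (ℤ.+ 1) := x :* con (ℤ.+ 1) :+ y :* con (ℤ.+ 1)) refl x y
  frobenius^-+ (suc i) x y = begin
    (x + y) ^ (p ℕ.* p ℕ.^ i) ≡⟨ sym (^-*-assoc (x + y) p (p ℕ.^ i)) ⟩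
    ((x + y) ^ p) ^ (p ℕ.^ i) ≡⟨ cong (_^ (p ℕ.^ i)) (frobenius-+ x y) ⟩
    (x ^ p + y ^ p) ^ (p ℕ.^ i) ≡⟨ frobenius^-+ i (x ^ p) (y ^ p) ⟩
    (x ^ p) ^ (p ℕ.^ i) + (y ^ p) ^ (p ℕ.^ i) ≡⟨ cong₂ _+_ (^-*-assoc x p (p ℕ.^ i)) (^-*-assoc y p (p ℕ.^ i)) ⟩
    x ^ (p ℕ.* p ℕ.^ i) + y ^ (p ℕ.* p ℕ.^ i) ∎
    where open ≡-Reasoning

  fromℕ^p≡fromℕ : ∀ k → fromℕ k ^ p ≡ fromℕ k
  fromℕ^p≡fromℕ zero = 0^n≡0 p
  fromℕ^p≡fromℕ (suc k) = trans (frobenius-+ 1# (fromℕ k)) (cong₂ _+_ (1^n≡1 p) (fromℕ^p≡fromℕ k))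

  X^p-X : Poly
  X^p-X = padd (monomial p) (pneg (monomial 1))

  eval-X^p-X : ∀ z → z ^ p ≡ z → eval X^p-X z ≡ 0#
  eval-X^p-X z e = begin
    eval X^p-X z ≡⟨ eval-padd (monomial p) (pneg (monomial 1)) z ⟩
    eval (monomial p) z + eval (pneg (monomial 1)) z ≡⟨ cong₂ _+_ (eval-monomial p z) (trans (eval-pneg (monomial 1) z) (cong -_ (eval-monomial 1 z))) ⟩
    z ^ p + - (z * 1#) ≡⟨ cong (λ a → a + - (z * 1#)) e ⟩
    z + - (z * 1#) ≡⟨ solve 1 (λ z → z :+ :- (z :* con (ℤ.+ 1)) := con (ℤ.+ 0)) refl z ⟩
    0# ∎
    where open ≡-Reasoning

  p≢1 : p ≢ 1
  p≢1 refl = ¬prime[1] p-prime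

  coef-X^p-X : coef X^p-X p ≡ 1#
  coef-X^p-X = begin
    coef X^p-X p ≡⟨ coef-padd (monomial p) (pneg (monomial 1)) p ⟩
    coef (monomial p) p + coef (pneg (monomial 1)) p ≡⟨ cong₂ _+_ (coef-monomial-≡ p) (trans (coef-pneg (monomial 1) p) (cong -_ (coef-monomial-≢ 1 p p≢1))) ⟩
    1# + - 0# ≡⟨ solve 0 (con (ℤ.+ 1) :+ :- con (ℤ.+ 0) := con (ℤ.+ 1)) refl ⟩
    1# ∎
    where open ≡-Reasoning

  length-X^p-X : length X^p-X ℕ.≤ suc p
  length-X^p-X = length-padd (monomial p) (pneg (monomial 1)) (suc p)
    (ℕP.≤-reflexive (length-monomial p))
    (subst (ℕ._≤ suc p) (sym (trans (length-pneg (monomial 1)) (length-monomial 1))) (s≤s (ℕ.>-nonZero⁻¹ p)))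

  findFromℕ : ∀ (y : Carrier) (L : List ℕ) → (Σ[ k ∈ ℕ ] (k ∈ L × fromℕ k ≡ y)) ⊎ (∀ k → k ∈ L → fromℕ k ≢ y)
  findFromℕ y [] = inj₂ (λ k ())
  findFromℕ y (k ∷ L) with fromℕ k ≟F y
  ... | yes e = inj₁ (k , here refl , e)
  ... | no ne with findFromℕ y L
  ...   | inj₁ (k' , k'∈ , e) = inj₁ (k' , there k'∈ , e)
  ...   | inj₂ f = inj₂ λ { k' (here refl) → ne ; k' (there k'∈) → f k' k'∈ }

  -- Otherwise y and fromℕ 0, …, fromℕ (p - 1) would be p + 1 distinct roots of X^p - X.
  fixed-by-frobenius⇒fromℕ : ∀ y → y ^ p ≡ y → Σ[ k ∈ ℕ ] (k < p × fromℕ k ≡ y)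
  fixed-by-frobenius⇒fromℕ y fy with findFromℕ y (upTo p)
  ... | inj₁ (k , k∈ , e) = k , ∈-upTo⁻ k∈ , e
  ... | inj₂ none = ⊥-elim (0≢1 (trans (sym (coef-zero X^p-X p allz)) coef-X^p-X))
    where
    R : List Carrier
    R = y ∷ applyUpTo fromℕ p
    y∉ : All (y ≢_) (applyUpTo fromℕ p)
    y∉ = All.tabulate λ {v} v∈ → let (i , i<p , v≡) = ∈-applyUpTo⁻ fromℕ v∈ in λ y≡v → none i (∈-upTo⁺ i<p) (sym (trans y≡v v≡))
    unique-R : Unique R
    unique-R = y∉ ∷ applyUpTo⁺₁ fromℕ p (λ i<j j<p → fromℕ-injective-< _ _ i<j j<p)
    length-R : length X^p-X ℕ.≤ length R
    length-R = subst (length X^p-X ℕ.≤_) (cong suc (sym (length-applyUpTo fromℕ p))) length-X^p-X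
    roots : ∀ a → a ∈ R → eval X^p-X a ≡ 0#
    roots a (here refl) = eval-X^p-X y fy
    roots a (there a∈) = let (i , i<p , a≡) = ∈-applyUpTo⁻ fromℕ a∈ in eval-X^p-X a (trans (cong (_^ p) a≡) (trans (fromℕ^p≡fromℕ i) (sym a≡)))
    allz : All (_≡ 0#) X^p-X
    allz = roots⇒zeros R unique-R X^p-X length-R roots


module Trace (F : FiniteField) (p n s : ℕ) .{{_ : NonZero p}} (p-prime : Prime p)
             (charF≡p : FiniteField.fromℕ F p ≡ FiniteField.0# F)
             (q≡p^n : FiniteField.order F ≡ p Data.Nat.^ n) where
  open Field F public
  open Polynomials F
  open Characteristic F p p-prime charF≡p public
  open Paper F p n s public
  open import Data.Nat as ℕ using (ℕ; zero; suc; _<_; _≤_; z≤n; s≤s; NonZero; _%_; nonTrivial⇒n>1)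
  import Data.Nat.Properties as ℕP
  open import Data.Nat.DivMod using (m%n<n)
  open import Data.Nat.Primality using (prime⇒nonTrivial)
  open import Data.List using (List; []; _∷_; map; foldr; length; upTo; applyUpTo)
  open import Data.List.Membership.Propositional using (_∈_)
  open import Data.List.Membership.Propositional.Properties using (∈-upTo⁺; ∈-upTo⁻)
  open import Data.List.Relation.Unary.Any using (here; there)
  open import Data.List.Relation.Unary.All using (All)
  open import Data.List.Relation.Unary.Unique.Propositional.Properties using (upTo⁺)
  open import Data.Integer as ℤ using (ℤ)
  open import Relation.Nullary using (¬_; yes; no; does)
  open import Relation.Binary.PropositionalEquality
  open import Data.Empty using (⊥-elim)
  open import Data.Product using (_×_; _,_; proj₁; proj₂; Σ-syntax)
  open import Data.Sum using (_⊎_; inj₁; inj₂)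
  open import Data.Bool using (if_then_else_)
  open import Relation.Binary using (tri<; tri≈; tri>)

  module Additive = Sums.Generic +-isCommutativeMonoid

  Tr-+ : ∀ x y → Tr (x + y) ≡ Tr x + Tr y
  Tr-+ x y = trans (Additive.Σ-cong (upTo n) (λ i → frobenius^-+ i x y)) (Additive.Σ-∙ (upTo n) _ _)

  p^i≢0 : ∀ i → NonZero (p ℕ.^ i)
  p^i≢0 i = ℕP.m^n≢0 p i

  Tr-0 : Tr 0# ≡ 0#
  Tr-0 = trans (Additive.Σ-cong (upTo n) (λ i → 0^n≡0 (p ℕ.^ i) {{p^i≢0 i}})) (Additive.Σ-ε (upTo n))

  Tr-fromℕ-* : ∀ k x → Tr (fromℕ k * x) ≡ fromℕ k * Tr x
  Tr-fromℕ-* zero x = trans (cong Tr (zeroˡ x)) (trans Tr-0 (sym (zeroˡ _)))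
  Tr-fromℕ-* (suc k) x = begin
    Tr ((1# + fromℕ k) * x) ≡⟨ cong Tr (trans (distribʳ x 1# (fromℕ k)) (cong (_+ fromℕ k * x) (*-identityˡ x))) ⟩
    Tr (x + fromℕ k * x) ≡⟨ Tr-+ x (fromℕ k * x) ⟩
    Tr x + Tr (fromℕ k * x) ≡⟨ cong (Tr x +_) (Tr-fromℕ-* k x) ⟩
    Tr x + fromℕ k * Tr x ≡⟨ solve 2 (λ t a → t :+ a :* t := (con (ℤ.+ 1) :+ a) :* t) refl (Tr x) (fromℕ k) ⟩
    (1# + fromℕ k) * Tr x ∎
    where open ≡-Reasoning

  Σ-frobenius : ∀ (L : List ℕ) (f : ℕ → Carrier) → Additive.Σ L f ^ p ≡ Additive.Σ L (λ i → f i ^ p)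
  Σ-frobenius [] f = 0^n≡0 p
  Σ-frobenius (i ∷ L) f = trans (frobenius-+ (f i) (Additive.Σ L f)) (cong (f i ^ p +_) (Σ-frobenius L f))

  Σ-rotate : ∀ m (f : ℕ → Carrier) → f m ≡ f 0 → Additive.Σ (upTo m) (λ i → f (suc i)) ≡ Additive.Σ (upTo m) f
  Σ-rotate m f e = begin
    Additive.Σ (upTo m) (λ i → f (suc i)) ≡⟨ Additive.Σ-applyUpTo-suc (λ i → i) m f ⟩
    Additive.Σ (applyUpTo suc m) f ≡⟨ solve 2 (λ a S → S := (a :+ S) :- a) refl (f 0) _ ⟩
    (f 0 + Additive.Σ (applyUpTo suc m) f) - f 0 ≡⟨ cong (_- f 0) (Additive.Σ-applyUpTo-last (λ i → i) m f) ⟩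
    (Additive.Σ (upTo m) f + f m) - f 0 ≡⟨ cong (λ z → (Additive.Σ (upTo m) f + z) - f 0) e ⟩
    (Additive.Σ (upTo m) f + f 0) - f 0 ≡⟨ solve 2 (λ a S → (S :+ a) :- a := S) refl (f 0) _ ⟩
    Additive.Σ (upTo m) f ∎
    where open ≡-Reasoning

  Tr^p≡Tr : ∀ x → Tr x ^ p ≡ Tr x
  Tr^p≡Tr x = begin
    Tr x ^ p ≡⟨ Σ-frobenius (upTo n) (λ i → x ^ (p ℕ.^ i)) ⟩
    Additive.Σ (upTo n) (λ i → (x ^ (p ℕ.^ i)) ^ p) ≡⟨ Additive.Σ-cong (upTo n) (λ i → trans (^-*-assoc x (p ℕ.^ i) p) (cong (x ^_) (ℕP.*-comm (p ℕ.^ i) p))) ⟩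
    Additive.Σ (upTo n) (λ i → x ^ (p ℕ.^ suc i)) ≡⟨ Σ-rotate n (λ i → x ^ (p ℕ.^ i)) (trans (cong (x ^_) (sym q≡p^n)) (trans (x^q≡x x) (sym (*-identityʳ x)))) ⟩
    Tr x ∎
    where open ≡-Reasoning

  traceIndex : ∀ x → Σ[ k ∈ ℕ ] (k < p × fromℕ k ≡ Tr x)
  traceIndex x = fixed-by-frobenius⇒fromℕ (Tr x) (Tr^p≡Tr x)

  χ : Carrier → ℕ
  χ x = proj₁ (traceIndex x)

  χ<p : ∀ x → χ x < p
  χ<p x = proj₁ (proj₂ (traceIndex x))

  χ-spec : ∀ x → fromℕ (χ x) ≡ Tr x
  χ-spec x = proj₂ (proj₂ (traceIndex x))

  -- Specifies any search g with the recursion of the local `go` of primeIndex; unification supplies go itself.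
  search-spec : ∀ (y : Carrier) (k : ℕ) → fromℕ k ≡ y → (g : List ℕ → ℕ) →
               (∀ a L → g (a ∷ L) ≡ (if does (fromℕ a ≟F y) then a else g L)) →
               (∀ a → a < p → fromℕ a ≡ y → a ≡ k) →
               ∀ L → (∀ a → a ∈ L → a < p) → k ∈ L → g L ≡ k
  search-spec y k ky g gs uniq (a ∷ L) bnd k∈ with fromℕ a ≟F y | gs a L
  ... | yes e | eq = trans eq (uniq a (bnd a (here refl)) e)
  ... | no ne | eq with k∈
  ...   | here refl = ⊥-elim (ne ky)
  ...   | there k∈L = trans eq (search-spec y k ky g gs uniq L (λ b b∈ → bnd b (there b∈)) k∈L)

  primeIndex-spec : ∀ y k → k < p → fromℕ k ≡ y → primeIndex y ≡ k
  primeIndex-spec y k k<p ky with upTo p | search-spec y k ky _ (λ _ _ → refl) | ∈-upTo⁺ {p} {k} k<p | (λ (a : ℕ) → ∈-upTo⁻ {p} {a})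
  ... | L | h | k∈ | bnd = h (λ a a<p e → fromℕ-injective a k a<p k<p (trans e (sym ky))) L (λ a a∈ → bnd a a∈) k∈

  χ-prime : ∀ x → primeIndex (Tr x) ≡ χ x
  χ-prime x = primeIndex-spec (Tr x) (χ x) (χ<p x) (χ-spec x)

  2≤q : 2 ≤ order
  2≤q = subst (2 ≤_) (sym order≡1+|units|) (s≤s 1≤|units|)

  1<p : 1 < p
  1<p = nonTrivial⇒n>1 p {{prime⇒nonTrivial p-prime}}

  1+N≤p*N : ∀ N → 1 ≤ N → suc N ≤ p ℕ.* N
  1+N≤p*N N 1≤N = ℕP.≤-trans (ℕP.+-monoˡ-≤ N 1≤N) (ℕP.≤-trans (ℕP.≤-reflexive (cong (N ℕ.+_) (sym (ℕP.+-identityʳ N)))) (ℕP.*-monoˡ-≤ N 1<p))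

  sumOfMonomials : (ℕ → ℕ) → List ℕ → Poly
  sumOfMonomials e L = foldr padd [] (map (λ i → monomial (e i)) L)

  eval-sumOfMonomials : ∀ e L x → eval (sumOfMonomials e L) x ≡ Additive.Σ L (λ i → x ^ e i)
  eval-sumOfMonomials e [] x = refl
  eval-sumOfMonomials e (i ∷ L) x = trans (eval-padd (monomial (e i)) (sumOfMonomials e L) x) (cong₂ _+_ (eval-monomial (e i) x) (eval-sumOfMonomials e L x))

  coef-sumOfMonomials : ∀ e L j → coef (sumOfMonomials e L) j ≡ Additive.Σ L (λ i → coef (monomial (e i)) j)
  coef-sumOfMonomials e [] j = refl
  coef-sumOfMonomials e (i ∷ L) j = trans (coef-padd (monomial (e i)) (sumOfMonomials e L) j) (cong (coef (monomial (e i)) j +_) (coef-sumOfMonomials e L j))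

  length-sumOfMonomials : ∀ e L M → (∀ i → i ∈ L → e i ≤ M) → length (sumOfMonomials e L) ≤ suc M
  length-sumOfMonomials e [] M b = z≤n
  length-sumOfMonomials e (i ∷ L) M b = length-padd (monomial (e i)) (sumOfMonomials e L) (suc M)
    (subst (_≤ suc M) (sym (length-monomial (e i))) (s≤s (b i (here refl)))) (length-sumOfMonomials e L M (λ j j∈ → b j (there j∈)))

  p^-injective : ∀ i j → p ℕ.^ i ≡ p ℕ.^ j → i ≡ j
  p^-injective i j e with ℕP.<-cmp i j
  ... | tri< i<j _ _ = ⊥-elim (ℕP.<-irrefl e (ℕP.^-monoʳ-< p 1<p i<j))
  ... | tri≈ _ ij _ = ij
  ... | tri> _ _ j<i = ⊥-elim (ℕP.<-irrefl (sym e) (ℕP.^-monoʳ-< p 1<p j<i))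

  findNonzeroTrace : ∀ (L : List Carrier) → (Σ[ x ∈ Carrier ] Tr x ≢ 0#) ⊎ (∀ x → x ∈ L → Tr x ≡ 0#)
  findNonzeroTrace [] = inj₂ (λ x ())
  findNonzeroTrace (x ∷ L) with Tr x ≟F 0#
  ... | no ne = inj₁ (x , ne)
  ... | yes e with findNonzeroTrace L
  ...   | inj₁ r = inj₁ r
  ...   | inj₂ f = inj₂ λ { y (here refl) → e ; y (there y∈) → f y y∈ }

  private module ℕIndexed = Additive.WithDecidableEquality ℕ._≟_

  -- Σ_{i<m} X^(p^i) is a nonzero polynomial with fewer than q = p^m coefficients.
  trace-not-identically-zero : ∀ m → order ≡ p ℕ.^ m → ¬ (∀ x → x ∈ elements → Additive.Σ (upTo m) (λ i → x ^ (p ℕ.^ i)) ≡ 0#)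
  trace-not-identically-zero zero qe allz = ℕP.<-irrefl (sym qe) 2≤q
  trace-not-identically-zero (suc n') qe allz = 0≢1 (trans (sym (coef-zero P N zs)) cN)
    where
    P : Poly
    P = sumOfMonomials (p ℕ.^_) (upTo (suc n'))
    N : ℕ
    N = p ℕ.^ n'
    lenP : length P ≤ length elements
    lenP = ℕP.≤-trans (length-sumOfMonomials (p ℕ.^_) (upTo (suc n')) N (λ i i∈ → ℕP.^-monoʳ-≤ p (ℕP.<⇒≤pred (∈-upTo⁻ i∈))))
             (subst (suc N ≤_) (sym qe) (1+N≤p*N N (ℕP.m^n>0 p n')))
    zs : All (_≡ 0#) P
    zs = roots⇒zeros elements elements-unique P lenP (λ a _ → trans (eval-sumOfMonomials (p ℕ.^_) (upTo (suc n')) a) (allz a (elements-complete a)))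
    cN : coef P N ≡ 1#
    cN = begin
      coef P N ≡⟨ coef-sumOfMonomials (p ℕ.^_) (upTo (suc n')) N ⟩
      Additive.Σ (upTo (suc n')) (λ i → coef (monomial (p ℕ.^ i)) N) ≡⟨ Additive.Σ-cong (upTo (suc n')) cm ⟩
      Additive.Σ (upTo (suc n')) (λ i → Additive.ind (i ℕ.≟ n') 1#) ≡⟨ ℕIndexed.Σ-delta (upTo (suc n')) n' (λ _ → 1#) (upTo⁺ (suc n')) (∈-upTo⁺ (ℕP.n<1+n n')) ⟩
      1# ∎
      where
      open ≡-Reasoning
      cm : ∀ i → coef (monomial (p ℕ.^ i)) N ≡ Additive.ind (i ℕ.≟ n') 1#
      cm i with i ℕ.≟ n'
      ... | yes refl = trans (coef-monomial-≡ N) (sym (Additive.ind-yes (i ℕ.≟ i) refl 1#))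
      ... | no ne = trans (coef-monomial-≢ (p ℕ.^ i) N (λ e → ne (p^-injective i n' (sym e)))) (sym (Additive.ind-no (i ℕ.≟ n') ne 1#))

  ∃Tr≢0 : Σ[ x ∈ Carrier ] Tr x ≢ 0#
  ∃Tr≢0 with findNonzeroTrace elements
  ... | inj₁ r = r
  ... | inj₂ allz = ⊥-elim (trace-not-identically-zero n q≡p^n allz)

  c₀ : Carrier
  c₀ = proj₁ ∃Tr≢0

  t₀ : Carrier
  t₀ = Tr c₀

  t₀≢0 : t₀ ≢ 0#
  t₀≢0 = proj₂ ∃Tr≢0

  t₀⁻¹^p≡t₀⁻¹ : inv t₀ ^ p ≡ inv t₀
  t₀⁻¹^p≡t₀⁻¹ = *-cancelˡ t₀ _ _ t₀≢0 (begin
    t₀ * inv t₀ ^ p ≡⟨ cong (_* inv t₀ ^ p) (sym (Tr^p≡Tr c₀)) ⟩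
    t₀ ^ p * inv t₀ ^ p ≡⟨ sym (^-distribʳ-* t₀ (inv t₀) p) ⟩
    (t₀ * inv t₀) ^ p ≡⟨ cong (_^ p) (inv-r t₀ t₀≢0) ⟩
    1# ^ p ≡⟨ 1^n≡1 p ⟩
    1# ≡⟨ sym (inv-r t₀ t₀≢0) ⟩
    t₀ * inv t₀ ∎)
    where open ≡-Reasoning

  k₀ : ℕ
  k₀ = proj₁ (fixed-by-frobenius⇒fromℕ (inv t₀) t₀⁻¹^p≡t₀⁻¹)

  fromℕk₀≡t₀⁻¹ : fromℕ k₀ ≡ inv t₀
  fromℕk₀≡t₀⁻¹ = proj₂ (proj₂ (fixed-by-frobenius⇒fromℕ (inv t₀) t₀⁻¹^p≡t₀⁻¹))

  traceOne : Carrier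
  traceOne = fromℕ k₀ * c₀

  Tr-traceOne : Tr traceOne ≡ 1#
  Tr-traceOne = trans (Tr-fromℕ-* k₀ c₀) (trans (cong (_* t₀) fromℕk₀≡t₀⁻¹) (inv-l t₀ t₀≢0))

  χ-unique : ∀ x k → k < p → fromℕ k ≡ Tr x → χ x ≡ k
  χ-unique x k k<p e = fromℕ-injective (χ x) k (χ<p x) k<p (trans (χ-spec x) (sym e))

  χ-+ : ∀ x y → χ (x + y) ≡ (χ x ℕ.+ χ y) % p
  χ-+ x y = χ-unique (x + y) _ (m%n<n _ p) (begin
    fromℕ ((χ x ℕ.+ χ y) % p) ≡⟨ sym (fromℕ-% _) ⟩
    fromℕ (χ x ℕ.+ χ y) ≡⟨ fromℕ-+ (χ x) (χ y) ⟩
    fromℕ (χ x) + fromℕ (χ y) ≡⟨ cong₂ _+_ (χ-spec x) (χ-spec y) ⟩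
    Tr x + Tr y ≡⟨ sym (Tr-+ x y) ⟩
    Tr (x + y) ∎)
    where open ≡-Reasoning

  χ-0 : χ 0# ≡ 0
  χ-0 = χ-unique 0# 0 (ℕ.>-nonZero⁻¹ p) (sym Tr-0)

  χ-shift : ∀ x → χ (x + traceOne) ≡ suc (χ x) % p
  χ-shift x = χ-unique (x + traceOne) _ (m%n<n _ p) (begin
    fromℕ (suc (χ x) % p) ≡⟨ sym (fromℕ-% _) ⟩
    fromℕ (suc (χ x)) ≡⟨ cong₂ _+_ refl (χ-spec x) ⟩
    1# + Tr x ≡⟨ cong (_+ Tr x) (sym Tr-traceOne) ⟩
    Tr traceOne + Tr x ≡⟨ +-comm _ _ ⟩
    Tr x + Tr traceOne ≡⟨ sym (Tr-+ x traceOne) ⟩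
    Tr (x + traceOne) ∎)
    where open ≡-Reasoning


module PowerBijection (F : FiniteField) (s : ℕ) (0<s : 0 < s)
                      (gcd[s,q-1]≡1 : gcd s (FiniteField.order F ∸ 1) ≡ 1) where
  open Field F
  open import Data.Nat as ℕ using (ℕ; _≤_; >-nonZero)
  import Data.Nat.Properties as ℕP
  open import Data.Nat.GCD using (GCD; gcd-GCD; module Bézout)
  open import Data.Nat.Tactic.RingSolver using (solve-∀)
  open import Data.Integer as ℤ using (ℤ)
  open import Data.List using (length)
  open import Relation.Nullary using (yes; no)
  open import Relation.Binary.PropositionalEquality

  |units| : ℕ
  |units| = length units

  gcd[s,|units|]≡1 : gcd s |units| ≡ 1
  gcd[s,|units|]≡1 = subst (λ z → gcd s (z ∸ 1) ≡ 1) order≡1+|units| gcd[s,q-1]≡1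

  x^[|units|*k]≡1 : ∀ z k → z ≢ 0# → (z ^ |units|) ^ k ≡ 1#
  x^[|units|*k]≡1 z k nz = trans (cong (_^ k) (x^|units|≡1 z nz)) (1^n≡1 k)

  record InverseExponent : Set where
    field
      s⁻¹ : ℕ
      e-inverts-units : ∀ z → z ≢ 0# → z ^ (s ℕ.* s⁻¹) ≡ z
      1≤s*s⁻¹ : 1 ≤ s ℕ.* s⁻¹

  -- Bézout makes s * x ≡ ±1 modulo |units|. For -1, z ^ (x * s) = z⁻¹, so (x * s)² inverts twice;
  -- adding |units| keeps s * s⁻¹ positive, so that 0 is fixed as well.
  inverseExponent : InverseExponent
  inverseExponent with Bézout.identity (subst (GCD s |units|) gcd[s,|units|]≡1 (gcd-GCD s |units|))
  ... | Bézout.+- x y eq = record { s⁻¹ = x ℕ.+ |units| ; e-inverts-units = inverts ; 1≤s*s⁻¹ = positive }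
    where
    inverts : ∀ z → z ≢ 0# → z ^ (s ℕ.* (x ℕ.+ |units|)) ≡ z
    inverts z nz = begin
      z ^ (s ℕ.* (x ℕ.+ |units|)) ≡⟨ cong (z ^_) (ℕP.*-distribˡ-+ s x |units|) ⟩
      z ^ (s ℕ.* x ℕ.+ s ℕ.* |units|) ≡⟨ ^-distribˡ-+-* z (s ℕ.* x) (s ℕ.* |units|) ⟩
      z ^ (s ℕ.* x) * z ^ (s ℕ.* |units|) ≡⟨ cong₂ _*_ (cong (z ^_) (trans (ℕP.*-comm s x) (sym eq))) (trans (cong (z ^_) (ℕP.*-comm s |units|)) (trans (sym (^-*-assoc z |units| s)) (x^[|units|*k]≡1 z s nz))) ⟩
      z ^ (1 ℕ.+ y ℕ.* |units|) * 1# ≡⟨ *-identityʳ _ ⟩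
      z * z ^ (y ℕ.* |units|) ≡⟨ cong (z *_) (trans (cong (z ^_) (ℕP.*-comm y |units|)) (trans (sym (^-*-assoc z |units| y)) (x^[|units|*k]≡1 z y nz))) ⟩
      z * 1# ≡⟨ *-identityʳ z ⟩
      z ∎
      where open ≡-Reasoning
    positive : 1 ≤ s ℕ.* (x ℕ.+ |units|)
    positive = ℕP.*-mono-≤ 0<s (ℕP.≤-trans 1≤|units| (ℕP.m≤n+m |units| x))
  ... | Bézout.-+ x y eq = record { s⁻¹ = x ℕ.* x ℕ.* s ℕ.+ |units| ; e-inverts-units = inverts ; 1≤s*s⁻¹ = positive }
    where
    x*s-inverts : ∀ z → z ≢ 0# → z ^ (x ℕ.* s) ≡ inv z
    x*s-inverts z nz = inv-unique z _ nz (begin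
      z * z ^ (x ℕ.* s) ≡⟨ cong (z ^_) eq ⟩
      z ^ (y ℕ.* |units|) ≡⟨ trans (cong (z ^_) (ℕP.*-comm y |units|)) (trans (sym (^-*-assoc z |units| y)) (x^[|units|*k]≡1 z y nz)) ⟩
      1# ∎)
      where open ≡-Reasoning
    inverts : ∀ z → z ≢ 0# → z ^ (s ℕ.* (x ℕ.* x ℕ.* s ℕ.+ |units|)) ≡ z
    inverts z nz = begin
      z ^ (s ℕ.* (x ℕ.* x ℕ.* s ℕ.+ |units|)) ≡⟨ cong (z ^_) (ℕP.*-distribˡ-+ s (x ℕ.* x ℕ.* s) |units|) ⟩
      z ^ (s ℕ.* (x ℕ.* x ℕ.* s) ℕ.+ s ℕ.* |units|) ≡⟨ ^-distribˡ-+-* z (s ℕ.* (x ℕ.* x ℕ.* s)) (s ℕ.* |units|) ⟩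
      z ^ (s ℕ.* (x ℕ.* x ℕ.* s)) * z ^ (s ℕ.* |units|) ≡⟨ cong₂ _*_ (cong (z ^_) (ar x s)) (trans (cong (z ^_) (ℕP.*-comm s |units|)) (trans (sym (^-*-assoc z |units| s)) (x^[|units|*k]≡1 z s nz))) ⟩
      z ^ ((x ℕ.* s) ℕ.* (x ℕ.* s)) * 1# ≡⟨ *-identityʳ _ ⟩
      z ^ ((x ℕ.* s) ℕ.* (x ℕ.* s)) ≡⟨ sym (^-*-assoc z (x ℕ.* s) (x ℕ.* s)) ⟩
      (z ^ (x ℕ.* s)) ^ (x ℕ.* s) ≡⟨ cong (_^ (x ℕ.* s)) (x*s-inverts z nz) ⟩
      inv z ^ (x ℕ.* s) ≡⟨ inv-^ z (x ℕ.* s) nz ⟩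
      inv (z ^ (x ℕ.* s)) ≡⟨ cong inv (x*s-inverts z nz) ⟩
      inv (inv z) ≡⟨ inv-involutive z nz ⟩
      z ∎
      where
      open ≡-Reasoning
      ar : ∀ x s → s ℕ.* (x ℕ.* x ℕ.* s) ≡ (x ℕ.* s) ℕ.* (x ℕ.* s)
      ar = solve-∀
    positive : 1 ≤ s ℕ.* (x ℕ.* x ℕ.* s ℕ.+ |units|)
    positive = ℕP.*-mono-≤ 0<s (ℕP.≤-trans 1≤|units| (ℕP.m≤n+m |units| _))

  open InverseExponent inverseExponent

  x^[s*s⁻¹]≡x : ∀ z → z ^ (s ℕ.* s⁻¹) ≡ z
  x^[s*s⁻¹]≡x z with z ≟F 0#
  ... | yes refl = 0^n≡0 (s ℕ.* s⁻¹) {{>-nonZero 1≤s*s⁻¹}}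
  ... | no nz = e-inverts-units z nz

  pow-s : Carrier → Carrier
  pow-s z = z ^ s

  root-s : Carrier → Carrier
  root-s z = z ^ s⁻¹

  pow-root : ∀ z → pow-s (root-s z) ≡ z
  pow-root z = trans (^-*-assoc z s⁻¹ s) (trans (cong (z ^_) (ℕP.*-comm s⁻¹ s)) (x^[s*s⁻¹]≡x z))

  root-pow : ∀ z → root-s (pow-s z) ≡ z
  root-pow z = trans (^-*-assoc z s s⁻¹) (x^[s*s⁻¹]≡x z)

  ^s-injective : ∀ a b → a ^ s ≡ b ^ s → a ≡ b
  ^s-injective a b eq = trans (sym (root-pow a)) (trans (cong root-s eq) (root-pow b))

  0^s≡0 : 0# ^ s ≡ 0#
  0^s≡0 = 0^n≡0 s {{>-nonZero 0<s}}

  -1# : Carrier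
  -1# = - 1#

  -- (-1)^s squares to 1, so it is 1 or -1; if it is 1 = 1^s, injectivity gives -1 = 1.
  [-1]^s≡-1 : -1# ^ s ≡ -1#
  [-1]^s≡-1 with (-1# ^ s) ≟F 1#
  ... | yes e1 = trans e1 (sym (^s-injective -1# 1# (trans e1 (sym (1^n≡1 s)))))
  ... | no ne = begin
      c ≡⟨ solve 1 (λ c → c := (c :+ con (ℤ.+ 1)) :- con (ℤ.+ 1)) refl c ⟩
      (c + 1#) - 1# ≡⟨ cong (_- 1#) c+1≡0 ⟩
      0# - 1# ≡⟨ +-identityˡ _ ⟩
      -1# ∎
    where
    open ≡-Reasoning
    c : Carrier
    c = -1# ^ s
    c*c≡1 : c * c ≡ 1#
    c*c≡1 = trans (sym (^-distribʳ-* -1# -1# s)) (trans (cong (_^ s) (solve 0 (:- con (ℤ.+ 1) :* :- con (ℤ.+ 1) := con (ℤ.+ 1)) refl)) (1^n≡1 s))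
    [c-1][c+1]≡0 : (c - 1#) * (c + 1#) ≡ 0#
    [c-1][c+1]≡0 = begin
      (c - 1#) * (c + 1#) ≡⟨ solve 1 (λ c → (c :- con (ℤ.+ 1)) :* (c :+ con (ℤ.+ 1)) := c :* c :- con (ℤ.+ 1)) refl c ⟩
      c * c - 1# ≡⟨ cong (_- 1#) c*c≡1 ⟩
      1# - 1# ≡⟨ -‿inverseʳ 1# ⟩
      0# ∎
    c+1≡0 : c + 1# ≡ 0#
    c+1≡0 = x*y≡0⇒y≡0 (c - 1#) (c + 1#) [c-1][c+1]≡0 (λ z → ne (x-y≡0⇒x≡y c 1# z))

  -‿^s : ∀ x → (- x) ^ s ≡ - (x ^ s)
  -‿^s x = begin
    (- x) ^ s ≡⟨ cong (_^ s) (solve 1 (λ x → :- x := :- con (ℤ.+ 1) :* x) refl x) ⟩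
    (-1# * x) ^ s ≡⟨ ^-distribʳ-* -1# x s ⟩
    -1# ^ s * x ^ s ≡⟨ cong (_* x ^ s) [-1]^s≡-1 ⟩
    -1# * x ^ s ≡⟨ solve 1 (λ y → :- con (ℤ.+ 1) :* y := :- y) refl (x ^ s) ⟩
    - (x ^ s) ∎
    where open ≡-Reasoning


module Cyclotomic (p : ℕ) .{{_ : NonZero p}} where
  open Sums using (Σ; ind)
  open import Data.Nat as ℕ using (zero; suc; _%_)
  import Data.Nat.Properties as ℕP
  open import Data.Nat.DivMod using (m%n<n; m%n%n≡m%n; [m+n]%n≡m%n; %-distribˡ-+; m<n⇒m%n≡m)
  open import Data.Integer using (ℤ; 0ℤ; 1ℤ) renaming (_+_ to _+ℤ_; _-_ to _-ℤ_; _*_ to _*ℤ_)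
  import Data.Integer.Properties as ℤP
  open import Data.Integer.Solver using (module +-*-Solver)
  open +-*-Solver
  open import Data.List using (List; []; _∷_; map; upTo; cartesianProduct)
  open import Data.List.Membership.Propositional using (_∈_)
  open import Data.List.Membership.Propositional.Properties using (∈-upTo⁺; ∈-upTo⁻)
  open import Data.List.Relation.Unary.Unique.Propositional.Properties using (upTo⁺)
  open import Relation.Nullary using (Dec; yes; no; does; ¬_)
  open import Relation.Binary.PropositionalEquality
  open import Data.Product using (_×_; _,_)
  open import Data.Bool using (if_then_else_)
  open import Data.Empty using (⊥-elim)

  infixl 6 _⊕_
  infixl 7 _⊗_
  infix 4 _≈_ _≐_

  _⊗_ : Cyc → Cyc → Cyc
  _⊗_ = _*ᶜ_ p

  _⊕_ : Cyc → Cyc → Cyc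
  _⊕_ = _+ᶜ_ p

  zeroᶜ : Cyc
  zeroᶜ = intᶜ p 0ℤ

  Σᶜ : {A : Set} → List A → (A → Cyc) → Cyc
  Σᶜ L f = sumᶜ p (map f L)

  _≐_ : Cyc → Cyc → Set
  f ≐ g = ∀ i → i < p → f i ≡ g i

  indᶜ : {P : Set} → Dec P → Cyc → Cyc
  indᶜ d c = if does d then c else zeroᶜ

  zeroᶜ-at : ∀ i → zeroᶜ i ≡ 0ℤ
  zeroᶜ-at zero = refl
  zeroᶜ-at (suc i) = refl

  Σᶜ-at : ∀ {A : Set} (L : List A) (f : A → Cyc) i → Σᶜ L f i ≡ Σ L (λ x → f x i)
  Σᶜ-at [] f i = zeroᶜ-at i
  Σᶜ-at (x ∷ L) f i = cong (f x i +ℤ_) (Σᶜ-at L f i)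

  indᶜ-at : ∀ {P : Set} (d : Dec P) c i → indᶜ d c i ≡ ind d (c i)
  indᶜ-at (yes _) c i = refl
  indᶜ-at (no _) c i = zeroᶜ-at i

  intᶜ-at : ∀ m i → intᶜ p m i ≡ ind (i ℕ.≟ 0) m
  intᶜ-at m zero = refl
  intᶜ-at m (suc i) = refl

  indᶜ-no : ∀ {P : Set} (d : Dec P) c → ¬ P → indᶜ d c ≡ zeroᶜ
  indᶜ-no (yes x) c ¬p = ⊥-elim (¬p x)
  indᶜ-no (no _) c ¬p = refl

  indᶜ-yes : ∀ {P : Set} (d : Dec P) c → P → indᶜ d c ≡ c
  indᶜ-yes (yes _) c _ = refl
  indᶜ-yes (no ¬p) c x = ⊥-elim (¬p x)

  ≡⇒≐ : ∀ {f g : Cyc} → f ≡ g → f ≐ g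
  ≡⇒≐ refl i _ = refl

  ≐-refl : ∀ {f} → f ≐ f
  ≐-refl i _ = refl
  ≐-sym : ∀ {f g} → f ≐ g → g ≐ f
  ≐-sym e i i<p = sym (e i i<p)
  ≐-trans : ∀ {f g h} → f ≐ g → g ≐ h → f ≐ h
  ≐-trans e e' i i<p = trans (e i i<p) (e' i i<p)

  -- The same relation as _≈ᶜ_ p, but as a record so that both sides can be inferred from goals.
  record _≈_ (f g : Cyc) : Set where
    constructor mk≈
    field
      cst : ℤ
      eqn : ∀ i → i < p → f i ≡ g i +ℤ cst

  ≈⇒≈ᶜ : ∀ {f g} → f ≈ g → _≈ᶜ_ p f g
  ≈⇒≈ᶜ (mk≈ c e) = c , e

  ≐⇒≈ : ∀ {f g} → f ≐ g → f ≈ g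
  ≐⇒≈ e = mk≈ 0ℤ λ i i<p → trans (e i i<p) (sym (ℤP.+-identityʳ _))

  ≈-refl : ∀ {f} → f ≈ f
  ≈-refl = ≐⇒≈ ≐-refl
  ≈-trans : ∀ {f g h} → f ≈ g → g ≈ h → f ≈ h
  ≈-trans {f} {g} {h} (mk≈ c e) (mk≈ d e') = mk≈ (d +ℤ c) λ i i<p → trans (e i i<p) (trans (cong (_+ℤ c) (e' i i<p)) (ℤP.+-assoc (h i) d c))
  ≐-≈-trans : ∀ {f g h} → f ≐ g → g ≈ h → f ≈ h
  ≐-≈-trans e e' = ≈-trans (≐⇒≈ e) e'
  ≈-≐-trans : ∀ {f g h} → f ≈ g → g ≐ h → f ≈ h
  ≈-≐-trans e e' = ≈-trans e (≐⇒≈ e')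

  ⊕-cong≈ : ∀ {f f' g g'} → f ≈ f' → g ≈ g' → f ⊕ g ≈ f' ⊕ g'
  ⊕-cong≈ {f} {f'} {g} {g'} (mk≈ c e) (mk≈ d e') = mk≈ (c +ℤ d) λ i i<p → trans (cong₂ _+ℤ_ (e i i<p) (e' i i<p))
    (solve 4 (λ a c b d → (a :+ c) :+ (b :+ d) := (a :+ b) :+ (c :+ d)) refl (f' i) c (g' i) d)

  Σᶜ-cong≐ : ∀ {A : Set} (L : List A) {f g : A → Cyc} → (∀ x → f x ≐ g x) → Σᶜ L f ≐ Σᶜ L g
  Σᶜ-cong≐ L {f} {g} e i i<p = trans (Σᶜ-at L f i) (trans (Sums.Σ-cong L (λ x → e x i i<p)) (sym (Σᶜ-at L g i)))

  Σᶜ-cong≈ : ∀ {A : Set} (L : List A) {f g : A → Cyc} → (∀ x → f x ≈ g x) → Σᶜ L f ≈ Σᶜ L g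
  Σᶜ-cong≈ L {f} {g} e = mk≈ (Σ L (λ x → _≈_.cst (e x))) λ i i<p → begin
    Σᶜ L f i ≡⟨ Σᶜ-at L f i ⟩
    Σ L (λ x → f x i) ≡⟨ Sums.Σ-cong L (λ x → _≈_.eqn (e x) i i<p) ⟩
    Σ L (λ x → g x i +ℤ _≈_.cst (e x)) ≡⟨ Sums.Σ-∙ L (λ x → g x i) (λ x → _≈_.cst (e x)) ⟩
    Σ L (λ x → g x i) +ℤ Σ L (λ x → _≈_.cst (e x)) ≡⟨ cong (_+ℤ Σ L (λ x → _≈_.cst (e x))) (sym (Σᶜ-at L g i)) ⟩
    Σᶜ L g i +ℤ Σ L (λ x → _≈_.cst (e x)) ∎
    where open ≡-Reasoning

  Σᶜ-swap : ∀ {A B : Set} (L : List A) (M : List B) (f : A → B → Cyc) →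
            Σᶜ L (λ a → Σᶜ M (f a)) ≐ Σᶜ M (λ b → Σᶜ L (λ a → f a b))
  Σᶜ-swap L M f i _ = begin
    Σᶜ L (λ a → Σᶜ M (f a)) i ≡⟨ Σᶜ-at L _ i ⟩
    Σ L (λ a → Σᶜ M (f a) i) ≡⟨ Sums.Σ-cong L (λ a → Σᶜ-at M (f a) i) ⟩
    Σ L (λ a → Σ M (λ b → f a b i)) ≡⟨ Sums.Σ-swap L M _ ⟩
    Σ M (λ b → Σ L (λ a → f a b i)) ≡⟨ sym (Sums.Σ-cong M (λ b → Σᶜ-at L (λ a → f a b) i)) ⟩
    Σ M (λ b → Σᶜ L (λ a → f a b) i) ≡⟨ sym (Σᶜ-at M _ i) ⟩
    Σᶜ M (λ b → Σᶜ L (λ a → f a b)) i ∎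
    where open ≡-Reasoning

  Σᶜ-zero : ∀ {A : Set} (L : List A) → Σᶜ L (λ _ → zeroᶜ) ≐ zeroᶜ
  Σᶜ-zero L i _ = trans (Σᶜ-at L _ i) (trans (Sums.Σ-cong L (λ _ → zeroᶜ-at i)) (trans (Sums.Σ-ε L) (sym (zeroᶜ-at i))))

  Σᶜ-indᶜ : ∀ {A : Set} (L : List A) {P : Set} (d : Dec P) (f : A → Cyc) → Σᶜ L (λ x → indᶜ d (f x)) ≐ indᶜ d (Σᶜ L f)
  Σᶜ-indᶜ L (yes _) f = ≐-refl
  Σᶜ-indᶜ L (no _) f = Σᶜ-zero L

  Σᶜ-int : ∀ {A : Set} (L : List A) (g : A → ℤ) → Σᶜ L (λ x → intᶜ p (g x)) ≐ intᶜ p (Σ L g)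
  Σᶜ-int L g i _ = begin
    Σᶜ L (λ x → intᶜ p (g x)) i ≡⟨ Σᶜ-at L _ i ⟩
    Σ L (λ x → intᶜ p (g x) i) ≡⟨ Sums.Σ-cong L (λ x → intᶜ-at (g x) i) ⟩
    Σ L (λ x → ind (i ℕ.≟ 0) (g x)) ≡⟨ Sums.Σ-ind L (i ℕ.≟ 0) g ⟩
    ind (i ℕ.≟ 0) (Σ L g) ≡⟨ sym (intᶜ-at _ i) ⟩
    intᶜ p (Σ L g) i ∎
    where open ≡-Reasoning

  intᶜ-⊕ : ∀ a b → intᶜ p a ⊕ intᶜ p b ≐ intᶜ p (a +ℤ b)
  intᶜ-⊕ a b zero _ = refl
  intᶜ-⊕ a b (suc i) _ = refl

  indᶜ-int : ∀ {P : Set} (d : Dec P) a → indᶜ d (intᶜ p a) ≐ intᶜ p (ind d a)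
  indᶜ-int (yes _) a = ≐-refl
  indᶜ-int (no _) a zero _ = refl
  indᶜ-int (no _) a (suc i) _ = refl

  indᶜ-⇔ : ∀ {P Q : Set} (d : Dec P) (e : Dec Q) → (P → Q) → (Q → P) → ∀ c → indᶜ d c ≡ indᶜ e c
  indᶜ-⇔ (yes p) (yes q) f g c = refl
  indᶜ-⇔ (yes p) (no ¬q) f g c = ⊥-elim (¬q (f p))
  indᶜ-⇔ (no ¬p) (yes q) f g c = ⊥-elim (¬p (g q))
  indᶜ-⇔ (no ¬p) (no ¬q) f g c = refl

  indᶜ-cong≐ : ∀ {P : Set} (d : Dec P) {c c'} → c ≐ c' → indᶜ d c ≐ indᶜ d c'
  indᶜ-cong≐ (yes _) e = e
  indᶜ-cong≐ (no _) e = ≐-refl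

  indᶜ-cong≈ : ∀ {P : Set} (d : Dec P) {c c'} → c ≈ c' → indᶜ d c ≈ indᶜ d c'
  indᶜ-cong≈ (yes _) e = e
  indᶜ-cong≈ (no _) e = ≈-refl

  ⊕-≈-cancelˡ : ∀ {A B C} X Y → A ≐ B ⊕ C → B ≈ intᶜ p X → A ≈ intᶜ p Y → C ≈ intᶜ p (Y -ℤ X)
  ⊕-≈-cancelˡ {A} {B} {C} X Y e (mk≈ b eb) (mk≈ a ea) = mk≈ (a -ℤ b) λ i i<p → begin
    C i ≡⟨ y≡[x+y]-x (B i) (C i) ⟩
    (B i +ℤ C i) -ℤ B i ≡⟨ cong₂ _-ℤ_ (sym (e i i<p)) (eb i i<p) ⟩
    A i -ℤ (intᶜ p X i +ℤ b) ≡⟨ cong (_-ℤ (intᶜ p X i +ℤ b)) (ea i i<p) ⟩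
    (intᶜ p Y i +ℤ a) -ℤ (intᶜ p X i +ℤ b) ≡⟨ intᶜ-difference i ⟩
    intᶜ p (Y -ℤ X) i +ℤ (a -ℤ b) ∎
    where
    open ≡-Reasoning
    y≡[x+y]-x : ∀ x y → y ≡ (x +ℤ y) -ℤ x
    y≡[x+y]-x = solve 2 (λ x y → y := (x :+ y) :- x) refl
    intᶜ-difference : ∀ i → (intᶜ p Y i +ℤ a) -ℤ (intᶜ p X i +ℤ b) ≡ intᶜ p (Y -ℤ X) i +ℤ (a -ℤ b)
    intᶜ-difference zero = solve 4 (λ Y a X b → (Y :+ a) :- (X :+ b) := (Y :- X) :+ (a :- b)) refl Y a X b
    intᶜ-difference (suc i) = solve 2 (λ a b → (con 0ℤ :+ a) :- (con 0ℤ :+ b) := con 0ℤ :+ (a :- b)) refl a b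

  ⊕-≈0-cancelˡ : ∀ {A B C R} → A ≐ B ⊕ C → B ≈ zeroᶜ → A ≈ R → C ≈ R
  ⊕-≈0-cancelˡ {A} {B} {C} {R} e (mk≈ b eb) (mk≈ a ea) = mk≈ (a -ℤ b) λ i i<p → begin
    C i ≡⟨ solve 2 (λ b c → c := (b :+ c) :- b) refl (B i) (C i) ⟩
    (B i +ℤ C i) -ℤ B i ≡⟨ cong₂ _-ℤ_ (sym (e i i<p)) (trans (eb i i<p) (cong (_+ℤ b) (zeroᶜ-at i))) ⟩
    A i -ℤ (0ℤ +ℤ b) ≡⟨ cong (_-ℤ (0ℤ +ℤ b)) (ea i i<p) ⟩
    (R i +ℤ a) -ℤ (0ℤ +ℤ b) ≡⟨ solve 3 (λ r a b → (r :+ a) :- (con 0ℤ :+ b) := r :+ (a :- b)) refl (R i) a b ⟩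
    R i +ℤ (a -ℤ b) ∎
    where open ≡-Reasoning

  Σᶜ-cartesianProduct : ∀ {A B : Set} (L : List A) (M : List B) (f : A × B → Cyc) →
            Σᶜ (cartesianProduct L M) f ≐ Σᶜ L (λ a → Σᶜ M (λ b → f (a , b)))
  Σᶜ-cartesianProduct L M f i _ = begin
    Σᶜ (cartesianProduct L M) f i ≡⟨ Σᶜ-at (cartesianProduct L M) f i ⟩
    Σ (cartesianProduct L M) (λ t → f t i) ≡⟨ Sums.Σ-cartesianProduct L M _ ⟩
    Σ L (λ a → Σ M (λ b → f (a , b) i)) ≡⟨ sym (Sums.Σ-cong L (λ a → Σᶜ-at M _ i)) ⟩
    Σ L (λ a → Σᶜ M (λ b → f (a , b)) i) ≡⟨ sym (Σᶜ-at L _ i) ⟩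
    Σᶜ L (λ a → Σᶜ M (λ b → f (a , b))) i ∎
    where open ≡-Reasoning

  Σᶜ-cong-∈ : ∀ {A : Set} (L : List A) {f g : A → Cyc} → (∀ x → x ∈ L → f x ≐ g x) → Σᶜ L f ≐ Σᶜ L g
  Σᶜ-cong-∈ L {f} {g} e i i<p = trans (Σᶜ-at L f i) (trans (Sums.Σ-cong-∈ L (λ x x∈ → e x x∈ i i<p)) (sym (Σᶜ-at L g i)))

  Σᶜ-≈zero : ∀ {A : Set} (L : List A) {f : A → Cyc} → (∀ x → f x ≈ zeroᶜ) → Σᶜ L f ≈ zeroᶜ
  Σᶜ-≈zero L e = ≈-≐-trans (Σᶜ-cong≈ L e) (Σᶜ-zero L)

  ⊗-cong≐ : ∀ {f f' g g'} → f ≐ f' → g ≐ g' → f ⊗ g ≐ f' ⊗ g'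
  ⊗-cong≐ {f} {f'} {g} {g'} e e' k k<p = Sums.Σ-cong-∈ (upTo p) (λ i i∈ →
    cong₂ _*ℤ_ (e i (∈-upTo⁻ i∈)) (e' _ (m%n<n _ p)))

  Σᶜ-⊗ˡ : ∀ {A : Set} (L : List A) (f : A → Cyc) g → Σᶜ L f ⊗ g ≐ Σᶜ L (λ x → f x ⊗ g)
  Σᶜ-⊗ˡ L f g k _ = begin
    (Σᶜ L f ⊗ g) k ≡⟨ Sums.Σ-cong (upTo p) (λ i → cong (_*ℤ g ((k ℕ.+ (p ℕ.∸ i)) % p)) (Σᶜ-at L f i)) ⟩
    Σ (upTo p) (λ i → Σ L (λ x → f x i) *ℤ g ((k ℕ.+ (p ℕ.∸ i)) % p)) ≡⟨ Sums.Σ-cong (upTo p) (λ i →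
        trans (ℤP.*-comm (Σ L (λ x → f x i)) _) (sym (Sums.Σ-*ˡ L (g ((k ℕ.+ (p ℕ.∸ i)) % p)) (λ x → f x i)))) ⟩
    Σ (upTo p) (λ i → Σ L (λ x → g ((k ℕ.+ (p ℕ.∸ i)) % p) *ℤ f x i)) ≡⟨ Sums.Σ-swap (upTo p) L _ ⟩
    Σ L (λ x → Σ (upTo p) (λ i → g ((k ℕ.+ (p ℕ.∸ i)) % p) *ℤ f x i)) ≡⟨ Sums.Σ-cong L (λ x → Sums.Σ-cong (upTo p) (λ i → ℤP.*-comm (g ((k ℕ.+ (p ℕ.∸ i)) % p)) (f x i))) ⟩
    Σ L (λ x → (f x ⊗ g) k) ≡⟨ sym (Σᶜ-at L _ k) ⟩
    Σᶜ L (λ x → f x ⊗ g) k ∎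
    where open ≡-Reasoning

  ⊗-Σᶜʳ : ∀ {A : Set} (L : List A) (f : A → Cyc) g → g ⊗ Σᶜ L f ≐ Σᶜ L (λ x → g ⊗ f x)
  ⊗-Σᶜʳ L f g k _ = begin
    (g ⊗ Σᶜ L f) k ≡⟨ Sums.Σ-cong (upTo p) (λ i → cong (g i *ℤ_) (Σᶜ-at L f ((k ℕ.+ (p ℕ.∸ i)) % p))) ⟩
    Σ (upTo p) (λ i → g i *ℤ Σ L (λ x → f x ((k ℕ.+ (p ℕ.∸ i)) % p))) ≡⟨ Sums.Σ-cong (upTo p) (λ i → sym (Sums.Σ-*ˡ L (g i) (λ x → f x ((k ℕ.+ (p ℕ.∸ i)) % p)))) ⟩
    Σ (upTo p) (λ i → Σ L (λ x → g i *ℤ f x ((k ℕ.+ (p ℕ.∸ i)) % p))) ≡⟨ Sums.Σ-swap (upTo p) L _ ⟩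
    Σ L (λ x → (g ⊗ f x) k) ≡⟨ sym (Σᶜ-at L _ k) ⟩
    Σᶜ L (λ x → g ⊗ f x) k ∎
    where open ≡-Reasoning

  private module ℕIndexed = Sums.WithDecidableEquality ℕ._≟_

  [m%p+n]%p≡[m+n]%p : ∀ x y → (x % p ℕ.+ y) % p ≡ (x ℕ.+ y) % p
  [m%p+n]%p≡[m+n]%p x y = begin
    (x % p ℕ.+ y) % p ≡⟨ %-distribˡ-+ (x % p) y p ⟩
    (x % p % p ℕ.+ y % p) % p ≡⟨ cong (λ z → (z ℕ.+ y % p) % p) (m%n%n≡m%n x p) ⟩
    (x % p ℕ.+ y % p) % p ≡⟨ sym (%-distribˡ-+ x y p) ⟩
    (x ℕ.+ y) % p ∎
    where open ≡-Reasoning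

  [m+n%p]%p≡[m+n]%p : ∀ x y → (x ℕ.+ y % p) % p ≡ (x ℕ.+ y) % p
  [m+n%p]%p≡[m+n]%p x y = trans (cong (_% p) (ℕP.+-comm x (y % p))) (trans ([m%p+n]%p≡[m+n]%p y x) (cong (_% p) (ℕP.+-comm y x)))

  [k+p-a]%p≡b⇒k≡[a+b]%p : ∀ k A B → k < p → A < p → B < p → (k ℕ.+ (p ℕ.∸ A)) % p ≡ B → k ≡ (A ℕ.+ B) % p
  [k+p-a]%p≡b⇒k≡[a+b]%p k A B k<p A<p B<p e = sym (begin
    (A ℕ.+ B) % p ≡⟨ cong (λ z → (A ℕ.+ z) % p) (sym e) ⟩
    (A ℕ.+ (k ℕ.+ (p ℕ.∸ A)) % p) % p ≡⟨ [m+n%p]%p≡[m+n]%p A _ ⟩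
    (A ℕ.+ (k ℕ.+ (p ℕ.∸ A))) % p ≡⟨ cong (_% p) rearrange ⟩
    (k ℕ.+ p) % p ≡⟨ [m+n]%n≡m%n k p ⟩
    k % p ≡⟨ m<n⇒m%n≡m k<p ⟩
    k ∎)
    where
    open ≡-Reasoning
    rearrange : A ℕ.+ (k ℕ.+ (p ℕ.∸ A)) ≡ k ℕ.+ p
    rearrange = trans (sym (ℕP.+-assoc A k _)) (trans (cong (ℕ._+ (p ℕ.∸ A)) (ℕP.+-comm A k))
      (trans (ℕP.+-assoc k A _) (cong (k ℕ.+_) (ℕP.m+[n∸m]≡n (ℕP.<⇒≤ A<p)))))

  k≡[a+b]%p⇒[k+p-a]%p≡b : ∀ k A B → A < p → B < p → k ≡ (A ℕ.+ B) % p → (k ℕ.+ (p ℕ.∸ A)) % p ≡ B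
  k≡[a+b]%p⇒[k+p-a]%p≡b k A B A<p B<p refl = begin
    ((A ℕ.+ B) % p ℕ.+ (p ℕ.∸ A)) % p ≡⟨ [m%p+n]%p≡[m+n]%p (A ℕ.+ B) _ ⟩
    ((A ℕ.+ B) ℕ.+ (p ℕ.∸ A)) % p ≡⟨ cong (_% p) rearrange ⟩
    (B ℕ.+ p) % p ≡⟨ [m+n]%n≡m%n B p ⟩
    B % p ≡⟨ m<n⇒m%n≡m B<p ⟩
    B ∎
    where
    open ≡-Reasoning
    rearrange : (A ℕ.+ B) ℕ.+ (p ℕ.∸ A) ≡ B ℕ.+ p
    rearrange = trans (cong (ℕ._+ (p ℕ.∸ A)) (ℕP.+-comm A B)) (trans (ℕP.+-assoc B A _) (cong (B ℕ.+_) (ℕP.m+[n∸m]≡n (ℕP.<⇒≤ A<p))))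

  ζ^-+ : ∀ a b → ζ^ p a ⊗ ζ^ p b ≐ ζ^ p (a ℕ.+ b)
  ζ^-+ a b k k<p = begin
    (ζ^ p a ⊗ ζ^ p b) k ≡⟨ Sums.Σ-cong (upTo p) (λ i → Sums.ind1*≡ind (i ℕ.≟ a % p) _) ⟩
    Σ (upTo p) (λ i → ind (i ℕ.≟ a % p) (ζ^ p b ((k ℕ.+ (p ℕ.∸ i)) % p))) ≡⟨ ℕIndexed.Σ-delta (upTo p) (a % p) (λ i → ζ^ p b ((k ℕ.+ (p ℕ.∸ i)) % p)) (upTo⁺ p) (∈-upTo⁺ (m%n<n a p)) ⟩
    ind ((k ℕ.+ (p ℕ.∸ a % p)) % p ℕ.≟ b % p) 1ℤ ≡⟨ Sums.ind-⇔ ((k ℕ.+ (p ℕ.∸ a % p)) % p ℕ.≟ b % p) (k ℕ.≟ (a ℕ.+ b) % p)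
         (λ e → trans ([k+p-a]%p≡b⇒k≡[a+b]%p k (a % p) (b % p) k<p (m%n<n a p) (m%n<n b p) e) (sym (%-distribˡ-+ a b p)))
         (λ e → k≡[a+b]%p⇒[k+p-a]%p≡b k (a % p) (b % p) (m%n<n a p) (m%n<n b p) (trans e (%-distribˡ-+ a b p))) 1ℤ ⟩
    ζ^ p (a ℕ.+ b) k ∎
    where open ≡-Reasoning

  ζ^-% : ∀ a → ζ^ p (a % p) ≐ ζ^ p a
  ζ^-% a i _ = cong (λ z → ind (i ℕ.≟ z) 1ℤ) (m%n%n≡m%n a p)


module AdditiveCharacter (F : FiniteField) (p n s : ℕ) .{{_ : NonZero p}} (p-prime : Prime p)
                         (charF≡p : FiniteField.fromℕ F p ≡ FiniteField.0# F)
                         (q≡p^n : FiniteField.order F ≡ p Data.Nat.^ n)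
                         (0<s : 0 < s) (gcd[s,q-1]≡1 : gcd s (FiniteField.order F ∸ 1) ≡ 1) where
  open Trace F p n s p-prime charF≡p q≡p^n public
  open PowerBijection F s 0<s gcd[s,q-1]≡1 public
  open Cyclotomic p public
  open Sums using (Σ; ind)
  open import Data.Nat as ℕ using (zero; suc; _%_)
  import Data.Nat.Properties as ℕP
  open import Data.Nat.DivMod using (n%n≡0; m<n⇒m%n≡m)
  open import Data.Integer as ℤ using (ℤ; 0ℤ; 1ℤ) renaming (_+_ to _+ℤ_; _*_ to _*ℤ_)
  import Data.Integer.Properties as ℤP
  open import Data.List using (List; length)
  open import Relation.Binary.PropositionalEquality
  open import Data.Empty using (⊥-elim)
  open import Data.Sum using (inj₁; inj₂)
  open import Relation.Nullary using (yes; no)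

  E : List Carrier
  E = elements

  U : List Carrier
  U = units

  q : ℕ
  q = order

  ψ-ζ : ∀ x → ψ x ≡ ζ^ p (χ x)
  ψ-ζ x = cong (ζ^ p) (χ-prime x)

  ψ-at : ∀ x i → ψ x i ≡ ind (i ℕ.≟ χ x) 1ℤ
  ψ-at x i = trans (cong (λ f → f i) (ψ-ζ x)) (cong (λ z → ind (i ℕ.≟ z) 1ℤ) (m<n⇒m%n≡m (χ<p x)))

  ψ-+ : ∀ a b → ψ a ⊗ ψ b ≐ ψ (a + b)
  ψ-+ a b = ≐-trans (λ i i<p → cong₂ (λ f g → (f ⊗ g) i) (ψ-ζ a) (ψ-ζ b))
    (≐-trans (ζ^-+ (χ a) (χ b)) (≐-trans (≐-sym (ζ^-% (χ a ℕ.+ χ b)))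
      (λ i i<p → cong (λ z → ζ^ p z i) (trans (sym (χ-+ a b)) (sym (χ-prime (a + b)))))))

  ψ-0 : ψ 0# ≐ intᶜ p 1ℤ
  ψ-0 i i<p = trans (ψ-at 0# i) (trans (cong (λ z → ind (i ℕ.≟ z) 1ℤ) χ-0) (sym (intᶜ-at 1ℤ i)))

  Σᶜ-bijection : (σ τ : Carrier → Carrier) → (∀ y → σ (τ y) ≡ y) → (∀ x → τ (σ x) ≡ x) →
               (f : Carrier → Cyc) → Σᶜ E (λ x → f (σ x)) ≐ Σᶜ E f
  Σᶜ-bijection σ τ σ∘τ τ∘σ f i _ = trans (Σᶜ-at E _ i) (trans (ℤSum.Σ-bijection E elements-unique elements-complete σ τ σ∘τ τ∘σ (λ x → f x i)) (sym (Σᶜ-at E f i)))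

  Σᶜ-remove-0 : ∀ (f : Carrier → Cyc) → Σᶜ E f ≐ f 0# ⊕ Σᶜ U f
  Σᶜ-remove-0 f i _ = trans (Σᶜ-at E f i) (trans (ℤSum.Σ-remove E 0# elements-unique (elements-complete 0#) (λ x → f x i)) (cong (f 0# i +ℤ_) (sym (Σᶜ-at U f i))))

  Σᶜ-delta : ∀ (a : Carrier) (f : Carrier → Cyc) → Σᶜ E (λ x → indᶜ (x ≟F a) (f x)) ≐ f a
  Σᶜ-delta a f i _ = trans (Σᶜ-at E _ i) (trans (Sums.Σ-cong E (λ x → indᶜ-at (x ≟F a) (f x) i)) (ℤSum.Σ-delta E a (λ x → f x i) elements-unique (elements-complete a)))

  Σᶜ-const-intᶜ : ∀ {A : Set} (L : List A) (m : ℤ) → Σᶜ L (λ _ → intᶜ p m) ≐ intᶜ p (ℤ.+ length L *ℤ m)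
  Σᶜ-const-intᶜ L m = ≐-trans (Σᶜ-int L (λ _ → m)) (λ i _ → cong (λ z → intᶜ p z i) (Sums.Σ-const L m))

  traceFibre : ℕ → ℤ
  traceFibre i = Σ E (λ x → ind (i ℕ.≟ χ x) 1ℤ)

  suc-injective-% : ∀ j c → suc j < p → c < p → suc j ≡ suc c % p → j ≡ c
  suc-injective-% j c sj<p c<p e with ℕP.<-≤-connex (suc c) p
  ... | inj₁ sc<p = ℕP.suc-injective (trans e (m<n⇒m%n≡m sc<p))
  ... | inj₂ p≤sc with ℕP.≤-antisym c<p p≤sc
  ...   | eq = ⊥-elim (ℕP.1+n≢0 (trans e (trans (cong (_% p) eq) (n%n≡0 p))))

  traceFibre-suc : ∀ j → suc j < p → traceFibre (suc j) ≡ traceFibre j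
  traceFibre-suc j sj<p = begin
    traceFibre (suc j) ≡⟨ sym (ℤSum.Σ-bijection E elements-unique elements-complete (_+ traceOne) (_- traceOne)
                   (λ y → solve 2 (λ y c → (y :- c) :+ c := y) refl y traceOne) (λ y → solve 2 (λ y c → (y :+ c) :- c := y) refl y traceOne)
                   (λ x → ind (suc j ℕ.≟ χ x) 1ℤ)) ⟩
    Σ E (λ x → ind (suc j ℕ.≟ χ (x + traceOne)) 1ℤ) ≡⟨ Sums.Σ-cong E (λ x → Sums.ind-⇔ (suc j ℕ.≟ χ (x + traceOne)) (j ℕ.≟ χ x)
          (λ e → suc-injective-% j (χ x) sj<p (χ<p x) (trans e (χ-shift x)))
          (λ e → trans (cong suc e) (trans (sym (m<n⇒m%n≡m (subst (λ z → suc z < p) e sj<p))) (sym (χ-shift x)))) 1ℤ) ⟩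
    traceFibre j ∎
    where open ≡-Reasoning

  traceFibre-const : ∀ i → i < p → traceFibre i ≡ traceFibre 0
  traceFibre-const zero _ = refl
  traceFibre-const (suc i) si<p = trans (traceFibre-suc i si<p) (traceFibre-const i (ℕP.<-trans (ℕP.n<1+n i) si<p))

  -- Translation by an element of trace one permutes the trace fibres cyclically, so all coefficients
  -- of Σ ψ agree: it is a multiple of 1 + ζ + … + ζ^(p-1) = 0.
  Σψ≈0 : Σᶜ E ψ ≈ zeroᶜ
  Σψ≈0 = mk≈ (traceFibre 0) λ i i<p → begin
    Σᶜ E ψ i ≡⟨ Σᶜ-at E ψ i ⟩
    Σ E (λ x → ψ x i) ≡⟨ Sums.Σ-cong E (λ x → ψ-at x i) ⟩
    traceFibre i ≡⟨ traceFibre-const i i<p ⟩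
    traceFibre 0 ≡⟨ sym (ℤP.+-identityˡ _) ⟩
    0ℤ +ℤ traceFibre 0 ≡⟨ cong (_+ℤ traceFibre 0) (sym (zeroᶜ-at i)) ⟩
    zeroᶜ i +ℤ traceFibre 0 ∎
    where open ≡-Reasoning

  Σψ-affine : ∀ A B → Σᶜ E (λ u → ψ (A + u * B)) ≈ indᶜ (B ≟F 0#) (Σᶜ E (λ _ → ψ A))
  Σψ-affine A B with B ≟F 0#
  ... | yes refl = ≐⇒≈ (Σᶜ-cong≐ E (λ u i _ → cong (λ z → ψ z i) (trans (cong (A +_) (zeroʳ u)) (+-identityʳ A))))
  ... | no nz = ≐-≈-trans (Σᶜ-bijection (λ u → A + u * B) (λ v → (v - A) * inv B)
        (λ v → begin
          A + ((v - A) * inv B) * B ≡⟨ cong (A +_) (*-assoc _ _ _) ⟩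
          A + (v - A) * (inv B * B) ≡⟨ cong (λ z → A + (v - A) * z) (inv-l B nz) ⟩
          A + (v - A) * 1# ≡⟨ solve 2 (λ A v → A :+ (v :- A) :* con (ℤ.+ 1) := v) refl A v ⟩
          v ∎)
        (λ u → begin
          ((A + u * B) - A) * inv B ≡⟨ cong (_* inv B) (solve 3 (λ A u B → (A :+ u :* B) :- A := u :* B) refl A u B) ⟩
          (u * B) * inv B ≡⟨ *-assoc _ _ _ ⟩
          u * (B * inv B) ≡⟨ cong (u *_) (inv-r B nz) ⟩
          u * 1# ≡⟨ *-identityʳ u ⟩
          u ∎)
        ψ) Σψ≈0
    where open ≡-Reasoning

  Σψ-power : ∀ A c → Σᶜ E (λ y → ψ (A + c * y ^ s)) ≈ indᶜ (c ≟F 0#) (Σᶜ E (λ _ → ψ A))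
  Σψ-power A c = ≐-≈-trans (≐-trans (Σᶜ-bijection pow-s root-s pow-root root-pow (λ y → ψ (A + c * y)))
    (Σᶜ-cong≐ E (λ y i _ → cong (λ z → ψ (A + z) i) (*-comm c y)))) (Σψ-affine A c)


module WeilSums (F : FiniteField) (p n s : ℕ) .{{_ : NonZero p}} (p-prime : Prime p)
                (charF≡p : FiniteField.fromℕ F p ≡ FiniteField.0# F)
                (q≡p^n : FiniteField.order F ≡ p Data.Nat.^ n)
                (0<s : 0 < s) (gcd[s,q-1]≡1 : gcd s (FiniteField.order F ∸ 1) ≡ 1) where
  open AdditiveCharacter F p n s p-prime charF≡p q≡p^n 0<s gcd[s,q-1]≡1 public
  open Sums using (ind)
  import Data.Nat as ℕ
  open import Data.Integer as ℤ using (ℤ; 0ℤ; 1ℤ) renaming (_*_ to _*ℤ_)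
  import Data.Integer.Properties as ℤP
  open import Data.List using (List; cartesianProduct)
  open import Relation.Nullary using (Dec)
  open import Relation.Binary.PropositionalEquality
  open import Data.Product using (_×_; _,_; proj₁; proj₂)

  ΣE-1≐q : Σᶜ E (λ _ → intᶜ p 1ℤ) ≐ intᶜ p (ℤ.+ q)
  ΣE-1≐q = ≐-trans (Σᶜ-const-intᶜ E 1ℤ) (≡⇒≐ (cong (intᶜ p) (ℤP.*-identityʳ _)))

  ΣE-ψ0≐q : Σᶜ E (λ _ → ψ 0#) ≐ intᶜ p (ℤ.+ q)
  ΣE-ψ0≐q = ≐-trans (Σᶜ-cong≐ E (λ _ → ψ-0)) ΣE-1≐q

  Σunits-phase : ∀ {T : Set} (L : List T) (A B : T → Carrier) → Σᶜ L (λ t → ψ (A t)) ≈ zeroᶜ →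
          Σᶜ U (λ u → Σᶜ L (λ t → ψ (A t + u * B t))) ≈ Σᶜ L (λ t → indᶜ (B t ≟F 0#) (Σᶜ E (λ _ → ψ (A t))))
  Σunits-phase L A B ΣψA≈0 = ⊕-≈0-cancelˡ (Σᶜ-remove-0 G)
     (≐-≈-trans (Σᶜ-cong≐ L (λ t → ≡⇒≐ (cong ψ (trans (cong (A t +_) (zeroˡ (B t))) (+-identityʳ (A t)))))) ΣψA≈0)
     (≐-≈-trans (Σᶜ-swap E L (λ u t → ψ (A t + u * B t))) (Σᶜ-cong≈ L (λ t → Σψ-affine (A t) (B t))))
    where
    G : Carrier → Cyc
    G u = Σᶜ L (λ t → ψ (A t + u * B t))

  Σψ[C+z^s]≈0 : ∀ C → Σᶜ E (λ z → ψ (C + z ^ s)) ≈ zeroᶜ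
  Σψ[C+z^s]≈0 C = ≐-≈-trans (Σᶜ-cong≐ E (λ z → ≡⇒≐ (cong (λ a → ψ (C + a)) (sym (*-identityˡ (z ^ s))))))
         (≈-≐-trans (Σψ-power C 1#) (≡⇒≐ (indᶜ-no (1# ≟F 0#) _ 1≢0)))

  phase : Carrier → Carrier → Carrier
  phase u x = x ^ s - u * x

  ψ⊗W : ∀ g c → ψ g ⊗ W c ≐ Σᶜ E (λ z → ψ (g + phase c z))
  ψ⊗W g c = ≐-trans (⊗-Σᶜʳ E (λ z → ψ (phase c z)) (ψ g)) (Σᶜ-cong≐ E (λ z → ψ-+ g (phase c z)))

  W⊗W : ∀ a b → W a ⊗ W b ≐ Σᶜ E (λ x → Σᶜ E (λ y → ψ (phase a x + phase b y)))
  W⊗W a b = ≐-trans (Σᶜ-⊗ˡ E (λ x → ψ (phase a x)) (W b)) (Σᶜ-cong≐ E (λ x → ψ⊗W (phase a x) b))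

  W⊗W⊗W : ∀ a b c → (W a ⊗ W b) ⊗ W c ≐ Σᶜ E (λ x → Σᶜ E (λ y → Σᶜ E (λ z → ψ ((phase a x + phase b y) + phase c z))))
  W⊗W⊗W a b c = ≐-trans (⊗-cong≐ (W⊗W a b) (≐-refl {W c}))
    (≐-trans (Σᶜ-⊗ˡ E _ (W c)) (Σᶜ-cong≐ E (λ x → ≐-trans (Σᶜ-⊗ˡ E _ (W c)) (Σᶜ-cong≐ E (λ y → ψ⊗W (phase a x + phase b y) c)))))

  W⊗W⊗W⊗W : ∀ a b c d → (W a ⊗ W b) ⊗ (W c ⊗ W d) ≐
         Σᶜ E (λ x → Σᶜ E (λ y → Σᶜ E (λ z → Σᶜ E (λ w → ψ ((phase a x + phase b y) + (phase c z + phase d w))))))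
  W⊗W⊗W⊗W a b c d = ≐-trans (⊗-cong≐ (W⊗W a b) (W⊗W c d))
    (≐-trans (Σᶜ-⊗ˡ E (λ x → Σᶜ E (λ y → ψ (phase a x + phase b y))) W⊗W[c,d])
    (Σᶜ-cong≐ E (λ x → ≐-trans (Σᶜ-⊗ˡ E (λ y → ψ (phase a x + phase b y)) W⊗W[c,d])
    (Σᶜ-cong≐ E (λ y → ≐-trans (⊗-Σᶜʳ E (λ z → Σᶜ E (λ w → ψ (phase c z + phase d w))) (ψ (phase a x + phase b y)))
    (Σᶜ-cong≐ E (λ z → ≐-trans (⊗-Σᶜʳ E (λ w → ψ (phase c z + phase d w)) (ψ (phase a x + phase b y)))
    (Σᶜ-cong≐ E (λ w → ψ-+ (phase a x + phase b y) (phase c z + phase d w))))))))))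
    where
    W⊗W[c,d] : Cyc
    W⊗W[c,d] = Σᶜ E (λ z → Σᶜ E (λ w → ψ (phase c z + phase d w)))

  W0≈0 : W 0# ≈ zeroᶜ
  W0≈0 = ≐-≈-trans (Σᶜ-cong≐ E (λ x → ≡⇒≐ (cong ψ (solve 2 (λ x X → X :- con (ℤ.+ 0) :* x := con (ℤ.+ 0) :+ X) refl x (x ^ s)))))
         (Σψ[C+z^s]≈0 0#)

  ΣE-W≈q : Σᶜ E W ≈ intᶜ p (ℤ.+ q)
  ΣE-W≈q = ≐-≈-trans (Σᶜ-swap E E (λ u x → ψ (x ^ s - u * x)))
        (≐-≈-trans (Σᶜ-cong≐ E (λ x → Σᶜ-cong≐ E (λ u → ≡⇒≐ (cong ψ (solve 3 (λ X u x → X :- u :* x := X :+ u :* (:- x)) refl (x ^ s) u x)))))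
        (≈-≐-trans (Σᶜ-cong≈ E (λ x → Σψ-affine (x ^ s) (- x)))
        (≐-trans (Σᶜ-cong≐ E (λ x → ≡⇒≐ (indᶜ-⇔ ((- x) ≟F 0#) (x ≟F 0#)
             (λ e → trans (solve 1 (λ x → x := :- (:- x)) refl x) (trans (cong -_ e) -0#≈0#))
             (λ e → trans (cong -_ e) -0#≈0#) _)))
        (≐-trans (Σᶜ-delta 0# (λ x → Σᶜ E (λ _ → ψ (x ^ s))))
        (≐-trans (Σᶜ-cong≐ E (λ _ → ≡⇒≐ (cong ψ 0^s≡0))) ΣE-ψ0≐q)))))

  Σunits-W≈q : Σᶜ U W ≈ intᶜ p (ℤ.+ q)
  Σunits-W≈q = ≈-≐-trans (⊕-≈-cancelˡ 0ℤ (ℤ.+ q) (Σᶜ-remove-0 W) W0≈0 ΣE-W≈q) (≡⇒≐ (cong (intᶜ p) (ℤP.+-identityʳ _)))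

  module LineThrough0 (t₁ t₂ : Carrier) (t₁≢0 : t₁ ≢ 0#) (t₂≢0 : t₂ ≢ 0#) where
    r : Carrier
    r = t₁ * inv t₂

    y₀ : Carrier → Carrier
    y₀ x = - (r * x)

    t₁x+t₂y≡0⇒y≡y₀ : ∀ x y → t₁ * x + t₂ * y ≡ 0# → y ≡ y₀ x
    t₁x+t₂y≡0⇒y≡y₀ x y h = begin
      y ≡⟨ sym (*-identityʳ y) ⟩
      y * 1# ≡⟨ cong (y *_) (sym (inv-r t₂ t₂≢0)) ⟩
      y * (t₂ * inv t₂) ≡⟨ solve 5 (λ y t₁ t₂ i x → y :* (t₂ :* i) := (t₁ :* x :+ t₂ :* y) :* i :+ :- (t₁ :* i :* x)) refl y t₁ t₂ (inv t₂) x ⟩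
      (t₁ * x + t₂ * y) * inv t₂ + - (r * x) ≡⟨ cong (λ z → z * inv t₂ + - (r * x)) h ⟩
      0# * inv t₂ + - (r * x) ≡⟨ solve 2 (λ i a → con (ℤ.+ 0) :* i :+ a := a) refl (inv t₂) (- (r * x)) ⟩
      y₀ x ∎
      where open ≡-Reasoning

    y≡y₀⇒t₁x+t₂y≡0 : ∀ x y → y ≡ y₀ x → t₁ * x + t₂ * y ≡ 0#
    y≡y₀⇒t₁x+t₂y≡0 x y refl = begin
      t₁ * x + t₂ * (- (t₁ * inv t₂ * x)) ≡⟨ solve 4 (λ t₁ t₂ i x → t₁ :* x :+ t₂ :* (:- (t₁ :* i :* x)) := t₁ :* x :+ :- (t₁ :* x :* (t₂ :* i))) refl t₁ t₂ (inv t₂) x ⟩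
      t₁ * x + - (t₁ * x * (t₂ * inv t₂)) ≡⟨ cong (λ z → t₁ * x + - (t₁ * x * z)) (inv-r t₂ t₂≢0) ⟩
      t₁ * x + - (t₁ * x * 1#) ≡⟨ solve 1 (λ a → a :+ :- (a :* con (ℤ.+ 1)) := con (ℤ.+ 0)) refl (t₁ * x) ⟩
      0# ∎
      where open ≡-Reasoning

    c : Carrier
    c = 1# - r ^ s

    x^s+y₀^s≡c*x^s : ∀ x → x ^ s + y₀ x ^ s ≡ 0# + c * x ^ s
    x^s+y₀^s≡c*x^s x = begin
      x ^ s + (- (r * x)) ^ s ≡⟨ cong (x ^ s +_) (trans (-‿^s (r * x)) (cong -_ (^-distribʳ-* r x s))) ⟩
      x ^ s + - (r ^ s * x ^ s) ≡⟨ solve 2 (λ X R → X :+ :- (R :* X) := con (ℤ.+ 0) :+ (con (ℤ.+ 1) :- R) :* X) refl (x ^ s) (r ^ s) ⟩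
      0# + c * x ^ s ∎
      where open ≡-Reasoning

    r≡1⇒t₁≡t₂ : r ≡ 1# → t₁ ≡ t₂
    r≡1⇒t₁≡t₂ h = begin
      t₁ ≡⟨ sym (*-identityʳ t₁) ⟩
      t₁ * 1# ≡⟨ cong (t₁ *_) (sym (inv-l t₂ t₂≢0)) ⟩
      t₁ * (inv t₂ * t₂) ≡⟨ sym (*-assoc _ _ _) ⟩
      r * t₂ ≡⟨ cong (_* t₂) h ⟩
      1# * t₂ ≡⟨ *-identityˡ t₂ ⟩
      t₂ ∎
      where open ≡-Reasoning

    c≡0⇒t₁≡t₂ : c ≡ 0# → t₁ ≡ t₂
    c≡0⇒t₁≡t₂ h = r≡1⇒t₁≡t₂ (^s-injective r 1# (trans (sym (x-y≡0⇒x≡y 1# (r ^ s) h)) (sym (1^n≡1 s))))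

    t₁≡t₂⇒c≡0 : t₁ ≡ t₂ → c ≡ 0#
    t₁≡t₂⇒c≡0 refl = begin
      1# - (t₁ * inv t₁) ^ s ≡⟨ cong (λ z → 1# - z ^ s) (inv-r t₁ t₁≢0) ⟩
      1# - 1# ^ s ≡⟨ cong (λ z → 1# - z) (1^n≡1 s) ⟩
      1# - 1# ≡⟨ -‿inverseʳ 1# ⟩
      0# ∎
      where open ≡-Reasoning

    Σ-line-ψ[x^s+y^s]≈ : ∀ {D : Carrier → Carrier → Set} (d : ∀ x y → Dec (D x y)) → (∀ x y → D x y → y ≡ y₀ x) → (∀ x y → y ≡ y₀ x → D x y) →
         Σᶜ E (λ x → Σᶜ E (λ y → indᶜ (d x y) (ψ (x ^ s + y ^ s)))) ≈ intᶜ p (ind (t₁ ≟F t₂) (ℤ.+ q))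
    Σ-line-ψ[x^s+y^s]≈ d f g = ≐-≈-trans (Σᶜ-cong≐ E (λ x → ≐-trans (Σᶜ-cong≐ E (λ y → ≡⇒≐ (indᶜ-⇔ (d x y) (y ≟F y₀ x) (f x y) (g x y) _)))
                 (≐-trans (Σᶜ-delta (y₀ x) (λ y → ψ (x ^ s + y ^ s))) (≡⇒≐ (cong ψ (x^s+y₀^s≡c*x^s x))))))
              (≈-≐-trans (Σψ-power 0# c)
              (≐-trans (indᶜ-cong≐ (c ≟F 0#) ΣE-ψ0≐q) (≐-trans (indᶜ-int (c ≟F 0#) (ℤ.+ q))
                (≡⇒≐ (cong (intᶜ p) (Sums.ind-⇔ (c ≟F 0#) (t₁ ≟F t₂) c≡0⇒t₁≡t₂ t₁≡t₂⇒c≡0 _))))))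

  E² : List (Carrier × Carrier)
  E² = cartesianProduct E E

  module SecondMoment (t₁ t₂ : Carrier) (t₁≢0 : t₁ ≢ 0#) (t₂≢0 : t₂ ≢ 0#) where
    open LineThrough0 t₁ t₂ t₁≢0 t₂≢0

    powerSum₂ : Carrier × Carrier → Carrier
    powerSum₂ t = proj₁ t ^ s + proj₂ t ^ s
    linearForm₂ : Carrier × Carrier → Carrier
    linearForm₂ t = - (t₁ * proj₁ t + t₂ * proj₂ t)

    expand : Σᶜ U (λ u → W (t₁ * u) ⊗ W (t₂ * u)) ≐ Σᶜ U (λ u → Σᶜ E² (λ t → ψ (powerSum₂ t + u * linearForm₂ t)))
    expand = Σᶜ-cong≐ U (λ u → ≐-trans (W⊗W (t₁ * u) (t₂ * u))
      (≐-trans (Σᶜ-cong≐ E (λ x → Σᶜ-cong≐ E (λ y → ≡⇒≐ (cong ψ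
        (solve 7 (λ X Y t₁ t₂ u x y → (X :- t₁ :* u :* x) :+ (Y :- t₂ :* u :* y) := (X :+ Y) :+ u :* (:- (t₁ :* x :+ t₂ :* y))) refl (x ^ s) (y ^ s) t₁ t₂ u x y)))))
      (≐-sym (Σᶜ-cartesianProduct E E (λ t → ψ (powerSum₂ t + u * linearForm₂ t))))))

    Σψ[powerSum₂]≈0 : Σᶜ E² (λ t → ψ (powerSum₂ t)) ≈ zeroᶜ
    Σψ[powerSum₂]≈0 = ≐-≈-trans (Σᶜ-cartesianProduct E E (λ t → ψ (powerSum₂ t))) (Σᶜ-≈zero E (λ x → Σψ[C+z^s]≈0 (x ^ s)))

    count : Σᶜ E² (λ t → indᶜ (linearForm₂ t ≟F 0#) (Σᶜ E (λ _ → ψ (powerSum₂ t)))) ≈ intᶜ p (ℤ.+ q *ℤ ind (t₁ ≟F t₂) (ℤ.+ q))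
    count = ≐-≈-trans (Σᶜ-cartesianProduct E E _)
      (≐-≈-trans (Σᶜ-cong≐ E (λ x → Σᶜ-cong≐ E (λ y → ≐-sym (Σᶜ-indᶜ E (linearForm₂ (x , y) ≟F 0#) (λ _ → ψ (powerSum₂ (x , y)))))))
      (≐-≈-trans (Σᶜ-cong≐ E (λ x → Σᶜ-swap E E (λ y u → indᶜ (linearForm₂ (x , y) ≟F 0#) (ψ (powerSum₂ (x , y))))))
      (≐-≈-trans (Σᶜ-swap E E (λ x u → Σᶜ E (λ y → indᶜ (linearForm₂ (x , y) ≟F 0#) (ψ (powerSum₂ (x , y))))))
      (≈-≐-trans (Σᶜ-cong≈ E (λ u → Σ-line-ψ[x^s+y^s]≈ (λ x y → linearForm₂ (x , y) ≟F 0#)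
                   (λ x y h → t₁x+t₂y≡0⇒y≡y₀ x y (-x≡0⇒x≡0 _ h)) (λ x y h → x≡0⇒-x≡0 _ (y≡y₀⇒t₁x+t₂y≡0 x y h))))
        (Σᶜ-const-intᶜ E (ind (t₁ ≟F t₂) (ℤ.+ q)))))))

    Σunits-W⊗W≈ : Σᶜ U (λ u → W (t₁ * u) ⊗ W (t₂ * u)) ≈ intᶜ p (ℤ.+ q *ℤ ind (t₁ ≟F t₂) (ℤ.+ q))
    Σunits-W⊗W≈ = ≐-≈-trans expand (≈-trans (Σunits-phase E² powerSum₂ linearForm₂ Σψ[powerSum₂]≈0) count)

    Σunits-W⊗W≈q² : t₁ ≡ t₂ → Σᶜ U (λ u → W (t₁ * u) ⊗ W (t₂ * u)) ≈ intᶜ p (ℤ.+ (q ℕ.* q))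
    Σunits-W⊗W≈q² e = ≈-≐-trans Σunits-W⊗W≈ (≡⇒≐ (cong (intᶜ p) (trans (cong (ℤ.+ q *ℤ_) (Sums.ind-yes (t₁ ≟F t₂) e _)) (sym (ℤP.pos-* q q)))))

    Σunits-W⊗W≈0 : t₁ ≢ t₂ → Σᶜ U (λ u → W (t₁ * u) ⊗ W (t₂ * u)) ≈ intᶜ p 0ℤ
    Σunits-W⊗W≈0 ne = ≈-≐-trans Σunits-W⊗W≈ (≡⇒≐ (cong (intᶜ p) (trans (cong (ℤ.+ q *ℤ_) (Sums.ind-no (t₁ ≟F t₂) ne _)) (ℤP.*-zeroʳ (ℤ.+ q)))))


module WeilSums₃ (F : FiniteField) (p n s : ℕ) .{{_ : NonZero p}} (p-prime : Prime p)
                 (charF≡p : FiniteField.fromℕ F p ≡ FiniteField.0# F)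
                 (q≡p^n : FiniteField.order F ≡ p Data.Nat.^ n)
                 (0<s : 0 < s) (gcd[s,q-1]≡1 : gcd s (FiniteField.order F ∸ 1) ≡ 1) where
  open WeilSums F p n s p-prime charF≡p q≡p^n 0<s gcd[s,q-1]≡1 public
  open Sums using (Σ; ind)
  import Data.Nat as ℕ
  open import Data.Integer as ℤ using (ℤ; 0ℤ; 1ℤ) renaming (_+_ to _+ℤ_; _-_ to _-ℤ_; _*_ to _*ℤ_; -_ to -ℤ_)
  import Data.Integer.Properties as ℤP
  open import Data.Integer.Tactic.RingSolver using (solve-∀)
  open import Data.List using (List; cartesianProduct)
  open import Relation.Nullary using (Dec; yes; no; ¬?)
  open import Relation.Nullary.Decidable using (_×-dec_)
  open import Relation.Binary.PropositionalEquality
  open import Data.Product using (_×_; _,_; proj₁; proj₂)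

  ΣΣ-neg : ∀ (f : Carrier → Carrier → ℤ) → Σ E (λ x → Σ E (λ y → -ℤ f x y)) ≡ -ℤ Σ E (λ x → Σ E (λ y → f x y))
  ΣΣ-neg f = trans (Sums.Σ-cong E (λ x → Sums.Σ-neg E (f x))) (Sums.Σ-neg E _)

  ΣΣ-* : ∀ c (f : Carrier → Carrier → ℤ) → Σ E (λ x → Σ E (λ y → c *ℤ f x y)) ≡ c *ℤ Σ E (λ x → Σ E (λ y → f x y))
  ΣΣ-* c f = trans (Sums.Σ-cong E (λ x → Sums.Σ-*ˡ E c (f x))) (Sums.Σ-*ˡ E c _)

  ΣΣ-+ : ∀ (f g : Carrier → Carrier → ℤ) → Σ E (λ x → Σ E (λ y → f x y +ℤ g x y)) ≡ Σ E (λ x → Σ E (λ y → f x y)) +ℤ Σ E (λ x → Σ E (λ y → g x y))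
  ΣΣ-+ f g = trans (Sums.Σ-cong E (λ x → Sums.Σ-∙ E (f x) (g x))) (Sums.Σ-∙ E _ _)

  ΣE-1≡q : Σ E (λ _ → 1ℤ) ≡ ℤ.+ q
  ΣE-1≡q = trans (Sums.Σ-const E 1ℤ) (ℤP.*-identityʳ _)

  Q-as-Σ : ∀ t₁ t₂ a b → ℤ.+ Q t₁ t₂ a b ≡ Σ E (λ v1 → Σ E (λ v2 → ind (((t₁ * v1 + t₂ * v2) ≟F a) ×-dec ((v1 ^ s + v2 ^ s) ≟F (b ^ s))) 1ℤ))
  Q-as-Σ t₁ t₂ a b = trans (Sums.length-filter _ (cartesianProduct E E)) (Sums.Σ-cartesianProduct E E _)

  module LineThrough1 (t₁ t₂ : Carrier) (t₁≢0 : t₁ ≢ 0#) (t₂≢0 : t₂ ≢ 0#) where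
    y₁ : Carrier → Carrier
    y₁ x = (1# - t₁ * x) * inv t₂

    t₁x+t₂y≡1⇒y≡y₁ : ∀ x y → 1# ≡ t₁ * x + t₂ * y → y ≡ y₁ x
    t₁x+t₂y≡1⇒y≡y₁ x y h = begin
      y ≡⟨ sym (*-identityʳ y) ⟩
      y * 1# ≡⟨ cong (y *_) (sym (inv-r t₂ t₂≢0)) ⟩
      y * (t₂ * inv t₂) ≡⟨ solve 5 (λ y t₁ t₂ i x → y :* (t₂ :* i) := ((t₁ :* x :+ t₂ :* y) :- t₁ :* x) :* i) refl y t₁ t₂ (inv t₂) x ⟩
      ((t₁ * x + t₂ * y) - t₁ * x) * inv t₂ ≡⟨ cong (λ z → (z - t₁ * x) * inv t₂) (sym h) ⟩
      y₁ x ∎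
      where open ≡-Reasoning

    y≡y₁⇒t₁x+t₂y≡1 : ∀ x y → y ≡ y₁ x → 1# ≡ t₁ * x + t₂ * y
    y≡y₁⇒t₁x+t₂y≡1 x y refl = sym (begin
      t₁ * x + t₂ * ((1# - t₁ * x) * inv t₂) ≡⟨ solve 4 (λ t₁ t₂ i x → t₁ :* x :+ t₂ :* ((con (ℤ.+ 1) :- t₁ :* x) :* i) := t₁ :* x :+ (con (ℤ.+ 1) :- t₁ :* x) :* (t₂ :* i)) refl t₁ t₂ (inv t₂) x ⟩
      t₁ * x + (1# - t₁ * x) * (t₂ * inv t₂) ≡⟨ cong (λ z → t₁ * x + (1# - t₁ * x) * z) (inv-r t₂ t₂≢0) ⟩
      t₁ * x + (1# - t₁ * x) * 1# ≡⟨ solve 1 (λ a → a :+ (con (ℤ.+ 1) :- a) :* con (ℤ.+ 1) := con (ℤ.+ 1)) refl (t₁ * x) ⟩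
      1# ∎)
      where open ≡-Reasoning

    |t₁x+t₂y≡1|≡q : Σ E (λ x → Σ E (λ y → ind (1# ≟F (t₁ * x + t₂ * y)) 1ℤ)) ≡ ℤ.+ q
    |t₁x+t₂y≡1|≡q = trans (Sums.Σ-cong E (λ x → trans (Sums.Σ-cong E (λ y →
        Sums.ind-⇔ (1# ≟F (t₁ * x + t₂ * y)) (y ≟F y₁ x) (t₁x+t₂y≡1⇒y≡y₁ x y) (y≡y₁⇒t₁x+t₂y≡1 x y) 1ℤ))
        (ℤSum.Σ-delta E (y₁ x) (λ _ → 1ℤ) elements-unique (elements-complete _)))) ΣE-1≡q

    Q[1,0]≡[t₁≢t₂] : ℤ.+ Q t₁ t₂ 1# 0# ≡ ind (¬? (t₁ ≟F t₂)) 1ℤ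
    Q[1,0]≡[t₁≢t₂] = trans (Q-as-Σ t₁ t₂ 1# 0#) (trans (Sums.Σ-cong E (λ v1 → trans (Sums.Σ-cong E (λ v2 →
           trans (Sums.ind-⇔ (((t₁ * v1 + t₂ * v2) ≟F 1#) ×-dec ((v1 ^ s + v2 ^ s) ≟F (0# ^ s)))
                           ((v2 ≟F (- v1)) ×-dec (((t₁ - t₂) * v1) ≟F 1#)) (to v1 v2) (from v1 v2) 1ℤ)
                 (sym (Sums.ind-× (v2 ≟F (- v1)) (((t₁ - t₂) * v1) ≟F 1#) 1ℤ))))
          (ℤSum.Σ-delta E (- v1) (λ _ → ind (((t₁ - t₂) * v1) ≟F 1#) 1ℤ) elements-unique (elements-complete _)))) Σ[[t₁-t₂]v≡1])
      where
      open ≡-Reasoning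
      t₁v+t₂[-v]≡[t₁-t₂]v : ∀ v1 → t₁ * v1 + t₂ * (- v1) ≡ (t₁ - t₂) * v1
      t₁v+t₂[-v]≡[t₁-t₂]v v1 = solve 3 (λ t₁ t₂ v → t₁ :* v :+ t₂ :* (:- v) := (t₁ :- t₂) :* v) refl t₁ t₂ v1
      to : ∀ v1 v2 → (t₁ * v1 + t₂ * v2 ≡ 1#) × (v1 ^ s + v2 ^ s ≡ 0# ^ s) → (v2 ≡ - v1) × ((t₁ - t₂) * v1 ≡ 1#)
      to v1 v2 (h1 , h2) = v₂≡-v₁ , trans (sym (t₁v+t₂[-v]≡[t₁-t₂]v v1)) (trans (cong (λ z → t₁ * v1 + t₂ * z) (sym v₂≡-v₁)) h1)
        where
        v₂≡-v₁ : v2 ≡ - v1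
        v₂≡-v₁ = ^s-injective v2 (- v1) (begin
          v2 ^ s ≡⟨ solve 2 (λ a b → b := :- a :+ (a :+ b)) refl (v1 ^ s) (v2 ^ s) ⟩
          - (v1 ^ s) + (v1 ^ s + v2 ^ s) ≡⟨ cong (- (v1 ^ s) +_) (trans h2 0^s≡0) ⟩
          - (v1 ^ s) + 0# ≡⟨ +-identityʳ _ ⟩
          - (v1 ^ s) ≡⟨ sym (-‿^s v1) ⟩
          (- v1) ^ s ∎)
      from : ∀ v1 v2 → (v2 ≡ - v1) × ((t₁ - t₂) * v1 ≡ 1#) → (t₁ * v1 + t₂ * v2 ≡ 1#) × (v1 ^ s + v2 ^ s ≡ 0# ^ s)
      from v1 v2 (refl , h) = trans (t₁v+t₂[-v]≡[t₁-t₂]v v1) h ,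
        trans (cong (v1 ^ s +_) (-‿^s v1)) (trans (-‿inverseʳ _) (sym 0^s≡0))
      Σ[[t₁-t₂]v≡1] : Σ E (λ v1 → ind (((t₁ - t₂) * v1) ≟F 1#) 1ℤ) ≡ ind (¬? (t₁ ≟F t₂)) 1ℤ
      Σ[[t₁-t₂]v≡1] with t₁ ≟F t₂
      ... | yes e = trans (Sums.Σ-cong E (λ v1 → Sums.ind-no (((t₁ - t₂) * v1) ≟F 1#)
                      (λ h → 0≢1 (trans (sym (trans (cong (λ z → (t₁ - z) * v1) (sym e)) (trans (cong (_* v1) (-‿inverseʳ t₁)) (zeroˡ v1)))) h)) 1ℤ))
                    (Sums.Σ-ε E)
      ... | no ne = trans (Sums.Σ-cong E (λ v1 → Sums.ind-⇔ (((t₁ - t₂) * v1) ≟F 1#) (v1 ≟F inv (t₁ - t₂))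
                      (λ h → *-cancelˡ (t₁ - t₂) v1 (inv (t₁ - t₂)) d≢0 (trans h (sym (inv-r _ d≢0))))
                      (λ h → trans (cong ((t₁ - t₂) *_) h) (inv-r _ d≢0)) 1ℤ))
                    (ℤSum.Σ-delta E (inv (t₁ - t₂)) (λ _ → 1ℤ) elements-unique (elements-complete _))
        where
        d≢0 : t₁ - t₂ ≢ 0#
        d≢0 h = ne (x-y≡0⇒x≡y t₁ t₂ h)

  Σunits-ψ[w^s*d]≈ : ∀ d → Σᶜ U (λ w → ψ (w ^ s * d)) ≈ intᶜ p (ind (d ≟F 0#) (ℤ.+ q) -ℤ 1ℤ)
  Σunits-ψ[w^s*d]≈ d = ⊕-≈-cancelˡ 1ℤ (ind (d ≟F 0#) (ℤ.+ q)) (Σᶜ-remove-0 (λ w → ψ (w ^ s * d)))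
    (≐⇒≈ (≐-trans (≡⇒≐ (cong ψ (trans (cong (_* d) 0^s≡0) (zeroˡ d)))) ψ-0))
    (≐-≈-trans (Σᶜ-cong≐ E (λ w → ≡⇒≐ (cong ψ (solve 2 (λ W d → W :* d := con (ℤ.+ 0) :+ d :* W) refl (w ^ s) d))))
      (≈-≐-trans (Σψ-power 0# d) (≐-trans (indᶜ-cong≐ (d ≟F 0#) ΣE-ψ0≐q) (indᶜ-int (d ≟F 0#) (ℤ.+ q)))))

  E³ : List (Carrier × (Carrier × Carrier))
  E³ = cartesianProduct E E²

  Σᶜ-E³ : ∀ (f : Carrier × (Carrier × Carrier) → Cyc) → Σᶜ E³ f ≐ Σᶜ E (λ x → Σᶜ E (λ y → Σᶜ E (λ z → f (x , (y , z)))))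
  Σᶜ-E³ f = ≐-trans (Σᶜ-cartesianProduct E E² f) (Σᶜ-cong≐ E (λ x → Σᶜ-cartesianProduct E E (λ b → f (x , b))))

  module ThirdMoment (t₁ t₂ t₃ : Carrier) (t₁≢0 : t₁ ≢ 0#) (t₂≢0 : t₂ ≢ 0#) (t₃≢0 : t₃ ≢ 0#) where
    open LineThrough0 t₁ t₂ t₁≢0 t₂≢0
    open LineThrough1 t₁ t₂ t₁≢0 t₂≢0

    τ : Carrier
    τ = inv t₃

    powerSum₃ : Carrier × (Carrier × Carrier) → Carrier
    powerSum₃ t = (proj₁ t ^ s + proj₁ (proj₂ t) ^ s) + proj₂ (proj₂ t) ^ s
    linearForm₃ : Carrier × (Carrier × Carrier) → Carrier
    linearForm₃ t = - ((t₁ * proj₁ t + t₂ * proj₁ (proj₂ t)) + t₃ * proj₂ (proj₂ t))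

    expand : Σᶜ U (λ u → (W (t₁ * u) ⊗ W (t₂ * u)) ⊗ W (t₃ * u)) ≐ Σᶜ U (λ u → Σᶜ E³ (λ t → ψ (powerSum₃ t + u * linearForm₃ t)))
    expand = Σᶜ-cong≐ U (λ u → ≐-trans (W⊗W⊗W (t₁ * u) (t₂ * u) (t₃ * u))
      (≐-trans (Σᶜ-cong≐ E (λ x → Σᶜ-cong≐ E (λ y → Σᶜ-cong≐ E (λ z → ≡⇒≐ (cong ψ
        (solve 10 (λ X Y Z t₁ t₂ t₃ u x y z → ((X :- t₁ :* u :* x) :+ (Y :- t₂ :* u :* y)) :+ (Z :- t₃ :* u :* z)
             := ((X :+ Y) :+ Z) :+ u :* (:- ((t₁ :* x :+ t₂ :* y) :+ t₃ :* z))) refl (x ^ s) (y ^ s) (z ^ s) t₁ t₂ t₃ u x y z))))))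
      (≐-sym (Σᶜ-E³ (λ t → ψ (powerSum₃ t + u * linearForm₃ t))))))

    Σψ[powerSum₃]≈0 : Σᶜ E³ (λ t → ψ (powerSum₃ t)) ≈ zeroᶜ
    Σψ[powerSum₃]≈0 = ≐-≈-trans (Σᶜ-E³ (λ t → ψ (powerSum₃ t))) (Σᶜ-≈zero E (λ x → Σᶜ-≈zero E (λ y → Σψ[C+z^s]≈0 (x ^ s + y ^ s))))

    z₀ : Carrier → Carrier → Carrier
    z₀ x y = - (τ * (t₁ * x + t₂ * y))

    linearForm₃≡0⇒z≡z₀ : ∀ x y z → linearForm₃ (x , (y , z)) ≡ 0# → z ≡ z₀ x y
    linearForm₃≡0⇒z≡z₀ x y z h = begin
      z ≡⟨ sym (*-identityʳ z) ⟩
      z * 1# ≡⟨ cong (z *_) (sym (inv-r t₃ t₃≢0)) ⟩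
      z * (t₃ * τ) ≡⟨ solve 4 (λ z t₃ τ e → z :* (t₃ :* τ) := (e :+ t₃ :* z) :* τ :+ :- (τ :* e)) refl z t₃ τ (t₁ * x + t₂ * y) ⟩
      ((t₁ * x + t₂ * y) + t₃ * z) * τ + - (τ * (t₁ * x + t₂ * y)) ≡⟨ cong (λ a → a * τ + z₀ x y) (-x≡0⇒x≡0 _ h) ⟩
      0# * τ + z₀ x y ≡⟨ cong (_+ z₀ x y) (zeroˡ τ) ⟩
      0# + z₀ x y ≡⟨ +-identityˡ _ ⟩
      z₀ x y ∎
      where open ≡-Reasoning

    z≡z₀⇒linearForm₃≡0 : ∀ x y z → z ≡ z₀ x y → linearForm₃ (x , (y , z)) ≡ 0#
    z≡z₀⇒linearForm₃≡0 x y z refl = x≡0⇒-x≡0 _ (begin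
      (t₁ * x + t₂ * y) + t₃ * (- (τ * (t₁ * x + t₂ * y))) ≡⟨ solve 3 (λ e t₃ τ → e :+ t₃ :* (:- (τ :* e)) := e :+ :- (e :* (t₃ :* τ))) refl (t₁ * x + t₂ * y) t₃ τ ⟩
      (t₁ * x + t₂ * y) + - ((t₁ * x + t₂ * y) * (t₃ * τ)) ≡⟨ cong (λ a → (t₁ * x + t₂ * y) + - ((t₁ * x + t₂ * y) * a)) (inv-r t₃ t₃≢0) ⟩
      (t₁ * x + t₂ * y) + - ((t₁ * x + t₂ * y) * 1#) ≡⟨ solve 1 (λ e → e :+ :- (e :* con (ℤ.+ 1)) := con (ℤ.+ 0)) refl (t₁ * x + t₂ * y) ⟩
      0# ∎)
      where open ≡-Reasoning

    ψ-reduced : Carrier → Carrier → Carrier → Cyc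
    ψ-reduced w x y = ψ ((x ^ s + y ^ s) + - ((τ * w) ^ s))

    powerSum₃-z₀ : ∀ x y → powerSum₃ (x , (y , z₀ x y)) ≡ (x ^ s + y ^ s) + - ((τ * (t₁ * x + t₂ * y)) ^ s)
    powerSum₃-z₀ x y = cong ((x ^ s + y ^ s) +_) (-‿^s _)

    fibre : Carrier → Cyc
    fibre w = Σᶜ E (λ x → Σᶜ E (λ y → indᶜ (w ≟F (t₁ * x + t₂ * y)) (ψ-reduced w x y)))

    Σ-by-fibres : Σᶜ E (λ x → Σᶜ E (λ y → ψ-reduced (t₁ * x + t₂ * y) x y)) ≐ Σᶜ E fibre
    Σ-by-fibres = ≐-trans (Σᶜ-cong≐ E (λ x → Σᶜ-cong≐ E (λ y → ≐-sym (Σᶜ-delta (t₁ * x + t₂ * y) (λ w → ψ-reduced w x y)))))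
      (≐-trans (Σᶜ-cong≐ E (λ x → Σᶜ-swap E E (λ y w → indᶜ (w ≟F (t₁ * x + t₂ * y)) (ψ-reduced w x y))))
        (Σᶜ-swap E E (λ x w → Σᶜ E (λ y → indᶜ (w ≟F (t₁ * x + t₂ * y)) (ψ-reduced w x y)))))

    ψ-reduced-0 : ∀ x y → ψ-reduced 0# x y ≐ ψ (x ^ s + y ^ s)
    ψ-reduced-0 x y = ≡⇒≐ (cong ψ (trans (cong (λ a → (x ^ s + y ^ s) + - (a ^ s)) (zeroʳ τ))
                 (trans (cong (λ a → (x ^ s + y ^ s) + - a) 0^s≡0) (trans (cong ((x ^ s + y ^ s) +_) -0#≈0#) (+-identityʳ _)))))

    fibre-0≈ : fibre 0# ≈ intᶜ p (ind (t₁ ≟F t₂) (ℤ.+ q))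
    fibre-0≈ = ≐-≈-trans (Σᶜ-cong≐ E (λ x → Σᶜ-cong≐ E (λ y → indᶜ-cong≐ (0# ≟F (t₁ * x + t₂ * y)) (ψ-reduced-0 x y))))
      (Σ-line-ψ[x^s+y^s]≈ (λ x y → 0# ≟F (t₁ * x + t₂ * y)) (λ x y h → t₁x+t₂y≡0⇒y≡y₀ x y (sym h)) (λ x y h → sym (y≡y₀⇒t₁x+t₂y≡0 x y h)))

    d : Carrier → Carrier → Carrier
    d x y = (x ^ s + y ^ s) + - (τ ^ s)

    fibre-rescale : ∀ w → w ≢ 0# → fibre w ≐ Σᶜ E (λ x → Σᶜ E (λ y → indᶜ (1# ≟F (t₁ * x + t₂ * y)) (ψ (w ^ s * d x y))))
    fibre-rescale w w≢0 = ≐-trans rescale-y (≐-trans rescale-x simplify)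
      where
      t₁[wx]+t₂[wy]≡w[t₁x+t₂y] : ∀ x y → t₁ * (w * x) + t₂ * (w * y) ≡ w * (t₁ * x + t₂ * y)
      t₁[wx]+t₂[wy]≡w[t₁x+t₂y] x y = solve 5 (λ t₁ t₂ w x y → t₁ :* (w :* x) :+ t₂ :* (w :* y) := w :* (t₁ :* x :+ t₂ :* y)) refl t₁ t₂ w x y
      on-fibre⇒on-line : ∀ x y → w ≡ t₁ * (w * x) + t₂ * (w * y) → 1# ≡ t₁ * x + t₂ * y
      on-fibre⇒on-line x y h = *-cancelˡ w 1# _ w≢0 (trans (*-identityʳ w) (trans h (t₁[wx]+t₂[wy]≡w[t₁x+t₂y] x y)))
      on-line⇒on-fibre : ∀ x y → 1# ≡ t₁ * x + t₂ * y → w ≡ t₁ * (w * x) + t₂ * (w * y)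
      on-line⇒on-fibre x y h = trans (sym (*-identityʳ w)) (trans (cong (w *_) h) (sym (t₁[wx]+t₂[wy]≡w[t₁x+t₂y] x y)))
      ψ-reduced-scale : ∀ x y → ((w * x) ^ s + (w * y) ^ s) + - ((τ * w) ^ s) ≡ w ^ s * d x y
      ψ-reduced-scale x y = begin
        ((w * x) ^ s + (w * y) ^ s) + - ((τ * w) ^ s) ≡⟨ cong₂ (λ a b → a + - b) (cong₂ _+_ (^-distribʳ-* w x s) (^-distribʳ-* w y s)) (^-distribʳ-* τ w s) ⟩
        (w ^ s * x ^ s + w ^ s * y ^ s) + - (τ ^ s * w ^ s) ≡⟨ solve 4 (λ W X Y T → (W :* X :+ W :* Y) :+ :- (T :* W) := W :* ((X :+ Y) :+ :- T)) refl (w ^ s) (x ^ s) (y ^ s) (τ ^ s) ⟩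
        w ^ s * d x y ∎
        where open ≡-Reasoning
      rescale-y : fibre w ≐ Σᶜ E (λ x → Σᶜ E (λ y → indᶜ (w ≟F (t₁ * x + t₂ * (w * y))) (ψ-reduced w x (w * y))))
      rescale-y = Σᶜ-cong≐ E (λ x → ≐-sym (Σᶜ-bijection (w *_) (inv w *_) (a*[a⁻¹*y]≡y w w≢0) (a⁻¹*[a*y]≡y w w≢0) (λ y → indᶜ (w ≟F (t₁ * x + t₂ * y)) (ψ-reduced w x y))))
      rescale-x : Σᶜ E (λ x → Σᶜ E (λ y → indᶜ (w ≟F (t₁ * x + t₂ * (w * y))) (ψ-reduced w x (w * y))))
         ≐ Σᶜ E (λ x → Σᶜ E (λ y → indᶜ (w ≟F (t₁ * (w * x) + t₂ * (w * y))) (ψ-reduced w (w * x) (w * y))))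
      rescale-x = ≐-sym (Σᶜ-bijection (w *_) (inv w *_) (a*[a⁻¹*y]≡y w w≢0) (a⁻¹*[a*y]≡y w w≢0) (λ x → Σᶜ E (λ y → indᶜ (w ≟F (t₁ * x + t₂ * (w * y))) (ψ-reduced w x (w * y)))))
      simplify : Σᶜ E (λ x → Σᶜ E (λ y → indᶜ (w ≟F (t₁ * (w * x) + t₂ * (w * y))) (ψ-reduced w (w * x) (w * y))))
         ≐ Σᶜ E (λ x → Σᶜ E (λ y → indᶜ (1# ≟F (t₁ * x + t₂ * y)) (ψ (w ^ s * d x y))))
      simplify = Σᶜ-cong≐ E (λ x → Σᶜ-cong≐ E (λ y →
             ≐-trans (≡⇒≐ (indᶜ-⇔ (w ≟F (t₁ * (w * x) + t₂ * (w * y))) (1# ≟F (t₁ * x + t₂ * y)) (on-fibre⇒on-line x y) (on-line⇒on-fibre x y) _))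
                     (indᶜ-cong≐ (1# ≟F (t₁ * x + t₂ * y)) (≡⇒≐ (cong ψ (ψ-reduced-scale x y))))))

    d≡0⇒x^s+y^s≡τ^s : ∀ x y → d x y ≡ 0# → x ^ s + y ^ s ≡ τ ^ s
    d≡0⇒x^s+y^s≡τ^s x y h = x-y≡0⇒x≡y _ _ h
    x^s+y^s≡τ^s⇒d≡0 : ∀ x y → x ^ s + y ^ s ≡ τ ^ s → d x y ≡ 0#
    x^s+y^s≡τ^s⇒d≡0 x y h = trans (cong (_+ - (τ ^ s)) h) (-‿inverseʳ _)

    Q[1,τ] : ℕ
    Q[1,τ] = Q t₁ t₂ 1# τ

    Σ-line-count : Σ E (λ x → Σ E (λ y → ind (1# ≟F (t₁ * x + t₂ * y)) (ind (d x y ≟F 0#) (ℤ.+ q) -ℤ 1ℤ))) ≡ ℤ.+ q *ℤ ℤ.+ Q[1,τ] -ℤ ℤ.+ q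
    Σ-line-count = begin
      Σ E (λ x → Σ E (λ y → ind (1# ≟F (t₁ * x + t₂ * y)) (ind (d x y ≟F 0#) (ℤ.+ q) -ℤ 1ℤ)))
        ≡⟨ Sums.Σ-cong E (λ x → Sums.Σ-cong E (λ y → Sums.ind-[ind-1] (1# ≟F (t₁ * x + t₂ * y)) (d x y ≟F 0#) (ℤ.+ q))) ⟩
      Σ E (λ x → Σ E (λ y → ℤ.+ q *ℤ a x y +ℤ -ℤ b x y)) ≡⟨ ΣΣ-+ (λ x y → ℤ.+ q *ℤ a x y) (λ x y → -ℤ b x y) ⟩
      Σ E (λ x → Σ E (λ y → ℤ.+ q *ℤ a x y)) +ℤ Σ E (λ x → Σ E (λ y → -ℤ b x y)) ≡⟨ cong₂ _+ℤ_ (ΣΣ-* (ℤ.+ q) a) (ΣΣ-neg b) ⟩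
      ℤ.+ q *ℤ Σ E (λ x → Σ E (λ y → a x y)) +ℤ -ℤ Σ E (λ x → Σ E (λ y → b x y)) ≡⟨ cong₂ (λ u v → ℤ.+ q *ℤ u +ℤ -ℤ v) Qa |t₁x+t₂y≡1|≡q ⟩
      ℤ.+ q *ℤ ℤ.+ Q[1,τ] -ℤ ℤ.+ q ∎
      where
      open ≡-Reasoning
      a : Carrier → Carrier → ℤ
      a x y = ind (1# ≟F (t₁ * x + t₂ * y)) (ind (d x y ≟F 0#) 1ℤ)
      b : Carrier → Carrier → ℤ
      b x y = ind (1# ≟F (t₁ * x + t₂ * y)) 1ℤ
      Qa : Σ E (λ x → Σ E (λ y → a x y)) ≡ ℤ.+ Q[1,τ]
      Qa = sym (trans (Q-as-Σ t₁ t₂ 1# τ) (Sums.Σ-cong E (λ x → Sums.Σ-cong E (λ y →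
             trans (Sums.ind-⇔ (((t₁ * x + t₂ * y) ≟F 1#) ×-dec ((x ^ s + y ^ s) ≟F (τ ^ s)))
                                  ((1# ≟F (t₁ * x + t₂ * y)) ×-dec (d x y ≟F 0#))
                                  (λ { (e1 , e2) → sym e1 , x^s+y^s≡τ^s⇒d≡0 x y e2 }) (λ { (e1 , e2) → sym e1 , d≡0⇒x^s+y^s≡τ^s x y e2 }) 1ℤ)
                   (sym (Sums.ind-× (1# ≟F (t₁ * x + t₂ * y)) (d x y ≟F 0#) 1ℤ))))))

    Σunits-fibre≈ : Σᶜ U fibre ≈ intᶜ p (ℤ.+ q *ℤ ℤ.+ Q[1,τ] -ℤ ℤ.+ q)
    Σunits-fibre≈ = ≐-≈-trans (Σᶜ-cong-∈ U (λ w w∈ → fibre-rescale w (∈units⇒≢0 w∈)))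
      (≐-≈-trans (Σᶜ-swap U E (λ w x → Σᶜ E (λ y → indᶜ (1# ≟F (t₁ * x + t₂ * y)) (ψ (w ^ s * d x y)))))
      (≐-≈-trans (Σᶜ-cong≐ E (λ x → Σᶜ-swap U E (λ w y → indᶜ (1# ≟F (t₁ * x + t₂ * y)) (ψ (w ^ s * d x y)))))
      (≐-≈-trans (Σᶜ-cong≐ E (λ x → Σᶜ-cong≐ E (λ y → Σᶜ-indᶜ U (1# ≟F (t₁ * x + t₂ * y)) (λ w → ψ (w ^ s * d x y)))))
      (≈-≐-trans (Σᶜ-cong≈ E (λ x → Σᶜ-cong≈ E (λ y → indᶜ-cong≈ (1# ≟F (t₁ * x + t₂ * y)) (Σunits-ψ[w^s*d]≈ (d x y)))))
      (≐-trans (Σᶜ-cong≐ E (λ x → Σᶜ-cong≐ E (λ y → indᶜ-int (1# ≟F (t₁ * x + t₂ * y)) (ind (d x y ≟F 0#) (ℤ.+ q) -ℤ 1ℤ))))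
      (≐-trans (Σᶜ-cong≐ E (λ x → Σᶜ-int E (λ y → ind (1# ≟F (t₁ * x + t₂ * y)) (ind (d x y ≟F 0#) (ℤ.+ q) -ℤ 1ℤ))))
      (≐-trans (Σᶜ-int E (λ x → Σ E (λ y → ind (1# ≟F (t₁ * x + t₂ * y)) (ind (d x y ≟F 0#) (ℤ.+ q) -ℤ 1ℤ))))
        (≡⇒≐ (cong (intᶜ p) Σ-line-count)))))))))

    V[t₁,t₂,τ] : ℤ
    V[t₁,t₂,τ] = V t₁ t₂ τ

    fibres-total : ind (t₁ ≟F t₂) (ℤ.+ q) +ℤ (ℤ.+ q *ℤ ℤ.+ Q[1,τ] -ℤ ℤ.+ q) ≡ ℤ.+ q *ℤ V[t₁,t₂,τ]
    fibres-total = trans (total (t₁ ≟F t₂)) (cong (λ z → ℤ.+ q *ℤ (ℤ.+ Q[1,τ] -ℤ z)) (sym Q[1,0]≡[t₁≢t₂]))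
      where
      total : (d : Dec (t₁ ≡ t₂)) → ind d (ℤ.+ q) +ℤ (ℤ.+ q *ℤ ℤ.+ Q[1,τ] -ℤ ℤ.+ q) ≡ ℤ.+ q *ℤ (ℤ.+ Q[1,τ] -ℤ ind (¬? d) 1ℤ)
      total (yes _) = identity (ℤ.+ q) (ℤ.+ Q[1,τ])
        where
        identity : ∀ a b → a +ℤ (a *ℤ b -ℤ a) ≡ a *ℤ (b -ℤ 0ℤ)
        identity = solve-∀
      total (no _) = identity (ℤ.+ q) (ℤ.+ Q[1,τ])
        where
        identity : ∀ a b → 0ℤ +ℤ (a *ℤ b -ℤ a) ≡ a *ℤ (b -ℤ 1ℤ)
        identity = solve-∀

    Σ-ψ-reduced≈ : Σᶜ E (λ x → Σᶜ E (λ y → ψ-reduced (t₁ * x + t₂ * y) x y)) ≈ intᶜ p (ℤ.+ q *ℤ V[t₁,t₂,τ])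
    Σ-ψ-reduced≈ = ≐-≈-trans Σ-by-fibres (≐-≈-trans (Σᶜ-remove-0 fibre) (≈-≐-trans (⊕-cong≈ fibre-0≈ Σunits-fibre≈)
               (≐-trans (intᶜ-⊕ _ _) (≡⇒≐ (cong (intᶜ p) fibres-total)))))

    count : Σᶜ E³ (λ t → indᶜ (linearForm₃ t ≟F 0#) (Σᶜ E (λ _ → ψ (powerSum₃ t)))) ≈ intᶜ p (ℤ.+ q *ℤ (ℤ.+ q *ℤ V[t₁,t₂,τ]))
    count = ≐-≈-trans (Σᶜ-E³ _)
      (≐-≈-trans (Σᶜ-cong≐ E (λ x → Σᶜ-cong≐ E (λ y →
          ≐-trans (Σᶜ-cong≐ E (λ z → ≡⇒≐ (indᶜ-⇔ (linearForm₃ (x , (y , z)) ≟F 0#) (z ≟F z₀ x y) (linearForm₃≡0⇒z≡z₀ x y z) (z≡z₀⇒linearForm₃≡0 x y z) _)))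
          (≐-trans (Σᶜ-delta (z₀ x y) (λ z → Σᶜ E (λ _ → ψ (powerSum₃ (x , (y , z))))))
                   (Σᶜ-cong≐ E (λ _ → ≡⇒≐ (cong ψ (powerSum₃-z₀ x y))))))))
      (≐-≈-trans (Σᶜ-cong≐ E (λ x → Σᶜ-swap E E (λ y u → ψ-reduced (t₁ * x + t₂ * y) x y)))
      (≐-≈-trans (Σᶜ-swap E E (λ x u → Σᶜ E (λ y → ψ-reduced (t₁ * x + t₂ * y) x y)))
      (≈-≐-trans (Σᶜ-cong≈ E (λ u → Σ-ψ-reduced≈)) (Σᶜ-const-intᶜ E (ℤ.+ q *ℤ V[t₁,t₂,τ]))))))

    Σunits-W⊗W⊗W≈ : Σᶜ U (λ u → (W (t₁ * u) ⊗ W (t₂ * u)) ⊗ W (t₃ * u)) ≈ intᶜ p (ℤ.+ (q ℕ.* q) *ℤ V[t₁,t₂,τ])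
    Σunits-W⊗W⊗W≈ = ≐-≈-trans expand (≈-trans (Σunits-phase E³ powerSum₃ linearForm₃ Σψ[powerSum₃]≈0) (≈-≐-trans count
      (≡⇒≐ (cong (intᶜ p) (trans (sym (ℤP.*-assoc (ℤ.+ q) (ℤ.+ q) V[t₁,t₂,τ])) (cong (_*ℤ V[t₁,t₂,τ]) (sym (ℤP.pos-* q q))))))))


module WeilSums₄ (F : FiniteField) (p n s : ℕ) .{{_ : NonZero p}} (p-prime : Prime p)
                 (charF≡p : FiniteField.fromℕ F p ≡ FiniteField.0# F)
                 (q≡p^n : FiniteField.order F ≡ p Data.Nat.^ n)
                 (0<s : 0 < s) (gcd[s,q-1]≡1 : gcd s (FiniteField.order F ∸ 1) ≡ 1) where
  open WeilSums₃ F p n s p-prime charF≡p q≡p^n 0<s gcd[s,q-1]≡1 public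
  open Sums using (Σ; ind)
  import Data.Nat as ℕ
  open import Data.Integer as ℤ using (ℤ; 0ℤ; 1ℤ) renaming (_+_ to _+ℤ_; _-_ to _-ℤ_; _*_ to _*ℤ_; -_ to -ℤ_)
  import Data.Integer.Properties as ℤP
  open import Data.Integer.Tactic.RingSolver using (solve-∀)
  open import Data.List using (List; cartesianProduct; foldr; map)
  open import Relation.Nullary using (Dec; ¬?)
  open import Relation.Nullary.Decidable using (_×-dec_)
  open import Relation.Binary.PropositionalEquality
  open import Data.Product using (_×_; _,_; proj₁; proj₂)

  E⁴ : List (Carrier × (Carrier × (Carrier × Carrier)))
  E⁴ = cartesianProduct E E³

  Σᶜ-E⁴ : ∀ (f : Carrier × (Carrier × (Carrier × Carrier)) → Cyc) →
          Σᶜ E⁴ f ≐ Σᶜ E (λ x → Σᶜ E (λ y → Σᶜ E (λ z → Σᶜ E (λ w → f (x , (y , (z , w)))))))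
  Σᶜ-E⁴ f = ≐-trans (Σᶜ-cartesianProduct E E³ f) (Σᶜ-cong≐ E (λ x → Σᶜ-E³ (λ b → f (x , b))))

  powerSum₄ : Carrier × (Carrier × (Carrier × Carrier)) → Carrier
  powerSum₄ t = ((proj₁ t ^ s + proj₁ (proj₂ t) ^ s) + proj₁ (proj₂ (proj₂ t)) ^ s) + proj₂ (proj₂ (proj₂ t)) ^ s
  linearForm₄ : Carrier × (Carrier × (Carrier × Carrier)) → Carrier
  linearForm₄ t = - (((proj₁ t + proj₁ (proj₂ t)) + proj₁ (proj₂ (proj₂ t))) + proj₂ (proj₂ (proj₂ t)))

  expand : Σᶜ U (λ u → (W u ⊗ W u) ⊗ (W u ⊗ W u)) ≐ Σᶜ U (λ u → Σᶜ E⁴ (λ t → ψ (powerSum₄ t + u * linearForm₄ t)))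
  expand = Σᶜ-cong≐ U (λ u → ≐-trans (W⊗W⊗W⊗W u u u u)
      (≐-trans (Σᶜ-cong≐ E (λ x → Σᶜ-cong≐ E (λ y → Σᶜ-cong≐ E (λ z → Σᶜ-cong≐ E (λ w → ≡⇒≐ (cong ψ
        (solve 9 (λ X Y Z Wv u x y z w → ((X :- u :* x) :+ (Y :- u :* y)) :+ ((Z :- u :* z) :+ (Wv :- u :* w))
             := (((X :+ Y) :+ Z) :+ Wv) :+ u :* (:- (((x :+ y) :+ z) :+ w))) refl (x ^ s) (y ^ s) (z ^ s) (w ^ s) u x y z w)))))))
      (≐-sym (Σᶜ-E⁴ (λ t → ψ (powerSum₄ t + u * linearForm₄ t))))))

  Σψ[powerSum₄]≈0 : Σᶜ E⁴ (λ t → ψ (powerSum₄ t)) ≈ zeroᶜ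
  Σψ[powerSum₄]≈0 = ≐-≈-trans (Σᶜ-E⁴ (λ t → ψ (powerSum₄ t))) (Σᶜ-≈zero E (λ x → Σᶜ-≈zero E (λ y → Σᶜ-≈zero E (λ z → Σψ[C+z^s]≈0 ((x ^ s + y ^ s) + z ^ s)))))

  w₀ : Carrier → Carrier → Carrier → Carrier
  w₀ x y z = - ((x + y) + z)

  linearForm₄≡0⇒w≡w₀ : ∀ x y z w → linearForm₄ (x , (y , (z , w))) ≡ 0# → w ≡ w₀ x y z
  linearForm₄≡0⇒w≡w₀ x y z w h = begin
    w ≡⟨ solve 2 (λ e w → w := (e :+ w) :+ :- e) refl ((x + y) + z) w ⟩
    (((x + y) + z) + w) + - ((x + y) + z) ≡⟨ cong (_+ w₀ x y z) (-x≡0⇒x≡0 _ h) ⟩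
    0# + w₀ x y z ≡⟨ +-identityˡ _ ⟩
    w₀ x y z ∎
    where open ≡-Reasoning

  w≡w₀⇒linearForm₄≡0 : ∀ x y z w → w ≡ w₀ x y z → linearForm₄ (x , (y , (z , w))) ≡ 0#
  w≡w₀⇒linearForm₄≡0 x y z w refl = x≡0⇒-x≡0 _ (-‿inverseʳ _)

  ψ-reduced : Carrier → Carrier → Carrier → Carrier → Cyc
  ψ-reduced a x y z = ψ (((x ^ s + y ^ s) + z ^ s) + - ((a + z) ^ s))

  powerSum₄-w₀ : ∀ x y z → powerSum₄ (x , (y , (z , w₀ x y z))) ≡ ((x ^ s + y ^ s) + z ^ s) + - (((x + y) + z) ^ s)
  powerSum₄-w₀ x y z = cong (((x ^ s + y ^ s) + z ^ s) +_) (-‿^s _)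

  zSum : Carrier → Carrier → Carrier → Cyc
  zSum a x y = Σᶜ E (λ z → ψ-reduced a x y z)

  fibre : Carrier → Cyc
  fibre a = Σᶜ E (λ x → Σᶜ E (λ y → indᶜ (a ≟F (x + y)) (zSum a x y)))

  Σ-by-fibres : Σᶜ E (λ x → Σᶜ E (λ y → zSum (x + y) x y)) ≐ Σᶜ E fibre
  Σ-by-fibres = ≐-trans (Σᶜ-cong≐ E (λ x → Σᶜ-cong≐ E (λ y → ≐-sym (Σᶜ-delta (x + y) (λ a → zSum a x y)))))
      (≐-trans (Σᶜ-cong≐ E (λ x → Σᶜ-swap E E (λ y a → indᶜ (a ≟F (x + y)) (zSum a x y))))
        (Σᶜ-swap E E (λ x a → Σᶜ E (λ y → indᶜ (a ≟F (x + y)) (zSum a x y)))))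

  fibre-0≐q² : fibre 0# ≐ intᶜ p (ℤ.+ q *ℤ ℤ.+ q)
  fibre-0≐q² = ≐-trans (Σᶜ-cong≐ E (λ x → ≐-trans (Σᶜ-cong≐ E (λ y → ≡⇒≐ (indᶜ-⇔ (0# ≟F (x + y)) (y ≟F (- x))
            (λ h → trans (solve 2 (λ x y → y := (x :+ y) :+ :- x) refl x y) (trans (cong (_+ - x) (sym h)) (+-identityˡ _)))
            (λ h → sym (trans (cong (x +_) h) (-‿inverseʳ x))) _)))
          (≐-trans (Σᶜ-delta (- x) (λ y → zSum 0# x y))
          (≐-trans (Σᶜ-cong≐ E (λ z → ≐-trans (≡⇒≐ (cong ψ (ψ-reduced-arg-0 x z))) ψ-0)) ΣE-1≐q))))
        (Σᶜ-const-intᶜ E (ℤ.+ q))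
    where
    ψ-reduced-arg-0 : ∀ x z → ((x ^ s + (- x) ^ s) + z ^ s) + - ((0# + z) ^ s) ≡ 0#
    ψ-reduced-arg-0 x z = begin
      ((x ^ s + (- x) ^ s) + z ^ s) + - ((0# + z) ^ s) ≡⟨ cong₂ (λ a b → ((x ^ s + a) + z ^ s) + - (b ^ s)) (-‿^s x) (+-identityˡ z) ⟩
      ((x ^ s + - (x ^ s)) + z ^ s) + - (z ^ s) ≡⟨ solve 2 (λ X Z → ((X :+ :- X) :+ Z) :+ :- Z := con (ℤ.+ 0)) refl (x ^ s) (z ^ s) ⟩
      0# ∎
      where open ≡-Reasoning

  curve : Carrier → Carrier → Carrier → Carrier
  curve x y z = ((x ^ s + y ^ s) + z ^ s) + - ((1# + z) ^ s)

  module Rescale (a : Carrier) (a≢0 : a ≢ 0#) where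
    curve-scale : ∀ x y z → (((a * x) ^ s + (a * y) ^ s) + (a * z) ^ s) + - ((a + a * z) ^ s) ≡ a ^ s * curve x y z
    curve-scale x y z = begin
      (((a * x) ^ s + (a * y) ^ s) + (a * z) ^ s) + - ((a + a * z) ^ s)
        ≡⟨ cong (λ b → (((a * x) ^ s + (a * y) ^ s) + (a * z) ^ s) + - (b ^ s)) (solve 2 (λ a z → a :+ a :* z := a :* (con (ℤ.+ 1) :+ z)) refl a z) ⟩
      (((a * x) ^ s + (a * y) ^ s) + (a * z) ^ s) + - ((a * (1# + z)) ^ s)
        ≡⟨ cong₂ (λ b c → b + - c) (cong₂ _+_ (cong₂ _+_ (^-distribʳ-* a x s) (^-distribʳ-* a y s)) (^-distribʳ-* a z s)) (^-distribʳ-* a (1# + z) s) ⟩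
      ((a ^ s * x ^ s + a ^ s * y ^ s) + a ^ s * z ^ s) + - (a ^ s * (1# + z) ^ s)
        ≡⟨ solve 5 (λ A X Y Z O → ((A :* X :+ A :* Y) :+ A :* Z) :+ :- (A :* O) := A :* (((X :+ Y) :+ Z) :+ :- O)) refl (a ^ s) (x ^ s) (y ^ s) (z ^ s) ((1# + z) ^ s) ⟩
      a ^ s * curve x y z ∎
      where open ≡-Reasoning

    zSum-rescale : ∀ x y → zSum a (a * x) (a * y) ≐ Σᶜ E (λ z → ψ (a ^ s * curve x y z))
    zSum-rescale x y = ≐-trans (≐-sym (Σᶜ-bijection (a *_) (inv a *_) (a*[a⁻¹*y]≡y a a≢0) (a⁻¹*[a*y]≡y a a≢0) (λ z → ψ-reduced a (a * x) (a * y) z)))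
      (Σᶜ-cong≐ E (λ z → ≡⇒≐ (cong ψ (curve-scale x y z))))

    on-fibre⇒on-line : ∀ x y → a ≡ a * x + a * y → 1# ≡ x + y
    on-fibre⇒on-line x y h = *-cancelˡ a 1# _ a≢0 (trans (*-identityʳ a) (trans h (sym (distribˡ a x y))))
    on-line⇒on-fibre : ∀ x y → 1# ≡ x + y → a ≡ a * x + a * y
    on-line⇒on-fibre x y h = trans (sym (*-identityʳ a)) (trans (cong (a *_) h) (distribˡ a x y))

    fibre-rescale : fibre a ≐ Σᶜ E (λ x → Σᶜ E (λ y → indᶜ (1# ≟F (x + y)) (Σᶜ E (λ z → ψ (a ^ s * curve x y z)))))
    fibre-rescale = ≐-trans rescale-y (≐-trans rescale-x simplify)
      where
      rescale-y : fibre a ≐ Σᶜ E (λ x → Σᶜ E (λ y → indᶜ (a ≟F (x + a * y)) (zSum a x (a * y))))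
      rescale-y = Σᶜ-cong≐ E (λ x → ≐-sym (Σᶜ-bijection (a *_) (inv a *_) (a*[a⁻¹*y]≡y a a≢0) (a⁻¹*[a*y]≡y a a≢0) (λ y → indᶜ (a ≟F (x + y)) (zSum a x y))))
      rescale-x : Σᶜ E (λ x → Σᶜ E (λ y → indᶜ (a ≟F (x + a * y)) (zSum a x (a * y))))
         ≐ Σᶜ E (λ x → Σᶜ E (λ y → indᶜ (a ≟F (a * x + a * y)) (zSum a (a * x) (a * y))))
      rescale-x = ≐-sym (Σᶜ-bijection (a *_) (inv a *_) (a*[a⁻¹*y]≡y a a≢0) (a⁻¹*[a*y]≡y a a≢0) (λ x → Σᶜ E (λ y → indᶜ (a ≟F (x + a * y)) (zSum a x (a * y)))))
      simplify : Σᶜ E (λ x → Σᶜ E (λ y → indᶜ (a ≟F (a * x + a * y)) (zSum a (a * x) (a * y))))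
         ≐ Σᶜ E (λ x → Σᶜ E (λ y → indᶜ (1# ≟F (x + y)) (Σᶜ E (λ z → ψ (a ^ s * curve x y z)))))
      simplify = Σᶜ-cong≐ E (λ x → Σᶜ-cong≐ E (λ y →
             ≐-trans (≡⇒≐ (indᶜ-⇔ (a ≟F (a * x + a * y)) (1# ≟F (x + y)) (on-fibre⇒on-line x y) (on-line⇒on-fibre x y) _))
                     (indᶜ-cong≐ (1# ≟F (x + y)) (zSum-rescale x y))))

  pointCount : ℤ
  pointCount = Σ E (λ x → Σ E (λ y → ind (1# ≟F (x + y)) (Σ E (λ z → ind (curve x y z ≟F 0#) 1ℤ))))

  |x+y≡1|≡q : Σ E (λ x → Σ E (λ y → ind (1# ≟F (x + y)) 1ℤ)) ≡ ℤ.+ q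
  |x+y≡1|≡q = trans (Sums.Σ-cong E (λ x → Sums.Σ-cong E (λ y → Sums.ind-⇔ (1# ≟F (x + y)) (1# ≟F (1# * x + 1# * y))
              (λ h → trans h (sym (cong₂ _+_ (*-identityˡ x) (*-identityˡ y))))
              (λ h → trans h (cong₂ _+_ (*-identityˡ x) (*-identityˡ y))) 1ℤ)))
           (LineThrough1.|t₁x+t₂y≡1|≡q 1# 1# 1≢0 1≢0)

  Σ-[q[curve≡0]-1] : ∀ x y → Σ E (λ z → ind (curve x y z ≟F 0#) (ℤ.+ q) -ℤ 1ℤ) ≡ ℤ.+ q *ℤ Σ E (λ z → ind (curve x y z ≟F 0#) 1ℤ) -ℤ ℤ.+ q
  Σ-[q[curve≡0]-1] x y = begin
    Σ E (λ z → ind (curve x y z ≟F 0#) (ℤ.+ q) +ℤ -ℤ 1ℤ) ≡⟨ Sums.Σ-∙ E _ _ ⟩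
    Σ E (λ z → ind (curve x y z ≟F 0#) (ℤ.+ q)) +ℤ Σ E (λ z → -ℤ 1ℤ) ≡⟨ cong₂ _+ℤ_
        (trans (Sums.Σ-cong E (λ z → Sums.ind≡*ind1 (curve x y z ≟F 0#) (ℤ.+ q))) (Sums.Σ-*ˡ E (ℤ.+ q) _))
        (trans (Sums.Σ-neg E (λ _ → 1ℤ)) (cong -ℤ_ ΣE-1≡q)) ⟩
    ℤ.+ q *ℤ Σ E (λ z → ind (curve x y z ≟F 0#) 1ℤ) -ℤ ℤ.+ q ∎
    where open ≡-Reasoning

  Σ-line-count : Σ E (λ x → Σ E (λ y → ind (1# ≟F (x + y)) (Σ E (λ z → ind (curve x y z ≟F 0#) (ℤ.+ q) -ℤ 1ℤ)))) ≡ ℤ.+ q *ℤ pointCount -ℤ ℤ.+ q *ℤ ℤ.+ q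
  Σ-line-count = begin
    Σ E (λ x → Σ E (λ y → ind (1# ≟F (x + y)) (Σ E (λ z → ind (curve x y z ≟F 0#) (ℤ.+ q) -ℤ 1ℤ))))
      ≡⟨ Sums.Σ-cong E (λ x → Sums.Σ-cong E (λ y → trans (cong (ind (1# ≟F (x + y))) (Σ-[q[curve≡0]-1] x y)) (Sums.ind-[c*x-c] (1# ≟F (x + y)) (ℤ.+ q) _))) ⟩
    Σ E (λ x → Σ E (λ y → ℤ.+ q *ℤ X x y +ℤ -ℤ (ℤ.+ q *ℤ Y x y))) ≡⟨ ΣΣ-+ _ _ ⟩
    Σ E (λ x → Σ E (λ y → ℤ.+ q *ℤ X x y)) +ℤ Σ E (λ x → Σ E (λ y → -ℤ (ℤ.+ q *ℤ Y x y)))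
      ≡⟨ cong₂ _+ℤ_ (ΣΣ-* (ℤ.+ q) X) (trans (ΣΣ-neg (λ x y → ℤ.+ q *ℤ Y x y)) (cong -ℤ_ (trans (ΣΣ-* (ℤ.+ q) Y) (cong (ℤ.+ q *ℤ_) |x+y≡1|≡q)))) ⟩
    ℤ.+ q *ℤ pointCount -ℤ ℤ.+ q *ℤ ℤ.+ q ∎
    where
    open ≡-Reasoning
    X : Carrier → Carrier → ℤ
    X x y = ind (1# ≟F (x + y)) (Σ E (λ z → ind (curve x y z ≟F 0#) 1ℤ))
    Y : Carrier → Carrier → ℤ
    Y x y = ind (1# ≟F (x + y)) 1ℤ

  onLine : ∀ x y → Dec (1# ≡ x + y)
  onLine x y = 1# ≟F (x + y)

  Σunits-fibre≈ : Σᶜ U fibre ≈ intᶜ p (ℤ.+ q *ℤ pointCount -ℤ ℤ.+ q *ℤ ℤ.+ q)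
  Σunits-fibre≈ = ≐-≈-trans (Σᶜ-cong-∈ U (λ a a∈ → Rescale.fibre-rescale a (∈units⇒≢0 a∈)))
      (≐-≈-trans (Σᶜ-swap U E (λ a x → Σᶜ E (λ y → indᶜ (onLine x y) (Σᶜ E (λ z → ψ (a ^ s * curve x y z))))))
      (≐-≈-trans (Σᶜ-cong≐ E (λ x → Σᶜ-swap U E (λ a y → indᶜ (onLine x y) (Σᶜ E (λ z → ψ (a ^ s * curve x y z))))))
      (≐-≈-trans (Σᶜ-cong≐ E (λ x → Σᶜ-cong≐ E (λ y → Σᶜ-indᶜ U (onLine x y) (λ a → Σᶜ E (λ z → ψ (a ^ s * curve x y z))))))
      (≐-≈-trans (Σᶜ-cong≐ E (λ x → Σᶜ-cong≐ E (λ y → indᶜ-cong≐ (onLine x y) (Σᶜ-swap U E (λ a z → ψ (a ^ s * curve x y z))))))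
      (≈-≐-trans (Σᶜ-cong≈ E (λ x → Σᶜ-cong≈ E (λ y → indᶜ-cong≈ (onLine x y) (Σᶜ-cong≈ E (λ z → Σunits-ψ[w^s*d]≈ (curve x y z))))))
      (≐-trans (Σᶜ-cong≐ E (λ x → Σᶜ-cong≐ E (λ y → indᶜ-cong≐ (onLine x y) (Σᶜ-int E (λ z → ind (curve x y z ≟F 0#) (ℤ.+ q) -ℤ 1ℤ)))))
      (≐-trans (Σᶜ-cong≐ E (λ x → Σᶜ-cong≐ E (λ y → indᶜ-int (onLine x y) (Σ E (λ z → ind (curve x y z ≟F 0#) (ℤ.+ q) -ℤ 1ℤ)))))
      (≐-trans (Σᶜ-cong≐ E (λ x → Σᶜ-int E (λ y → ind (onLine x y) (Σ E (λ z → ind (curve x y z ≟F 0#) (ℤ.+ q) -ℤ 1ℤ)))))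
      (≐-trans (Σᶜ-int E (λ x → Σ E (λ y → ind (onLine x y) (Σ E (λ z → ind (curve x y z ≟F 0#) (ℤ.+ q) -ℤ 1ℤ)))))
        (≡⇒≐ (cong (intᶜ p) Σ-line-count)))))))))))

  Σ-zSum≈ : Σᶜ E (λ x → Σᶜ E (λ y → zSum (x + y) x y)) ≈ intᶜ p (ℤ.+ q *ℤ pointCount)
  Σ-zSum≈ = ≐-≈-trans Σ-by-fibres (≐-≈-trans (Σᶜ-remove-0 fibre) (≈-≐-trans (⊕-cong≈ (≐⇒≈ fibre-0≐q²) Σunits-fibre≈)
              (≐-trans (intᶜ-⊕ _ _) (≡⇒≐ (cong (intᶜ p) (identity (ℤ.+ q) pointCount))))))
    where
    identity : ∀ a m → a *ℤ a +ℤ (a *ℤ m -ℤ a *ℤ a) ≡ a *ℤ m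
    identity = solve-∀

  count : Σᶜ E⁴ (λ t → indᶜ (linearForm₄ t ≟F 0#) (Σᶜ E (λ _ → ψ (powerSum₄ t)))) ≈ intᶜ p (ℤ.+ q *ℤ (ℤ.+ q *ℤ pointCount))
  count = ≐-≈-trans (Σᶜ-E⁴ _)
      (≐-≈-trans (Σᶜ-cong≐ E (λ x → Σᶜ-cong≐ E (λ y → Σᶜ-cong≐ E (λ z →
          ≐-trans (Σᶜ-cong≐ E (λ w → ≡⇒≐ (indᶜ-⇔ (linearForm₄ (x , (y , (z , w))) ≟F 0#) (w ≟F w₀ x y z) (linearForm₄≡0⇒w≡w₀ x y z w) (w≡w₀⇒linearForm₄≡0 x y z w) _)))
          (≐-trans (Σᶜ-delta (w₀ x y z) (λ w → Σᶜ E (λ _ → ψ (powerSum₄ (x , (y , (z , w)))))))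
                   (Σᶜ-cong≐ E (λ _ → ≡⇒≐ (cong ψ (powerSum₄-w₀ x y z)))))))))
      (≐-≈-trans (Σᶜ-cong≐ E (λ x → Σᶜ-cong≐ E (λ y → Σᶜ-swap E E (λ z u → ψ-reduced (x + y) x y z))))
      (≐-≈-trans (Σᶜ-cong≐ E (λ x → Σᶜ-swap E E (λ y u → zSum (x + y) x y)))
      (≐-≈-trans (Σᶜ-swap E E (λ x u → Σᶜ E (λ y → zSum (x + y) x y)))
      (≈-≐-trans (Σᶜ-cong≈ E (λ u → Σ-zSum≈)) (Σᶜ-const-intᶜ E (ℤ.+ q *ℤ pointCount)))))))

  N : Carrier → ℤ
  N b = Σ E (λ v1 → Σ E (λ v2 → ind (1# ≟F (v1 + v2)) (ind ((v1 ^ s + v2 ^ s) ≟F b) 1ℤ)))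

  Q[1,1,1,u]≡N[u^s] : ∀ u → ℤ.+ Q 1# 1# 1# u ≡ N (u ^ s)
  Q[1,1,1,u]≡N[u^s] u = trans (Q-as-Σ 1# 1# 1# u) (Sums.Σ-cong E (λ v1 → Sums.Σ-cong E (λ v2 →
    trans (Sums.ind-⇔ (((1# * v1 + 1# * v2) ≟F 1#) ×-dec ((v1 ^ s + v2 ^ s) ≟F (u ^ s)))
                         ((1# ≟F (v1 + v2)) ×-dec ((v1 ^ s + v2 ^ s) ≟F (u ^ s)))
                         (λ { (h1 , h2) → sym (trans (sym (cong₂ _+_ (*-identityˡ v1) (*-identityˡ v2))) h1) , h2 })
                         (λ { (h1 , h2) → trans (cong₂ _+_ (*-identityˡ v1) (*-identityˡ v2)) (sym h1) , h2 }) 1ℤ)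
          (sym (Sums.ind-× (1# ≟F (v1 + v2)) ((v1 ^ s + v2 ^ s) ≟F (u ^ s)) 1ℤ)))))

  Q[1,1,1,0]≡0 : ℤ.+ Q 1# 1# 1# 0# ≡ 0ℤ
  Q[1,1,1,0]≡0 = trans (LineThrough1.Q[1,0]≡[t₁≢t₂] 1# 1# 1≢0 1≢0) (Sums.ind-no (¬? (1# ≟F 1#)) (λ f → f refl) 1ℤ)

  V[1,1,u]≡N[u^s] : ∀ u → V 1# 1# u ≡ N (u ^ s)
  V[1,1,u]≡N[u^s] u = trans (cong (λ z → ℤ.+ Q 1# 1# 1# u -ℤ z) Q[1,1,1,0]≡0) (trans (ℤP.+-identityʳ _) (Q[1,1,1,u]≡N[u^s] u))

  N[0]≡0 : N (0# ^ s) ≡ 0ℤ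
  N[0]≡0 = trans (sym (Q[1,1,1,u]≡N[u^s] 0#)) Q[1,1,1,0]≡0

  ΣV² : ℤ
  ΣV² = foldr _+ℤ_ 0ℤ (map (λ u → V 1# 1# u *ℤ V 1# 1# u) units)

  ΣV²≡ΣN² : ΣV² ≡ Σ E (λ b → N b *ℤ N b)
  ΣV²≡ΣN² = begin
    Σ U (λ u → V 1# 1# u *ℤ V 1# 1# u) ≡⟨ Sums.Σ-cong U (λ u → cong₂ _*ℤ_ (V[1,1,u]≡N[u^s] u) (V[1,1,u]≡N[u^s] u)) ⟩
    Σ U f ≡⟨ sym (ℤP.+-identityˡ _) ⟩
    0ℤ +ℤ Σ U f ≡⟨ cong (_+ℤ Σ U f) (sym (cong₂ _*ℤ_ N[0]≡0 N[0]≡0)) ⟩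
    f 0# +ℤ Σ U f ≡⟨ sym (ℤSum.Σ-remove E 0# elements-unique (elements-complete 0#) f) ⟩
    Σ E f ≡⟨ ℤSum.Σ-bijection E elements-unique elements-complete pow-s root-s pow-root root-pow (λ b → N b *ℤ N b) ⟩
    Σ E (λ b → N b *ℤ N b) ∎
    where
    open ≡-Reasoning
    f : Carrier → ℤ
    f u = N (u ^ s) *ℤ N (u ^ s)

  ΣN²≡ : Σ E (λ b → N b *ℤ N b) ≡ Σ E (λ v1 → Σ E (λ v2 → ind (1# ≟F (v1 + v2)) (N (v1 ^ s + v2 ^ s))))
  ΣN²≡ = begin
    Σ E (λ b → N b *ℤ N b) ≡⟨ Sums.Σ-cong E (λ b → trans (Sums.Σ-*ʳ E _ (N b)) (Sums.Σ-cong E (λ v1 →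
          trans (Sums.Σ-*ʳ E _ (N b)) (Sums.Σ-cong E (λ v2 → Sums.ind-ind1*≡ind-ind (1# ≟F (v1 + v2)) ((v1 ^ s + v2 ^ s) ≟F b) (N b)))))) ⟩
    Σ E (λ b → Σ E (λ v1 → Σ E (λ v2 → ind (1# ≟F (v1 + v2)) (ind ((v1 ^ s + v2 ^ s) ≟F b) (N b))))) ≡⟨ Sums.Σ-swap E E _ ⟩
    Σ E (λ v1 → Σ E (λ b → Σ E (λ v2 → ind (1# ≟F (v1 + v2)) (ind ((v1 ^ s + v2 ^ s) ≟F b) (N b))))) ≡⟨ Sums.Σ-cong E (λ v1 → Sums.Σ-swap E E _) ⟩
    Σ E (λ v1 → Σ E (λ v2 → Σ E (λ b → ind (1# ≟F (v1 + v2)) (ind ((v1 ^ s + v2 ^ s) ≟F b) (N b))))) ≡⟨ Sums.Σ-cong E (λ v1 → Sums.Σ-cong E (λ v2 →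
          trans (Sums.Σ-ind E (1# ≟F (v1 + v2)) (λ b → ind ((v1 ^ s + v2 ^ s) ≟F b) (N b)))
            (cong (ind (1# ≟F (v1 + v2))) (trans (Sums.Σ-cong E (λ b → Sums.ind-⇔ ((v1 ^ s + v2 ^ s) ≟F b) (b ≟F (v1 ^ s + v2 ^ s)) sym sym (N b)))
              (ℤSum.Σ-delta E (v1 ^ s + v2 ^ s) N elements-unique (elements-complete _)))))) ⟩
    Σ E (λ v1 → Σ E (λ v2 → ind (1# ≟F (v1 + v2)) (N (v1 ^ s + v2 ^ s)))) ∎
    where open ≡-Reasoning

  N[x^s+y^s]≡ : ∀ x y → N (x ^ s + y ^ s) ≡ Σ E (λ z → ind (curve x y z ≟F 0#) 1ℤ)
  N[x^s+y^s]≡ x y = begin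
    N P ≡⟨ Sums.Σ-cong E (λ w1 → trans (Sums.Σ-cong E (λ w2 →
              trans (Sums.ind-× (1# ≟F (w1 + w2)) ((w1 ^ s + w2 ^ s) ≟F P) 1ℤ)
              (trans (Sums.ind-⇔ ((1# ≟F (w1 + w2)) ×-dec ((w1 ^ s + w2 ^ s) ≟F P))
                                    ((w2 ≟F (1# - w1)) ×-dec ((w1 ^ s + (1# - w1) ^ s) ≟F P))
                                    (to w1 w2) (from w1 w2) 1ℤ)
                     (sym (Sums.ind-× (w2 ≟F (1# - w1)) ((w1 ^ s + (1# - w1) ^ s) ≟F P) 1ℤ)))))
            (ℤSum.Σ-delta E (1# - w1) (λ _ → ind ((w1 ^ s + (1# - w1) ^ s) ≟F P) 1ℤ) elements-unique (elements-complete _))) ⟩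
    Σ E (λ w1 → ind ((w1 ^ s + (1# - w1) ^ s) ≟F P) 1ℤ) ≡⟨ sym (ℤSum.Σ-bijection E elements-unique elements-complete (1# +_) (λ w → w - 1#)
         (λ w → solve 1 (λ w → con (ℤ.+ 1) :+ (w :- con (ℤ.+ 1)) := w) refl w) (λ z → solve 1 (λ z → (con (ℤ.+ 1) :+ z) :- con (ℤ.+ 1) := z) refl z)
         (λ w1 → ind ((w1 ^ s + (1# - w1) ^ s) ≟F P) 1ℤ)) ⟩
    Σ E (λ z → ind (((1# + z) ^ s + (1# - (1# + z)) ^ s) ≟F P) 1ℤ) ≡⟨ Sums.Σ-cong E (λ z →
          Sums.ind-⇔ (((1# + z) ^ s + (1# - (1# + z)) ^ s) ≟F P) (curve x y z ≟F 0#) (on-curve⇒ z) (⇒on-curve z) 1ℤ) ⟩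
    Σ E (λ z → ind (curve x y z ≟F 0#) 1ℤ) ∎
    where
    open ≡-Reasoning
    P = x ^ s + y ^ s
    to : ∀ w1 w2 → (1# ≡ w1 + w2) × (w1 ^ s + w2 ^ s ≡ P) → (w2 ≡ 1# - w1) × (w1 ^ s + (1# - w1) ^ s ≡ P)
    to w1 w2 (h1 , h2) = e , subst (λ v → w1 ^ s + v ^ s ≡ P) e h2
      where e : w2 ≡ 1# - w1
            e = trans (solve 2 (λ a b → b := (a :+ b) :- a) refl w1 w2) (cong (_- w1) (sym h1))
    from : ∀ w1 w2 → (w2 ≡ 1# - w1) × (w1 ^ s + (1# - w1) ^ s ≡ P) → (1# ≡ w1 + w2) × (w1 ^ s + w2 ^ s ≡ P)
    from w1 w2 (refl , h2) = solve 1 (λ a → con (ℤ.+ 1) := a :+ (con (ℤ.+ 1) :- a)) refl w1 , h2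
    [1-[1+z]]^s≡-z^s : ∀ z → (1# - (1# + z)) ^ s ≡ - (z ^ s)
    [1-[1+z]]^s≡-z^s z = trans (cong (_^ s) (solve 1 (λ z → con (ℤ.+ 1) :- (con (ℤ.+ 1) :+ z) := :- z) refl z)) (-‿^s z)
    on-curve⇒ : ∀ z → (1# + z) ^ s + (1# - (1# + z)) ^ s ≡ P → curve x y z ≡ 0#
    on-curve⇒ z h = begin
      (P + z ^ s) + - ((1# + z) ^ s) ≡⟨ cong (λ a → (a + z ^ s) + - ((1# + z) ^ s)) (sym (trans (cong ((1# + z) ^ s +_) (sym ([1-[1+z]]^s≡-z^s z))) h)) ⟩
      (((1# + z) ^ s + - (z ^ s)) + z ^ s) + - ((1# + z) ^ s) ≡⟨ solve 2 (λ O V → ((O :+ :- V) :+ V) :+ :- O := con (ℤ.+ 0)) refl ((1# + z) ^ s) (z ^ s) ⟩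
      0# ∎
    ⇒on-curve : ∀ z → curve x y z ≡ 0# → (1# + z) ^ s + (1# - (1# + z)) ^ s ≡ P
    ⇒on-curve z h = begin
      (1# + z) ^ s + (1# - (1# + z)) ^ s ≡⟨ cong ((1# + z) ^ s +_) ([1-[1+z]]^s≡-z^s z) ⟩
      (1# + z) ^ s + - (z ^ s) ≡⟨ solve 3 (λ O V P → O :+ :- V := P :+ :- ((P :+ V) :+ :- O)) refl ((1# + z) ^ s) (z ^ s) P ⟩
      P + - curve x y z ≡⟨ cong (λ a → P + - a) h ⟩
      P + - 0# ≡⟨ cong (P +_) -0#≈0# ⟩
      P + 0# ≡⟨ +-identityʳ P ⟩
      P ∎

  pointCount≡ΣV² : pointCount ≡ ΣV²
  pointCount≡ΣV² = sym (trans ΣV²≡ΣN² (trans ΣN²≡ (Sums.Σ-cong E (λ x → Sums.Σ-cong E (λ y → cong (ind (1# ≟F (x + y))) (N[x^s+y^s]≡ x y))))))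

  Σunits-W⁴≈ : Σᶜ U (λ u → (W u ⊗ W u) ⊗ (W u ⊗ W u)) ≈ intᶜ p (ℤ.+ (q ℕ.* q) *ℤ ΣV²)
  Σunits-W⁴≈ = ≐-≈-trans expand (≈-trans (Σunits-phase E⁴ powerSum₄ linearForm₄ Σψ[powerSum₄]≈0) (≈-≐-trans count
    (≡⇒≐ (cong (intᶜ p) (trans (sym (ℤP.*-assoc (ℤ.+ q) (ℤ.+ q) pointCount)) (cong₂ _*ℤ_ (sym (ℤP.pos-* q q)) pointCount≡ΣV²))))))


open import Data.Integer using (+_; 0ℤ) renaming (_*_ to _*ℤ_)
open import Data.List using (map)
open import Data.Product using (_×_; _,_)

lemma5p14 : (F : FiniteField) (p n s : ℕ) .{{_ : NonZero p}} →
    let open FiniteField F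
        open Paper F p n s
        q = order
        _≈_ = _≈ᶜ_ p
        _⊗_ = _*ᶜ_ p
        Σu = λ f → sumᶜ p (map f units)
    in Prime p → fromℕ p ≡ 0# → q ≡ p Data.Nat.^ n →
       0 < s → gcd s (q ∸ 1) ≡ 1 →
       ∀ t₁ t₂ t₃ → t₁ ≢ 0# → t₂ ≢ 0# → t₃ ≢ 0# →
         (Σu (λ u → W u) ≈ intᶜ p (+ q))
       × (t₁ ≡ t₂ → Σu (λ u → W (t₁ * u) ⊗ W (t₂ * u)) ≈ intᶜ p (+ (q Data.Nat.* q)))
       × (t₁ ≢ t₂ → Σu (λ u → W (t₁ * u) ⊗ W (t₂ * u)) ≈ intᶜ p 0ℤ)
       × (Σu (λ u → (W (t₁ * u) ⊗ W (t₂ * u)) ⊗ W (t₃ * u))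
            ≈ intᶜ p (+ (q Data.Nat.* q) *ℤ V t₁ t₂ (inv t₃)))
       × (Σu (λ u → (W u ⊗ W u) ⊗ (W u ⊗ W u))
            ≈ intᶜ p (+ (q Data.Nat.* q) *ℤ Data.List.foldr Data.Integer._+_ 0ℤ (map (λ u → V 1# 1# u *ℤ V 1# 1# u) units)))
lemma5p14 F p n s p-prime charF≡p q≡p^n 0<s gcd[s,q-1]≡1 t₁ t₂ t₃ t₁≢0 t₂≢0 t₃≢0 =
    ≈⇒≈ᶜ Σunits-W≈q
  , (λ t₁≡t₂ → ≈⇒≈ᶜ (Σunits-W⊗W≈q² t₁≡t₂))
  , (λ t₁≢t₂ → ≈⇒≈ᶜ (Σunits-W⊗W≈0 t₁≢t₂))
  , ≈⇒≈ᶜ (ThirdMoment.Σunits-W⊗W⊗W≈ t₁ t₂ t₃ t₁≢0 t₂≢0 t₃≢0)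
  , ≈⇒≈ᶜ Σunits-W⁴≈
  where
  open WeilSums₄ F p n s p-prime charF≡p q≡p^n 0<s gcd[s,q-1]≡1
  open SecondMoment t₁ t₂ t₁≢0 t₂≢0
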